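{- Let $k\ge 1$ be an integer. (1) If $G$ is a co-bipartite graph, then $X_G(x_1,\ldots,x_k)$ is SNP and its Newton polytope is the permutahedron $\mathcal{P}^{(k)}_{\lambda(G)}$. (2) If $d$ is a Dyck path with indifference graph $G(d)$, then $X_{G(d)}(x_1,\ldots,x_k)$ is SNP and its Newton polytope is the permutahedron $\mathcal{P}^{(k)}_{\lambda(d)}$, where $\lambda(d)=\lambda^{\mathrm{gr}}(d)$. (3) If $P$ is a (3+1)-free poset with incomparability graph $G(P)$, then $X_{G(P)}(x_1,\ldots,x_k)$ is SNP and its Newton polytope is the permutahedron $\mathcal{P}^{(k)}_{\lambda(P)}$, where $\lambda(P)=\lambda^{\mathrm{gr}}(P)$.
   Context: All graphs are finite and simple, all posets finite. A coloring $f$ of the vertices of $G$ is proper if adjacent vertices receive different colors. The chromatic symmetric polynomial in $k$ variables is $X_G(x_1,\ldots,x_k)=\sum_f \prod_{v\in V(G)}x_{f(v)}$, summed over all proper colorings $f:V(G)\to[k]=\{1,\dots,k\}$; $X_G$ is the symmetric function in infinitely many variables obtained in the same way with $f:V(G)\to\{1,2,\ldots\}$. The weight of $f$ is $\mathrm{wt}(f)=(|f^{ -1}(1)|,|f^{ -1}(2)|,\ldots)$. Newton polytopes. For $p=\sum_\alpha c_\alpha \mathbf{x}^\alpha\in\mathbb{R}[x_1,\ldots,x_k]$, $\mathrm{supp}(p)=\{\alpha: c_\alpha\ne0\}$ and $\mathrm{Newton}(p)=\mathrm{conv}(\mathrm{supp}(p))\subset\mathbb{R}^k$. $p$ is SNP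 (has saturated Newton polytope) if $\mathrm{supp}(p)=\mathrm{Newton}(p)\cap\mathbb{Z}^k$. For a partition $\lambda$ with exactly $\ell$ positive parts, if $k\ge \ell$ then $\mathcal{P}^{(k)}_\lambda$ is the convex hull in $\mathbb{R}^k$ of all permutations of $(\lambda_1,\ldots,\lambda_\ell,0,\ldots,0)$; if $k<\ell$ then $\mathcal{P}^{(k)}_\lambda=\emptyset$. Co-bipartite graphs. $G$ is co-bipartite if its complement is bipartite. If $G$ has $n$ vertices, the expansion of $X_G$ in monomial symmetric functions has the form $X_G=\sum_{i=0}^{\lfloor n/2\rfloor}c^G_{2^i1^{n-2i}}m_{2^i1^{n-2i}}$, and $\lambda(G)=2^j1^{n-2j}$ with $j$ maximal such that $c^G_{2^j1^{n-2j}}\neq0$. Dyck paths. A Dyck path $d$ of length $n$ is a lattice path from $(0,0)$ to $(n,n)$ with steps $\mathsf{n}=(0,1)$ and $\mathsf{e}=(1,0)$ not going below $y=x$. Its Hessenberg function $h_d:[n]\to[n]$ is: $h_d(i)$ is the number of unit squares in column $i$ below $d$, i.e. the number of $\mathsf n$ steps preceding the $i$-th $\mathsf e$ step. The indifference graph $G(d)$ has vertex set $[n]$ with an edge between $i<j$ iff $j\le h_d(i)$. The greedy coloring $\mathrm{gr}$ of $G(d)$ processes vertices in the order $1,2,\ldots,n$ and gives each vertex the smallest positive integer not used on its already colored neighbors; $\lambda^{\mathrm{gr}}(d)=\mathrm{wt}(\mathrm{gr})$ (it is a partition of $n$). Posets. A poset is (3+1)-free if there are no chain $a_1<a_2<a_3$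 and element $b$ with $b$ incomparable to $a_1,a_2,a_3$. The incomparability graph $G(P)$ has the elements of $P$ as vertices and edges joining incomparable pairs. Definition of $\lambda^{\mathrm{gr}}(P)$. A part listing is a finite word in the letters $v_i$ ($i\ge0$; a single vertex at level $i$) and $b_{i,i+1}(H)$ ($i\ge0$; $H$ a bicolored graph, i.e. a bipartite graph with a given ordered bipartition, whose lower color class is placed at level $i$ and upper color class at level $i+1$). Its associated poset is on the set of all vertices of all the parts, with $x<y$ iff one of the following holds: (i) $x,y$ are at levels $i,j$ with $j-i\ge2$; (ii) $x$ is exactly one level below $y$ and the part containing $x$ appears strictly before the part containing $y$ in the word; (iii) $x$ is exactly one level below $y$ and they are joined by an edge of a bicolored graph $H$ of the listing. It is known that every (3+1)-free poset is isomorphic to the poset of some part listing, and that the poset of a part listing with no letters $b_{i,i+1}(H)$ has incomparability graph isomorphic to $G(d)$ for some Dyck path $d$. Given a (3+1)-free poset $P$, take a part listing $L$ for $P$. For each part $b_{i,i+1}(H)$ of $L$, with $r$ lower and $s$ upper vertices, let $q_j$ be the probability that $H$ and a uniformly random matching with $\min(r,s)$ edges between lower and upper vertices have exactly $j$ edges in common, let $j$ be the largest index with $q_j\ne0$, and replace the part by the word $v_{i+1}^{s-j}v_i^rv_{i+1}^j$ if $r\ge s$, and by $v_i^jv_{i+1}^sv_i^{r-j}$ if $r<s$. The resulting listing has only letters $v_i$; the incomparability graph of its poset is isomorphic to $G(d)$ for a Dyck path $d$, and $\lambda^{\mathrm{gr}}(P):=\lambda^{\mathrm{gr}}(d)$.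 The statement is asserted for any such choice of $L$ and $d$. -}

module Defs where

open import Level using (0ℓ)
open import Function.Base using (_∘_)
open import Data.Bool.Base using (Bool; true; false; T)
open import Data.Empty using (⊥)
open import Data.Fin.Base as Fin using (Fin; toℕ)
open import Data.Fin.Properties as Fin using (all?)
open import Data.Fin.Subset using (Subset; _∩_; ∣_∣)
import Data.Fin.Subset as Subset
import Data.Fin.Subset.Properties as Subset
open import Data.Integer.Base as ℤ using (ℤ)
open import Data.List.Base as List
  using (List; []; _∷_; _++_; length; filter; foldr; upTo; allFin; cartesianProductWith)
open import Data.List.Relation.Binary.Permutation.Propositional using (_↭_)
open import Data.Nat.Base as ℕ using (ℕ; zero; suc)
import Data.Nat.Properties as ℕ
open import Data.List.Membership.DecPropositional ℕ._≟_ using (_∈?_)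
open import Data.Product.Base using (Σ; Σ-syntax; ∃-syntax; _×_; _,_; proj₁; proj₂)
open import Data.Rational.Base as ℚ using (ℚ; 0ℚ; 1ℚ)
import Data.Rational.Properties as ℚ
open import Data.Sum.Base using (_⊎_; inj₁; inj₂)
open import Data.Unit.Base using (⊤)
open import Data.Vec.Base as Vec using (Vec; []; _∷_; lookup)
import Data.Vec.Properties as Vec
import Data.Vec.Functional as Vector
open import Relation.Binary.Core using (Rel)
open import Relation.Binary.Definitions using (Symmetric; Irreflexive; Decidable)
open import Relation.Binary.Morphism.Structures using (IsOrderIsomorphism)
open import Relation.Binary.PropositionalEquality
  using (_≡_; _≢_; refl; sym; trans; cong; cong₂; subst; module ≡-Reasoning)
open import Relation.Binary.Structures using (IsDecStrictPartialOrder)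
open import Relation.Nullary.Decidable.Core using (yes; no; ¬?; _×-dec_; _→-dec_; _⊎-dec_)
open import Relation.Nullary.Negation.Core using (¬_)
open import Relation.Unary using (Pred; _≐_)
import Relation.Unary as Unary

-- The real numbers, as Cauchy sequences of rationals up to _≈_

record ℝ : Set where
  constructor mkℝ
  field
    seq    : ℕ → ℚ
    cauchy : ∀ ε → 0ℚ ℚ.< ε → ∃[ N ] ∀ m n → N ℕ.≤ m → N ℕ.≤ n → ℚ.∣ seq m ℚ.- seq n ∣ ℚ.< ε
open ℝ public

infix 4 _≈_ _≤_

_≈_ : Rel ℝ 0ℓ
x ≈ y = ∀ ε → 0ℚ ℚ.< ε → ∃[ N ] ∀ n → N ℕ.≤ n → ℚ.∣ seq x n ℚ.- seq y n ∣ ℚ.< ε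

_≤_ : Rel ℝ 0ℓ
x ≤ y = ∀ ε → 0ℚ ℚ.< ε → ∃[ N ] ∀ n → N ℕ.≤ n → seq x n ℚ.≤ seq y n ℚ.+ ε

fromℚ : ℚ → ℝ
fromℚ q .seq _ = q
fromℚ q .cauchy ε 0<ε = 0 , λ _ _ _ _ →
  subst (ℚ._< ε) (sym (cong ℚ.∣_∣ (ℚ.+-inverseʳ q))) 0<ε

0ℝ 1ℝ : ℝ
0ℝ = fromℚ 0ℚ
1ℝ = fromℚ 1ℚ

fromℤ : ℤ → ℝ
fromℤ z = fromℚ (z ℚ./ 1)

private
  split : ∀ ε → 0ℚ ℚ.< ε → ∀ b .{{_ : ℚ.Positive b}} →
          ∃[ δ ] 0ℚ ℚ.< δ × δ ℚ.* b ≡ ε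
  split ε 0<ε b = ε ℚ.* b⁻¹ , ℚ.positive⁻¹ _ {{ε⁺}} ,
    trans (ℚ.*-assoc ε b⁻¹ b) (trans (cong (ε ℚ.*_) (ℚ.*-inverseˡ b {{b≢0}})) (ℚ.*-identityʳ ε))
    where
    b≢0 = ℚ.pos⇒nonZero b
    b⁻¹ = (ℚ.1/ b) {{b≢0}}
    ε⁺ : ℚ.Positive (ε ℚ.* b⁻¹)
    ε⁺ = ℚ.pos*pos⇒pos ε {{ℚ.positive 0<ε}} b⁻¹ {{ℚ.1/pos⇒pos b}}

  +-exchange : ∀ a b c d → (a ℚ.+ b) ℚ.- (c ℚ.+ d) ≡ (a ℚ.- c) ℚ.+ (b ℚ.- d)
  +-exchange a b c d = trans (cong ((a ℚ.+ b) ℚ.+_) (ℚ.neg-distrib-+ c d))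
                             (interchange a b (ℚ.- c) (ℚ.- d))
    where
    open import Algebra.Bundles using (CommutativeMonoid)
    open CommutativeMonoid ℚ.+-0-commutativeMonoid using (commutativeSemigroup)
    open import Algebra.Properties.CommutativeSemigroup commutativeSemigroup using (interchange)

  recentre : ∀ a b → b ℚ.+ (a ℚ.- b) ≡ a
  recentre a b = trans (sym (ℚ.+-assoc b a (ℚ.- b))) (xyx⁻¹≈y b a)
    where open import Algebra.Properties.AbelianGroup ℚ.+-0-abelianGroup using (xyx⁻¹≈y)

  telescope : ∀ a b c → (c ℚ.- b) ℚ.+ (a ℚ.- c) ≡ a ℚ.- b
  telescope a b c = begin
    (c ℚ.- b) ℚ.+ (a ℚ.- c)   ≡⟨ ℚ.+-comm (c ℚ.- b) (a ℚ.- c) ⟩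
    (a ℚ.- c) ℚ.+ (c ℚ.- b)   ≡⟨ ℚ.+-assoc (a ℚ.- c) c (ℚ.- b) ⟨
    ((a ℚ.- c) ℚ.+ c) ℚ.- b   ≡⟨ cong (ℚ._- b) (ℚ.+-comm (a ℚ.- c) c) ⟩
    (c ℚ.+ (a ℚ.- c)) ℚ.- b   ≡⟨ cong (ℚ._- b) (recentre a c) ⟩
    a ℚ.- b                   ∎
    where open ≡-Reasoning

  *-distribˡ-- : ∀ a b c → a ℚ.* (b ℚ.- c) ≡ a ℚ.* b ℚ.- a ℚ.* c
  *-distribˡ-- a b c = trans (ℚ.*-distribˡ-+ a b (ℚ.- c))
                             (cong (a ℚ.* b ℚ.+_) (sym (ℚ.neg-distribʳ-* a c)))

  *-exchange : ∀ a b c d → a ℚ.* b ℚ.- c ℚ.* d ≡ a ℚ.* (b ℚ.- d) ℚ.+ d ℚ.* (a ℚ.- c)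
  *-exchange a b c d = sym (begin
    a ℚ.* (b ℚ.- d) ℚ.+ d ℚ.* (a ℚ.- c)
      ≡⟨ cong₂ ℚ._+_ (*-distribˡ-- a b d) (*-distribˡ-- d a c) ⟩
    (a ℚ.* b ℚ.- a ℚ.* d) ℚ.+ (d ℚ.* a ℚ.- d ℚ.* c)
      ≡⟨ cong₂ (λ e f → (a ℚ.* b ℚ.- a ℚ.* d) ℚ.+ (e ℚ.- f)) (ℚ.*-comm d a) (ℚ.*-comm d c) ⟩
    (a ℚ.* b ℚ.- a ℚ.* d) ℚ.+ (a ℚ.* d ℚ.- c ℚ.* d)
      ≡⟨ ℚ.+-comm (a ℚ.* b ℚ.- a ℚ.* d) (a ℚ.* d ℚ.- c ℚ.* d) ⟩
    (a ℚ.* d ℚ.- c ℚ.* d) ℚ.+ (a ℚ.* b ℚ.- a ℚ.* d)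
      ≡⟨ telescope (a ℚ.* b) (c ℚ.* d) (a ℚ.* d) ⟩
    a ℚ.* b ℚ.- c ℚ.* d ∎)
    where open ≡-Reasoning

  eventuallyBounded : ∀ x → ∃[ B ] ℚ.Positive B ×
    ∃[ N ] ∀ n → N ℕ.≤ n → ℚ.∣ seq x n ∣ ℚ.≤ B
  eventuallyBounded x with cauchy x 1ℚ (ℚ.positive⁻¹ 1ℚ)
  ... | N , close = B , ℚ.nonNeg+pos⇒pos ℚ.∣ a ∣ {{ℚ.nonNegative (ℚ.0≤∣p∣ a)}} 1ℚ , N , bound
    where
    a = seq x N
    B = ℚ.∣ a ∣ ℚ.+ 1ℚ
    open ℚ.≤-Reasoning
    bound : ∀ n → N ℕ.≤ n → ℚ.∣ seq x n ∣ ℚ.≤ B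
    bound n N≤n = begin
      ℚ.∣ seq x n ∣                     ≡⟨ cong ℚ.∣_∣ (recentre (seq x n) a) ⟨
      ℚ.∣ a ℚ.+ (seq x n ℚ.- a) ∣       ≤⟨ ℚ.∣p+q∣≤∣p∣+∣q∣ a (seq x n ℚ.- a) ⟩
      ℚ.∣ a ∣ ℚ.+ ℚ.∣ seq x n ℚ.- a ∣   ≤⟨ ℚ.+-monoʳ-≤ ℚ.∣ a ∣ (ℚ.<⇒≤ (close n N N≤n ℕ.≤-refl)) ⟩
      B                                 ∎

infixl 6 _+_
infixl 7 _*_

_+_ : ℝ → ℝ → ℝ
(x + y) .seq n = seq x n ℚ.+ seq y n
(x + y) .cauchy ε 0<ε with split ε 0<ε (1ℚ ℚ.+ 1ℚ)
... | δ , 0<δ , δ+δ≡ε with cauchy x δ 0<δ | cauchy y δ 0<δ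
... | M , xclose | N , yclose = M ℕ.⊔ N , close
  where
  open ℚ.≤-Reasoning
  close : ∀ m n → M ℕ.⊔ N ℕ.≤ m → M ℕ.⊔ N ℕ.≤ n →
          ℚ.∣ (seq x m ℚ.+ seq y m) ℚ.- (seq x n ℚ.+ seq y n) ∣ ℚ.< ε
  close m n p q = begin-strict
    ℚ.∣ (seq x m ℚ.+ seq y m) ℚ.- (seq x n ℚ.+ seq y n) ∣
      ≡⟨ cong ℚ.∣_∣ (+-exchange (seq x m) (seq y m) (seq x n) (seq y n)) ⟩
    ℚ.∣ (seq x m ℚ.- seq x n) ℚ.+ (seq y m ℚ.- seq y n) ∣
      ≤⟨ ℚ.∣p+q∣≤∣p∣+∣q∣ (seq x m ℚ.- seq x n) (seq y m ℚ.- seq y n) ⟩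
    ℚ.∣ seq x m ℚ.- seq x n ∣ ℚ.+ ℚ.∣ seq y m ℚ.- seq y n ∣
      <⟨ ℚ.+-mono-< (xclose m n (ℕ.m⊔n≤o⇒m≤o M N p) (ℕ.m⊔n≤o⇒m≤o M N q))
                    (yclose m n (ℕ.m⊔n≤o⇒n≤o M N p) (ℕ.m⊔n≤o⇒n≤o M N q)) ⟩
    δ ℚ.+ δ                      ≡⟨ cong₂ ℚ._+_ (ℚ.*-identityʳ δ) (ℚ.*-identityʳ δ) ⟨
    δ ℚ.* 1ℚ ℚ.+ δ ℚ.* 1ℚ        ≡⟨ ℚ.*-distribˡ-+ δ 1ℚ 1ℚ ⟨
    δ ℚ.* (1ℚ ℚ.+ 1ℚ)            ≡⟨ δ+δ≡ε ⟩
    ε                            ∎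

_*_ : ℝ → ℝ → ℝ
(x * y) .seq n = seq x n ℚ.* seq y n
(x * y) .cauchy ε 0<ε with eventuallyBounded x | eventuallyBounded y
... | A , A⁺ , K , xbound | B , B⁺ , L , ybound
  with split ε 0<ε (A ℚ.+ B) {{ℚ.pos+pos⇒pos A {{A⁺}} B {{B⁺}}}}
... | δ , 0<δ , δ[A+B]≡ε with cauchy x δ 0<δ | cauchy y δ 0<δ
... | M , xclose | N , yclose = R , close
  where
  open ℚ.≤-Reasoning
  R = (K ℕ.⊔ L) ℕ.⊔ (M ℕ.⊔ N)

  product : ∀ a b C → ℚ.Positive C → ℚ.∣ a ∣ ℚ.≤ C → ℚ.∣ b ∣ ℚ.< δ → ℚ.∣ a ℚ.* b ∣ ℚ.< δ ℚ.* C
  product a b C C⁺ a≤C b<δ = begin-strict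
    ℚ.∣ a ℚ.* b ∣          ≡⟨ ℚ.∣p*q∣≡∣p∣*∣q∣ a b ⟩
    ℚ.∣ a ∣ ℚ.* ℚ.∣ b ∣    ≤⟨ ℚ.*-monoʳ-≤-nonNeg ℚ.∣ b ∣ {{ℚ.nonNegative (ℚ.0≤∣p∣ b)}} a≤C ⟩
    C ℚ.* ℚ.∣ b ∣          <⟨ ℚ.*-monoʳ-<-pos C {{C⁺}} b<δ ⟩
    C ℚ.* δ                ≡⟨ ℚ.*-comm C δ ⟩
    δ ℚ.* C                ∎

  close : ∀ m n → R ℕ.≤ m → R ℕ.≤ n → ℚ.∣ seq x m ℚ.* seq y m ℚ.- seq x n ℚ.* seq y n ∣ ℚ.< ε
  close m n p q = begin-strict
    ℚ.∣ seq x m ℚ.* seq y m ℚ.- seq x n ℚ.* seq y n ∣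
      ≡⟨ cong ℚ.∣_∣ (*-exchange (seq x m) (seq y m) (seq x n) (seq y n)) ⟩
    ℚ.∣ seq x m ℚ.* (seq y m ℚ.- seq y n) ℚ.+ seq y n ℚ.* (seq x m ℚ.- seq x n) ∣
      ≤⟨ ℚ.∣p+q∣≤∣p∣+∣q∣ (seq x m ℚ.* (seq y m ℚ.- seq y n)) (seq y n ℚ.* (seq x m ℚ.- seq x n)) ⟩
    ℚ.∣ seq x m ℚ.* (seq y m ℚ.- seq y n) ∣ ℚ.+ ℚ.∣ seq y n ℚ.* (seq x m ℚ.- seq x n) ∣
      <⟨ ℚ.+-mono-<
           (product (seq x m) _ A A⁺ (xbound m (ℕ.m⊔n≤o⇒m≤o K L (KL p)))
             (yclose m n (ℕ.m⊔n≤o⇒n≤o M N (MN p)) (ℕ.m⊔n≤o⇒n≤o M N (MN q))))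
           (product (seq y n) _ B B⁺ (ybound n (ℕ.m⊔n≤o⇒n≤o K L (KL q)))
             (xclose m n (ℕ.m⊔n≤o⇒m≤o M N (MN p)) (ℕ.m⊔n≤o⇒m≤o M N (MN q)))) ⟩
    δ ℚ.* A ℚ.+ δ ℚ.* B   ≡⟨ ℚ.*-distribˡ-+ δ A B ⟨
    δ ℚ.* (A ℚ.+ B)       ≡⟨ δ[A+B]≡ε ⟩
    ε                     ∎
    where
    KL : ∀ {o} → R ℕ.≤ o → K ℕ.⊔ L ℕ.≤ o
    KL = ℕ.m⊔n≤o⇒m≤o (K ℕ.⊔ L) (M ℕ.⊔ N)
    MN : ∀ {o} → R ℕ.≤ o → M ℕ.⊔ N ℕ.≤ o
    MN = ℕ.m⊔n≤o⇒n≤o (K ℕ.⊔ L) (M ℕ.⊔ N)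

------------------------------------------------------------------------

Point : ℕ → Set
Point k = Fin k → ℝ

sumℝ : ∀ {m} → (Fin m → ℝ) → ℝ
sumℝ = Vector.foldr _+_ 0ℝ

record Conv {k} (S : Pred (Point k) 0ℓ) (x : Point k) : Set where
  field
    size       : ℕ
    point      : Fin size → Point k
    weight     : Fin size → ℝ
    point∈S    : ∀ j → S (point j)
    weight≥0   : ∀ j → 0ℝ ≤ weight j
    weights≈1  : sumℝ weight ≈ 1ℝ
    x≈combine  : ∀ i → x i ≈ sumℝ (λ j → weight j * point j i)

embed : ∀ {k} → Vec ℤ k → Point k
embed z i = fromℤ (lookup z i)

-- A set of lattice points, regarded as a subset of ℝᵏ.
Embedded : ∀ {k} → Pred (Vec ℤ k) 0ℓ → Pred (Point k) 0ℓ
Embedded S x = ∃[ z ] S z × (∀ i → x i ≈ embed z i)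

-- Partitions are lists of parts.  Zero parts are ignored, and the order of the
-- parts is irrelevant to the permutahedron.
positiveParts : List ℕ → List ℕ
positiveParts = filter (0 ℕ.<?_)

-- The permutations of (λ₁,…,λ_ℓ,0,…,0) ∈ ℤᵏ.
PermutationOf : ∀ {k} → List ℕ → Pred (Vec ℤ k) 0ℓ
PermutationOf {k} μ z = ∃[ α ] z ≡ Vec.map ℤ.+_ α ×
  Vec.toList α ↭ positiveParts μ ++ List.replicate (k ℕ.∸ length (positiveParts μ)) 0

Permutahedron : ∀ k → List ℕ → Pred (Point k) 0ℓ
Permutahedron k μ x = length (positiveParts μ) ℕ.≤ k × Conv (Embedded (PermutationOf μ)) x

------------------------------------------------------------------------

-- Polynomials in x₁,…,x_k.  Integer coefficients suffice for X_G, and the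
-- Newton polytope depends only on which coefficients vanish.

-- A formal sum of terms c·x^α; a monomial may occur in several terms.
Poly : ℕ → Set
Poly k = List (ℤ × Vec ℕ k)

module _ {k : ℕ} where

  1ₚ : Poly k
  1ₚ = (ℤ.1ℤ , Vec.replicate k 0) ∷ []

  var : Fin k → Poly k
  var i = (ℤ.1ℤ , Vec.replicate k 0 Vec.[ i ]≔ 1) ∷ []

  _*ₚ_ : Poly k → Poly k → Poly k
  _*ₚ_ = cartesianProductWith λ (c , α) (d , β) → c ℤ.* d , Vec.zipWith ℕ._+_ α β

  sumₚ productₚ : List (Poly k) → Poly k
  sumₚ     = foldr _++_ []
  productₚ = foldr _*ₚ_ 1ₚ

  coeff : Poly k → Vec ℕ k → ℤ
  coeff p α = foldr ℤ._+_ ℤ.0ℤ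
    (List.map proj₁ (filter (λ t → Vec.≡-dec ℕ._≟_ (proj₂ t) α) p))

  supp : Poly k → Pred (Vec ℤ k) 0ℓ
  supp p z = ∃[ α ] z ≡ Vec.map ℤ.+_ α × coeff p α ≢ ℤ.0ℤ

  Newton : Poly k → Pred (Point k) 0ℓ
  Newton p = Conv (Embedded (supp p))

  SNP : Poly k → Set
  SNP p = supp p ≐ (λ z → Newton p (embed z))

------------------------------------------------------------------------

record Graph (n : ℕ) : Set₁ where
  field
    Adj    : Rel (Fin n) 0ℓ
    irrefl : Irreflexive _≡_ Adj
    symm   : Symmetric Adj
    adj?   : Decidable Adj
open Graph public

allVecs : ∀ {A : Set} → List A → ∀ n → List (Vec A n)
allVecs xs zero    = [] ∷ []
allVecs xs (suc n) = cartesianProductWith _∷_ xs (allVecs xs n)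

-- A colouring f is the vector of its values.
Proper : ∀ {n k} → Graph n → Pred (Vec (Fin k) n) 0ℓ
Proper G f = ∀ u v → Adj G u v → lookup f u ≢ lookup f v

proper? : ∀ {n k} (G : Graph n) → Unary.Decidable (Proper {n} {k} G)
proper? G f = all? λ u → all? λ v → adj? G u v →-dec ¬? (lookup f u Fin.≟ lookup f v)

X : ∀ {n} → Graph n → (k : ℕ) → Poly k
X {n} G k = sumₚ (List.map (λ f → productₚ (List.map (λ v → var (lookup f v)) (allFin n)))
                           (filter (proper? G) (allVecs (allFin k) n)))

-- The coefficient of m_μ in the symmetric function X_G is the coefficient of
-- x₁^μ₁⋯x_ℓ^μ_ℓ, for ℓ = length μ.  This monomial involves x₁,…,x_ℓ only, so it
-- has the same coefficient in the polynomial X_G(x₁,…,x_ℓ).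
monomialCoeff : ∀ {n} → Graph n → List ℕ → ℤ
monomialCoeff G μ = coeff (X G (length μ)) (Vec.fromList μ)

-- The largest j ≤ b satisfying P; equal to 0 if there is none.
largest : ∀ {P : Pred ℕ 0ℓ} → Unary.Decidable P → ℕ → ℕ
largest P? zero = zero
largest P? (suc b) with P? (suc b)
... | yes _ = suc b
... | no  _ = largest P? b

complement : ∀ {n} → Graph n → Graph n
complement G .Adj u v = u ≢ v × ¬ Adj G u v
complement G .irrefl refl (u≢u , _) = u≢u refl
complement G .symm (u≢v , ¬uv) = u≢v ∘ sym , ¬uv ∘ symm G
complement G .adj? u v = ¬? (u Fin.≟ v) ×-dec ¬? (adj? G u v)

Bipartite : ∀ {n} → Graph n → Set
Bipartite {n} G = Σ[ side ∈ (Fin n → Bool) ] (∀ u v → Adj G u v → side u ≢ side v)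

CoBipartite : ∀ {n} → Graph n → Set
CoBipartite G = Bipartite (complement G)

-- 2ʲ1ⁿ⁻²ʲ
twosOnes : ℕ → ℕ → List ℕ
twosOnes n j = List.replicate j 2 ++ List.replicate (n ℕ.∸ 2 ℕ.* j) 1

λ-coBipartite : ∀ {n} → Graph n → List ℕ
λ-coBipartite {n} G = twosOnes n
  (largest (λ j → ¬? (monomialCoeff G (twosOnes n j) ℤ.≟ ℤ.0ℤ)) ℕ.⌊ n /2⌋)
  where import Data.Integer.Properties as ℤ

------------------------------------------------------------------------

-- The smallest positive integer not in the list: one of 1,…,1+length is free.
smallestUnused : List ℕ → ℕ
smallestUnused cs = search (length cs) 1
  where
  search : ℕ → ℕ → ℕ
  search zero       c = c
  search (suc fuel) c with c ∈? cs
  ... | yes _ = search fuel (suc c)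
  ... | no  _ = c

-- The state lists the vertices coloured so far with their colours.
greedyStep : ∀ {n} → Graph n → List (Fin n × ℕ) → Fin n → List (Fin n × ℕ)
greedyStep G done v =
  (v , smallestUnused (List.map proj₂ (filter (λ (u , _) → adj? G u v) done))) ∷ done

greedy : ∀ {n} → Graph n → List (Fin n × ℕ)
greedy {n} G = List.foldl (greedyStep G) [] (allFin n)

-- The weight (|gr⁻¹(1)|,…,|gr⁻¹(n)|); greedy uses no colour above n.
greedyWeight : ∀ {n} → Graph n → List ℕ
greedyWeight {n} G = List.map
  (λ i → length (filter (λ (_ , c) → c ℕ.≟ suc i) (greedy G))) (upTo n)

------------------------------------------------------------------------

data Step : Set where
  north east : Step

norths easts : List Step → ℕ
norths []          = 0
norths (north ∷ w) = suc (norths w)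
norths (east ∷ w)  = norths w
easts []           = 0
easts (north ∷ w)  = easts w
easts (east ∷ w)   = suc (easts w)

record DyckPath (n : ℕ) : Set where
  field
    steps    : List Step
    norths≡n : norths steps ≡ n
    easts≡n  : easts steps ≡ n
    above    : ∀ m → easts (List.take m steps) ℕ.≤ norths (List.take m steps)
open DyckPath public

-- The number of north steps preceding the east step number i, counted from 0.
northsBefore : List Step → ℕ → ℕ
northsBefore []          _       = 0
northsBefore (north ∷ w) i       = suc (northsBefore w i)
northsBefore (east ∷ w)  zero    = 0
northsBefore (east ∷ w)  (suc i) = northsBefore w i

hessenberg : ∀ {n} → DyckPath n → Fin n → ℕ
hessenberg d i = northsBefore (steps d) (toℕ i)

-- Vertex i : Fin n stands for the vertex 1 + toℕ i of [n], so that the condition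
-- j ≤ h(i) on [n] becomes toℕ j < h(i).
indifferenceGraph : ∀ {n} → DyckPath n → Graph n
indifferenceGraph {n} d = record
  { Adj    = λ i j → Joined i j ⊎ Joined j i
  ; irrefl = λ { refl (inj₁ (i<i , _)) → ℕ.<-irrefl refl i<i
               ; refl (inj₂ (i<i , _)) → ℕ.<-irrefl refl i<i }
  ; symm   = λ { (inj₁ e) → inj₂ e ; (inj₂ e) → inj₁ e }
  ; adj?   = λ i j → joined? i j ⊎-dec joined? j i
  }
  where
  Joined : Rel (Fin n) 0ℓ
  Joined i j = toℕ i ℕ.< toℕ j × toℕ j ℕ.< hessenberg d i
  joined? : Decidable Joined
  joined? i j = (toℕ i ℕ.<? toℕ j) ×-dec (toℕ j ℕ.<? hessenberg d i)

λ-greedy : ∀ {n} → DyckPath n → List ℕ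
λ-greedy d = greedyWeight (indifferenceGraph d)

------------------------------------------------------------------------

record FinPoset (n : ℕ) : Set₁ where
  field
    _⊏_                     : Rel (Fin n) 0ℓ
    isDecStrictPartialOrder : IsDecStrictPartialOrder _≡_ _⊏_
  open IsDecStrictPartialOrder isDecStrictPartialOrder public using (_<?_)

Incomparable : ∀ {A : Set} → Rel A 0ℓ → Rel A 0ℓ
Incomparable _⊏_ x y = x ≢ y × ¬ (x ⊏ y) × ¬ (y ⊏ x)

ThreePlusOneFree : ∀ {n} → FinPoset n → Set
ThreePlusOneFree P = ∀ a₁ a₂ a₃ b → a₁ ⊏ a₂ → a₂ ⊏ a₃ →
  ¬ (Incomparable _⊏_ b a₁ × Incomparable _⊏_ b a₂ × Incomparable _⊏_ b a₃)
  where open FinPoset P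

incomparabilityGraph : ∀ {n} → FinPoset n → Graph n
incomparabilityGraph P = record
  { Adj    = Incomparable _⊏_
  ; irrefl = λ { refl (x≢x , _) → x≢x refl }
  ; symm   = λ (x≢y , ¬xy , ¬yx) → x≢y ∘ sym , ¬yx , ¬xy
  ; adj?   = λ x y → ¬? (x Fin.≟ y) ×-dec (¬? (x <? y) ×-dec ¬? (y <? x))
  }
  where open FinPoset P

-- For bare relations: used both for orders and for adjacency relations.
Isomorphic : ∀ {A B : Set} → Rel A 0ℓ → Rel B 0ℓ → Set
Isomorphic {A} {B} R S = Σ[ φ ∈ (A → B) ] IsOrderIsomorphism _≡_ _≡_ R S φ

------------------------------------------------------------------------

-- A bicoloured graph with lower class Fin r and upper class Fin s, given by the
-- set of upper neighbours of each lower vertex.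
BicolouredGraph : ℕ → ℕ → Set
BicolouredGraph r s = Vec (Subset s) r

module _ {r s : ℕ} where

  Edge : BicolouredGraph r s → Fin r → Fin s → Set
  Edge H a b = b Subset.∈ lookup H a

  edgeCount : BicolouredGraph r s → ℕ
  edgeCount H = Vec.sum (Vec.map ∣_∣ H)

  commonEdges : BicolouredGraph r s → BicolouredGraph r s → ℕ
  commonEdges H M = edgeCount (Vec.zipWith _∩_ H M)

  -- A matching with min(r,s) edges: no two distinct edges share an endpoint.
  MaximumMatching : Pred (BicolouredGraph r s) 0ℓ
  MaximumMatching M =
    (∀ a b a′ b′ → Edge M a b → Edge M a′ b′ → (a ≡ a′ → b ≡ b′) × (b ≡ b′ → a ≡ a′))
    × edgeCount M ≡ r ℕ.⊓ s

  maximumMatching? : Unary.Decidable MaximumMatching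
  maximumMatching? M =
    (all? λ a → all? λ b → all? λ a′ → all? λ b′ →
      (b Subset.∈? lookup M a) →-dec ((b′ Subset.∈? lookup M a′) →-dec
        (((a Fin.≟ a′) →-dec (b Fin.≟ b′)) ×-dec ((b Fin.≟ b′) →-dec (a Fin.≟ a′)))))
    ×-dec (edgeCount M ℕ.≟ r ℕ.⊓ s)

  maximumMatchings : List (BicolouredGraph r s)
  maximumMatchings = filter maximumMatching?
    (allVecs (allVecs (true ∷ false ∷ []) s) r)

-- The probability that a uniformly random entry of the list satisfies P (0 for
-- the empty list, which does not arise from maximumMatchings).
probability : ∀ {A : Set} {P : Pred A 0ℓ} → Unary.Decidable P → List A → ℚ
probability P? []            = 0ℚ
probability P? xs@(_ ∷ _)    = ℤ.+ length (filter P? xs) ℚ./ length xs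

q : ∀ {r s} → BicolouredGraph r s → ℕ → ℚ
q H j = probability (λ M → commonEdges H M ℕ.≟ j) maximumMatchings

maxCommon : ∀ {r s} → BicolouredGraph r s → ℕ
maxCommon {r} {s} H = largest (λ j → ¬? (q H j ℚ.≟ 0ℚ)) (r ℕ.⊓ s)

------------------------------------------------------------------------

data Part : Set where
  v : (i : ℕ) → Part
  b : (i r s : ℕ) (H : BicolouredGraph r s) → Part

Listing : Set
Listing = List Part

PartVertex : Part → Set
PartVertex (v i)       = ⊤
PartVertex (b i r s H) = Fin r ⊎ Fin s

partLevel : ∀ p → PartVertex p → ℕ
partLevel (v i)       _        = i
partLevel (b i r s H) (inj₁ _) = i
partLevel (b i r s H) (inj₂ _) = suc i

JoinedInPart : ∀ p → Rel (PartVertex p) 0ℓ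
JoinedInPart (b i r s H) (inj₁ x) (inj₂ y) = Edge H x y
JoinedInPart _           _        _        = ⊥

module _ (L : Listing) where

  Vertex : Set
  Vertex = Σ[ t ∈ Fin (length L) ] PartVertex (List.lookup L t)

  level : Vertex → ℕ
  level (t , x) = partLevel (List.lookup L t) x

  data JoinedByEdge : Rel Vertex 0ℓ where
    joined : ∀ {t x y} → JoinedInPart (List.lookup L t) x y → JoinedByEdge (t , x) (t , y)

  ListingOrder : Rel Vertex 0ℓ
  ListingOrder x y =
    (2 ℕ.+ level x ℕ.≤ level y)
    ⊎ (suc (level x) ≡ level y × proj₁ x Fin.< proj₁ y)
    ⊎ (suc (level x) ≡ level y × JoinedByEdge x y)

replacePart : Part → Listing
replacePart (v i) = v i ∷ []
replacePart (b i r s H) with s ℕ.≤? r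
... | yes _ = List.replicate (s ℕ.∸ maxCommon H) (v (suc i)) ++ List.replicate r (v i)
              ++ List.replicate (maxCommon H) (v (suc i))
... | no  _ = List.replicate (maxCommon H) (v i) ++ List.replicate s (v (suc i))
              ++ List.replicate (r ℕ.∸ maxCommon H) (v i)

replaceParts : Listing → Listing
replaceParts = List.concatMap replacePart

-- μ is a value of λ^gr(P), obtained from some choice of part listing and Dyck path.
record IsGreedyPartition {n} (P : FinPoset n) (μ : List ℕ) : Set where
  field
    listing   : Listing
    P≅listing : Isomorphic (FinPoset._⊏_ P) (ListingOrder listing)
    size      : ℕ
    path      : DyckPath size
    inc≅path  : Isomorphic (Incomparable (ListingOrder (replaceParts listing)))
                           (Adj (indifferenceGraph path))
    μ≡λ       : μ ≡ λ-greedy path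

{-# OPTIONS --safe #-}
module Submission where

-- Fix a graph whose set W of weights of proper colourings is closed under permutations
-- and under box moves (x+1, y) ↦ (x, y+1) for y < x, and let λ ∈ W dominate all weights.
-- Every α dominated by λ arises from λ by box moves, and a box move stays on the segment
-- between two permutations of a weight; hence W, its convex hull and the permutahedron of
-- λ contain the same lattice points.
--
-- For co-bipartite graphs classes have at most two vertices and everything is explicit.
-- For unit interval graphs, a box move exchanges two colours on an initial segment of the
-- vertices, cut where the two classes are not linked, and the first m colours of the greedy
-- colouring cover a largest m-colourable set. For part listings, the two levels of a
-- bicoloured part can carry any two sets of colours with at most ν common elements, where ν
-- is the size of a largest matching between them. The word replacing the part realises
-- exactly the same sets, so that the poset has the same weights as the unit interval graph.

open import Defs renaming
  (_+_ to _+ʳ_; _*_ to _*ʳ_; _≤_ to _≤ʳ_; _≈_ to _≈ʳ_; v to single; b to double; q to commonProbability)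
open import Level using (0ℓ)
open import Function.Base using (_∘_; id; case_of_)
open import Function.Bundles using (_↔_; Inverse; mk↔ₛ′)
open import Data.Bool.Base using (Bool; true; false)
open import Data.Empty using (⊥; ⊥-elim)
open import Data.Fin.Base as Fin using (Fin; toℕ; fromℕ<)
import Data.Fin.Properties as Fin
import Data.Fin.Subset as Subset
open import Data.Fin.Subset using (Subset)
import Data.Fin.Subset.Properties as Subset
open import Data.Integer.Base as ℤ using (ℤ)
import Data.Integer.Properties as ℤ
open import Data.List.Base hiding (sum; product; and; or; all; any)
open import Data.Nat.ListAction using (sum)
open import Data.Nat.ListAction.Properties using (sum-++; sum-↭)
open import Data.List.Properties hiding (sum-++)
open import Data.List.Membership.Propositional using (_∈_; _∉_)
open import Data.List.Membership.Propositional.Properties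
open import Data.List.Relation.Binary.Permutation.Propositional
  using (_↭_; ↭-refl; ↭-reflexive; ↭-sym; ↭-trans; ↭⇒↭ₛ)
import Data.List.Relation.Binary.Permutation.Propositional as Perm
open import Data.List.Relation.Binary.Permutation.Propositional.Properties
  using (∈-resp-↭; ↭-length; shift; filter-↭; shifts; drop-mid; ↭-map-inv)
import Data.List.Relation.Binary.Permutation.Setoid.Properties as SetoidPerm
import Relation.Binary.Construct.Flip.EqAndOrd as Flip
import Data.List.Relation.Binary.Permutation.Propositional.Properties as Perm
open import Data.List.Relation.Unary.All as All using (All; []; _∷_)
import Data.List.Relation.Unary.All.Properties as All
open import Data.List.Relation.Unary.AllPairs as AllPairs using (AllPairs; []; _∷_)
import Data.List.Relation.Unary.AllPairs.Properties as AllPairs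
open import Data.List.Relation.Unary.Any using (here; there)
open import Data.List.Relation.Unary.Unique.Propositional using (Unique)
import Data.List.Relation.Unary.Unique.Propositional.Properties as Unique
open import Data.Nat.Base
open import Data.Nat.Properties
open import Data.List.Membership.DecPropositional _≟_ using (_∈?_)
open import Data.Product.Base using (Σ-syntax; ∃₂; ∃-syntax; _×_; _,_; proj₁; proj₂)
import Data.Product.Properties as Product
open import Data.Rational.Base as ℚ using (ℚ; 0ℚ; 1ℚ)
import Data.Rational.Properties as ℚ
import Data.Rational.Unnormalised as ℚᵘ
import Data.Rational.Unnormalised.Properties as ℚᵘ
open import Data.Rational.Solver using (module +-*-Solver)
open import Data.Sum.Base using (_⊎_; inj₁; inj₂)
open import Data.Unit.Base using (tt)
open import Data.Vec.Base as Vec using (Vec; []; _∷_)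
import Data.Vec.Properties as Vec
open import Relation.Binary.Core using (Rel)
open import Relation.Binary.Morphism.Structures using (IsOrderIsomorphism)
open import Relation.Binary.Definitions using (DecidableEquality; tri<; tri≈; tri>)
open import Relation.Binary.PropositionalEquality
open import Relation.Nullary.Decidable using (Dec; yes; no; does; ¬?; dec-true; decidable-stable)
open import Relation.Nullary.Negation using (¬_; contradiction)
open import Relation.Unary using (Pred; _≐_; _⊆_; Decidable)

-- One statement about box moves is applied to two predicates. Applied to the set of weights, it
-- puts every dominated exponent into the support. Applied to the predicate "all rearrangements lie
-- in the convex hull", it puts the support into the permutahedron. The obstacle is the real
-- numbers: they are Cauchy sequences, so their order is undecidable and nothing can be chosen by
-- inspecting the coefficients of a convex combination. A lattice point of the Newton polytope is
-- therefore tested only against linear inequalities with natural number bounds: nonnegativity of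
-- the coordinates, the total, and the sums of its `m` largest coordinates. These bounds hold at the
-- points of the support, pass to the hull by linearity, and compare embedded integers, where they
-- become statements about ℕ again. Weights are lists of any length, so the number of variables
-- enters only when the support is read off. If there are fewer variables than positive parts of the
-- dominating weight, domination leaves no weight of that length, and the support, the Newton
-- polytope and the permutahedron are all empty.

count : {A : Set} {P : Pred A 0ℓ} → Decidable P → List A → ℕ
count P? xs = length (filter P? xs)

occurrences : ℕ → List ℕ → ℕ
occurrences c = count (_≟ c)

module _ {A : Set} {P : Pred A 0ℓ} (P? : Decidable P) where

  count-accept : ∀ {x xs} → P x → count P? (x ∷ xs) ≡ suc (count P? xs)
  count-accept Px = cong length (filter-accept P? Px)

  count-reject : ∀ {x xs} → ¬ P x → count P? (x ∷ xs) ≡ count P? xs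
  count-reject ¬Px = cong length (filter-reject P? ¬Px)

  count-++ : ∀ xs ys → count P? (xs ++ ys) ≡ count P? xs + count P? ys
  count-++ xs ys = trans (cong length (filter-++ P? xs ys)) (length-++ (filter P? xs))

  count-↭ : ∀ {xs ys} → xs ↭ ys → count P? xs ≡ count P? ys
  count-↭ = ↭-length ∘ filter-↭ P?

  count-≤ : ∀ xs → count P? xs ≤ length xs
  count-≤ = length-filter P?

  count-all : ∀ {xs} → All P xs → count P? xs ≡ length xs
  count-all = cong length ∘ filter-all P?

  count-none : ∀ {xs} → All (¬_ ∘ P) xs → count P? xs ≡ 0
  count-none = cong length ∘ filter-none P?

  count-map : ∀ {B : Set} (f : B → A) xs → count P? (map f xs) ≡ count (P? ∘ f) xs
  count-map f [] = refl
  count-map f (x ∷ xs) with P? (f x)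
  ... | yes _ = cong suc (count-map f xs)
  ... | no  _ = count-map f xs

module _ {A : Set} {P Q : Pred A 0ℓ} (P? : Decidable P) (Q? : Decidable Q) where

  count-cong : ∀ xs → (∀ {x} → x ∈ xs → P x → Q x) → (∀ {x} → x ∈ xs → Q x → P x) →
               count P? xs ≡ count Q? xs
  count-cong [] _ _ = refl
  count-cong (x ∷ xs) P⇒Q Q⇒P with P? x | Q? x
  ... | yes _ | yes _ = cong suc (count-cong xs (P⇒Q ∘ there) (Q⇒P ∘ there))
  ... | no  _ | no  _ = count-cong xs (P⇒Q ∘ there) (Q⇒P ∘ there)
  ... | yes p | no ¬q = contradiction (P⇒Q (here refl) p) ¬q
  ... | no ¬p | yes q = contradiction (Q⇒P (here refl) q) ¬p

-- Prefix sums of lists and multiplicities of colours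

nth : List ℕ → ℕ → ℕ
nth []       _       = 0
nth (x ∷ xs) zero    = x
nth (x ∷ xs) (suc i) = nth xs i

nth-overflow : ∀ xs {i} → length xs ≤ i → nth xs i ≡ 0
nth-overflow []       _       = refl
nth-overflow (x ∷ xs) (s≤s p) = nth-overflow xs p

nth-++-zeros : ∀ xs m i → nth (xs ++ replicate m 0) i ≡ nth xs i
nth-++-zeros []       zero    i       = refl
nth-++-zeros []       (suc m) zero    = refl
nth-++-zeros []       (suc m) (suc i) = nth-++-zeros [] m i
nth-++-zeros (x ∷ xs) m       zero    = refl
nth-++-zeros (x ∷ xs) m       (suc i) = nth-++-zeros xs m i

sum-take-suc : ∀ m xs → sum (take (suc m) xs) ≡ sum (take m xs) + nth xs m
sum-take-suc zero    []       = refl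
sum-take-suc (suc m) []       = refl
sum-take-suc zero    (x ∷ xs) = +-identityʳ x
sum-take-suc (suc m) (x ∷ xs) = trans (cong (x +_) (sum-take-suc m xs)) (sym (+-assoc x _ _))

sum-take-length : ∀ {m} xs → length xs ≤ m → sum (take m xs) ≡ sum xs
sum-take-length {m} xs p = cong sum (take-all m xs p)

sum-take-mono : ∀ {m n} xs → m ≤ n → sum (take m xs) ≤ sum (take n xs)
sum-take-mono xs       z≤n     = z≤n
sum-take-mono []       (s≤s p) = z≤n
sum-take-mono (x ∷ xs) (s≤s p) = +-monoʳ-≤ x (sum-take-mono xs p)

sum-take-≤ : ∀ m xs → sum (take m xs) ≤ sum xs
sum-take-≤ zero    xs       = z≤n
sum-take-≤ (suc m) []       = z≤n
sum-take-≤ (suc m) (x ∷ xs) = +-monoʳ-≤ x (sum-take-≤ m xs)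

count-<suc : ∀ m xs → count (_<? suc m) xs ≡ count (_<? m) xs + occurrences m xs
count-<suc m []       = refl
count-<suc m (x ∷ xs) with <-cmp x m
... | tri< x<m x≢m _
  rewrite count-accept (_<? suc m) {xs = xs} (m≤n⇒m≤1+n x<m) | count-accept (_<? m) {xs = xs} x<m
        | count-reject (_≟ m) {xs = xs} x≢m = cong suc (count-<suc m xs)
... | tri≈ x≮m refl _
  rewrite count-accept (_<? suc m) {xs = xs} (n<1+n m) | count-reject (_<? m) {xs = xs} x≮m
        | count-accept (_≟ m) {xs = xs} refl = trans (cong suc (count-<suc m xs)) (sym (+-suc _ _))
... | tri> x≮m x≢m x>m
  rewrite count-reject (_<? suc m) {xs = xs} (≤⇒≯ x>m) | count-reject (_<? m) {xs = xs} x≮m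
        | count-reject (_≟ m) {xs = xs} x≢m = count-<suc m xs

count-<0 : ∀ xs → count (_<? 0) xs ≡ 0
count-<0 xs = count-none (_<? 0) (All.universal (λ _ ()) xs)

∈⇒0<count : ∀ {A : Set} {P : Pred A 0ℓ} (P? : Decidable P) {x xs} → x ∈ xs → P x → 0 < count P? xs
∈⇒0<count P? x∈xs Px = nonempty (∈-filter⁺ P? x∈xs Px)
  where
  nonempty : ∀ {x ys} → x ∈ ys → 0 < length ys
  nonempty (here _)  = z<s
  nonempty (there _) = z<s

0<count⇒∈ : ∀ {A : Set} {P : Pred A 0ℓ} (P? : Decidable P) xs → 0 < count P? xs → ∃[ x ] x ∈ xs × P x
0<count⇒∈ P? xs 0<n with filter P? xs in eq
... | y ∷ ys = y , ∈-filter⁻ P? (subst (y ∈_) (sym eq) (here refl))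

-- As `nth α` is 0 past the end of `α`, the condition at large `c` also forbids every colour from
-- `length α` on. This is how colours in ℕ are confined to finitely many values.
HasMultiplicities : List ℕ → List ℕ → Set
HasMultiplicities α cs = ∀ c → occurrences c cs ≡ nth α c

module _ {α cs} (mult : HasMultiplicities α cs) where

  sum-take≡count : ∀ m → sum (take m α) ≡ count (_<? m) cs
  sum-take≡count zero    = sym (count-<0 cs)
  sum-take≡count (suc m) = begin
    sum (take (suc m) α)                    ≡⟨ sum-take-suc m α ⟩
    sum (take m α) + nth α m                ≡⟨ cong₂ _+_ (sum-take≡count m) (sym (mult m)) ⟩
    count (_<? m) cs + occurrences m cs     ≡⟨ count-<suc m cs ⟨
    count (_<? suc m) cs                    ∎
    where open ≡-Reasoning

  colour<length : ∀ {c} → c ∈ cs → c < length α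
  colour<length {c} c∈cs = ≰⇒> λ ℓ≤c → >⇒≢ (∈⇒0<count (_≟ c) c∈cs refl) (trans (mult c) (nth-overflow α ℓ≤c))

  sum≡length : sum α ≡ length cs
  sum≡length = begin
    sum α                          ≡⟨ sum-take-length α ≤-refl ⟨
    sum (take (length α) α)        ≡⟨ sum-take≡count (length α) ⟩
    count (_<? length α) cs        ≡⟨ count-all (_<? length α) (All.tabulate colour<length) ⟩
    length cs                      ∎
    where open ≡-Reasoning

HasMultiplicities-resp-↭ : ∀ {α cs ds} → cs ↭ ds → HasMultiplicities α cs → HasMultiplicities α ds
HasMultiplicities-resp-↭ cs↭ds mult c = trans (sym (count-↭ (_≟ c) cs↭ds)) (mult c)

-- Proper colourings of a given weight

record Colouring {A : Set} (R : Rel A 0ℓ) (vs : List A) (α : List ℕ) : Set where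
  field
    colour : A → ℕ
    proper : ∀ {x y} → R x y → colour x ≢ colour y
    mult   : HasMultiplicities α (map colour vs)

  occurrences≡nth : ∀ c → count (λ x → colour x ≟ c) vs ≡ nth α c
  occurrences≡nth c = trans (sym (count-map (_≟ c) colour vs)) (mult c)

  sum-take≡ : ∀ m → sum (take m α) ≡ count (λ x → colour x <? m) vs
  sum-take≡ m = trans (sum-take≡count {α} {map colour vs} mult m) (count-map (_<? m) colour vs)

  sum≡ : sum α ≡ length vs
  sum≡ = trans (sum≡length {α} {map colour vs} mult) (length-map colour vs)

-- A bijection of all of ℕ, rather than of the positions of a list, can be composed with a colouring
-- without any bound on its colours, and zeros past the end need no separate treatment.
Relabelling : List ℕ → List ℕ → Set
Relabelling α β = Σ[ π ∈ ℕ ↔ ℕ ] ∀ c → nth α (Inverse.from π c) ≡ nth β c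

↭⇒relabelling : ∀ {α β} → α ↭ β → Relabelling α β
↭⇒relabelling Perm.refl = mk↔ₛ′ id id (λ _ → refl) (λ _ → refl) , λ _ → refl
↭⇒relabelling (Perm.prep x α↭β) with ↭⇒relabelling α↭β
... | π , eq = mk↔ₛ′ (lift to) (lift from) (inv to from strictlyInverseˡ) (inv from to strictlyInverseʳ) ,
               λ { zero → refl ; (suc c) → eq c }
  where
  open Inverse π
  lift : (ℕ → ℕ) → ℕ → ℕ
  lift f zero    = zero
  lift f (suc c) = suc (f c)
  inv : ∀ f g → (∀ c → f (g c) ≡ c) → ∀ c → lift f (lift g c) ≡ c
  inv f g fg zero    = refl
  inv f g fg (suc c) = cong suc (fg c)
↭⇒relabelling {x ∷ y ∷ α} {_ ∷ _ ∷ β} (Perm.swap x y α↭β) with ↭⇒relabelling α↭β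
... | π , eq = mk↔ₛ′ (lift to) (lift from) (inv to from strictlyInverseˡ) (inv from to strictlyInverseʳ) ,
               λ { zero → refl ; (suc zero) → refl ; (suc (suc c)) → eq c }
  where
  open Inverse π
  lift : (ℕ → ℕ) → ℕ → ℕ
  lift f zero          = 1
  lift f (suc zero)    = 0
  lift f (suc (suc c)) = suc (suc (f c))
  inv : ∀ f g → (∀ c → f (g c) ≡ c) → ∀ c → lift f (lift g c) ≡ c
  inv f g fg zero          = refl
  inv f g fg (suc zero)    = refl
  inv f g fg (suc (suc c)) = cong (2 +_) (fg c)
↭⇒relabelling (Perm.trans α↭β β↭γ) with ↭⇒relabelling α↭β | ↭⇒relabelling β↭γ
... | π , eq | ρ , eq′ =
  mk↔ₛ′ (ρ.to ∘ π.to) (π.from ∘ ρ.from)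
        (λ c → trans (cong ρ.to (π.strictlyInverseˡ _)) (ρ.strictlyInverseˡ c))
        (λ c → trans (cong π.from (ρ.strictlyInverseʳ _)) (π.strictlyInverseʳ c)) ,
  λ c → trans (eq (ρ.from c)) (eq′ c)
  where
  module π = Inverse π
  module ρ = Inverse ρ

module _ {A : Set} {R : Rel A 0ℓ} {vs : List A} where

  Colouring-resp-nth : ∀ {α β} → (∀ c → nth α c ≡ nth β c) → Colouring R vs α → Colouring R vs β
  Colouring-resp-nth eq f = record
    { colour = colour ; proper = proper ; mult = λ c → trans (mult c) (eq c) }
    where open Colouring f

  Colouring-resp-↭ : ∀ {α β} → α ↭ β → Colouring R vs α → Colouring R vs β
  Colouring-resp-↭ {α} {β} α↭β f with ↭⇒relabelling α↭β
  ... | π , eq = record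
    { colour = to ∘ colour
    ; proper = λ xy eq → proper xy (to-injective eq)
    ; mult   = λ c → begin
        occurrences c (map (to ∘ colour) vs)          ≡⟨ count-map (_≟ c) (to ∘ colour) vs ⟩
        count (λ x → to (colour x) ≟ c) vs
          ≡⟨ count-cong _ (λ x → colour x ≟ from c) vs
               (λ { _ refl → sym (strictlyInverseʳ _) })
               (λ {x} _ eq → trans (cong to eq) (strictlyInverseˡ c)) ⟩
        count (λ x → colour x ≟ from c) vs            ≡⟨ occurrences≡nth (from c) ⟩
        nth α (from c)                                ≡⟨ eq c ⟩
        nth β c                                       ∎
    }
    where
    open Colouring f
    open Inverse π
    open ≡-Reasoning
    to-injective : ∀ {c d} → to c ≡ to d → c ≡ d
    to-injective eq = trans (sym (strictlyInverseʳ _)) (trans (cong from eq) (strictlyInverseʳ _))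

-- Box moves and the dominance order

-- Box moves: taking Q to be closed under permutations lets them act on the first two entries.
record BoxClosed (Q : List ℕ → Set) : Set where
  field
    perm : ∀ {α β} → α ↭ β → Q α → Q β
    box  : ∀ {x y α} → y < x → Q (suc x ∷ y ∷ α) → Q (x ∷ suc y ∷ α)

-- The dominance order in running form. The index is the lead of `β` over `α` when the remaining
-- entries are reached: that it is a natural number says that no prefix of `α` overtakes, and that
-- it ends at 0 says that the totals agree.
data Dominated : ℕ → List ℕ → List ℕ → Set where
  []  : Dominated 0 [] []
  _∷_ : ∀ {s s′ a b α β} → s′ + a ≡ s + b → Dominated s′ α β → Dominated s (a ∷ α) (b ∷ β)

Decreasing : List ℕ → Set
Decreasing = AllPairs _≥_

module _ {Q : List ℕ → Set} (Q-closed : BoxClosed Q) where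
  open BoxClosed Q-closed

  tail-closed : ∀ a → BoxClosed (Q ∘ (a ∷_))
  tail-closed a .BoxClosed.perm α↭β = perm (Perm.prep a α↭β)
  tail-closed a .BoxClosed.box {x} {y} {α} y<x =
    -- The fixed entry `a` is moved behind the two active entries for the box move and back to the
    -- front afterwards.
    perm (shift a (x ∷ suc y ∷ []) α) ∘ box y<x ∘ perm (↭-sym (shift a (suc x ∷ y ∷ []) α))

  boxes : ∀ e {x y α} → y + e ≤ x → Q (x + e ∷ y ∷ α) → Q (x ∷ y + e ∷ α)
  boxes zero    {x} {y} _ rewrite +-identityʳ x | +-identityʳ y = id
  boxes (suc e) {x} {y} p rewrite +-suc x e | +-suc y e =
    boxes e p ∘ box (≤-trans (s≤s (m≤m+n y e)) (≤-trans p (m≤m+n x e)))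

  -- The head carries a surplus s, which is distributed over β wherever α exceeds
  -- what β and the surplus t left over from earlier entries provide.
  distribute : ∀ {h s t α β} γ → All (_≤ h) α → Dominated (s + t) α β → Q (h + s ∷ β ++ γ) →
               ∃[ δ ] Dominated t α δ × Q (h ∷ δ ++ γ)
  distribute {h} {s} {t} γ [] dom Qβ with s + t in eq
  distribute {h} {s} {t} γ [] [] Qβ | .0
    with refl ← m+n≡0⇒m≡0 s eq | refl ← m+n≡0⇒n≡0 s eq =
    [] , [] , subst (λ x → Q (x ∷ γ)) (+-identityʳ h) Qβ
  distribute {h} {s} {t} {a ∷ α} {b ∷ β} γ (a≤h ∷ α≤h) (_∷_ {s′ = r} eq dom) Qβ with a ≤? t + b
  ... | yes a≤t+b =
    let δ , dom′ , Qδ = distribute (b ∷ γ) α≤h (subst (λ s → Dominated s α β) r≡ dom)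
                          (perm (Perm.prep _ (↭-sym (shift b β γ))) Qβ)
    in b ∷ δ , m∸n+n≡m a≤t+b ∷ dom′ , perm (Perm.prep _ (shift b δ γ)) Qδ
    where
    r≡ : r ≡ s + (t + b ∸ a)
    r≡ = +-cancelʳ-≡ a r _ (begin
      r + a                   ≡⟨ eq ⟩
      s + t + b               ≡⟨ +-assoc s t b ⟩
      s + (t + b)             ≡⟨ cong (s +_) (m∸n+n≡m a≤t+b) ⟨
      s + (t + b ∸ a + a)     ≡⟨ +-assoc s _ a ⟨
      s + (t + b ∸ a) + a     ∎)
      where open ≡-Reasoning
  ... | no a≰t+b =
    let δ , dom′ , Qδ = distribute (b + e ∷ γ) α≤h (subst (λ s → Dominated s α β) (sym (+-identityʳ r)) dom)
                          (perm (Perm.prep _ (↭-sym (shift (b + e) β γ)))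
                            -- Here the decreasing order is needed: the filled entry `b + e` is at
                            -- most `a`, hence at most `h`, and the head keeps at least `h`. So
                            -- every single unit moves from a strictly larger entry in the sense of
                            -- `box`.
                            (boxes e (≤-trans b+e≤a (≤-trans a≤h (m≤m+n h r)))
                              (subst (λ x → Q (x ∷ b ∷ β ++ γ)) h+s≡ Qβ)))
    in b + e ∷ δ , trans (sym t+b+e≡a) (+-assoc t b e) ∷ dom′ , perm (Perm.prep _ (shift (b + e) δ γ)) Qδ
    where
    e = a ∸ (t + b)
    t+b+e≡a : t + b + e ≡ a
    t+b+e≡a = m+[n∸m]≡n (<⇒≤ (≰⇒> a≰t+b))
    b+e≤a : b + e ≤ a
    b+e≤a = subst (b + e ≤_) t+b+e≡a (+-monoˡ-≤ e (m≤n+m b t))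
    s≡ : s ≡ r + e
    s≡ = +-cancelʳ-≡ (t + b) s _ (begin
      s + (t + b)             ≡⟨ +-assoc s t b ⟨
      s + t + b               ≡⟨ eq ⟨
      r + a                   ≡⟨ cong (r +_) t+b+e≡a ⟨
      r + (t + b + e)         ≡⟨ cong (r +_) (+-comm (t + b) e) ⟩
      r + (e + (t + b))       ≡⟨ +-assoc r e _ ⟨
      r + e + (t + b)         ∎)
      where open ≡-Reasoning
    h+s≡ : h + s ≡ h + r + e
    h+s≡ = trans (cong (h +_) s≡) (sym (+-assoc h r e))

-- A discrete form of the theorem of Muirhead and of Hardy, Littlewood and Pólya. The head of `β`
-- exceeds that of `α` by exactly the surplus; once `distribute` has spread it over the tail, the
-- head is final and the induction continues with `Q ∘ (a ∷_)`.
dominated-closed : ∀ {Q} → BoxClosed Q → ∀ {α β} → Decreasing α → Dominated 0 α β → Q β → Q α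
dominated-closed Q-closed [] [] Qβ = Qβ
dominated-closed {Q} Q-closed {a ∷ α} (a≥α ∷ dec) (_∷_ {s′ = s} eq dom) Qβ =
  let δ , dom′ , Qδ = distribute Q-closed [] a≥α (subst (λ s → Dominated s α _) (sym (+-identityʳ s)) dom)
                        (subst Q (cong₂ _∷_ (trans (sym eq) (+-comm s a)) (sym (++-identityʳ _))) Qβ)
  in dominated-closed (tail-closed Q-closed a) dec dom′ (subst (Q ∘ (a ∷_)) (++-identityʳ δ) Qδ)

prefix-dominated : ∀ {s α β} → length α ≡ length β → (∀ m → sum (take m α) ≤ s + sum (take m β)) →
                   sum α ≡ s + sum β → Dominated s α β
prefix-dominated {s} {[]}    {[]}    _ _ eq = subst (λ s → Dominated s [] []) (trans eq (+-identityʳ s)) []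
prefix-dominated {s} {a ∷ α} {b ∷ β} len prefix eq =
  m∸n+n≡m a≤s+b ∷ prefix-dominated (suc-injective len)
    (λ m → +-cancelˡ-≤ a _ _ (≤-trans (prefix (suc m)) (≤-reflexive (regroup (sum (take m β))))))
    (+-cancelˡ-≡ a _ _ (trans eq (regroup (sum β))))
  where
  a≤s+b : a ≤ s + b
  a≤s+b = subst₂ _≤_ (+-identityʳ a) (cong (s +_) (+-identityʳ b)) (prefix 1)
  regroup : ∀ x → s + (b + x) ≡ a + (s + b ∸ a + x)
  regroup x = begin
    s + (b + x)               ≡⟨ +-assoc s b x ⟨
    s + b + x                 ≡⟨ cong (_+ x) (m+[n∸m]≡n a≤s+b) ⟨
    a + (s + b ∸ a) + x       ≡⟨ +-assoc a _ x ⟩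
    a + (s + b ∸ a + x)       ∎
    where open ≡-Reasoning

majorized-closed : ∀ {Q} → BoxClosed Q → ∀ {α β} → Decreasing α → length α ≡ length β →
                   (∀ m → sum (take m α) ≤ sum (take m β)) → sum α ≡ sum β → Q β → Q α
majorized-closed Q-closed dec len prefix eq = dominated-closed Q-closed dec (prefix-dominated len prefix eq)

-- Rational approximation of real inequalities

private
  half : ∀ {ε} → 0ℚ ℚ.< ε → 0ℚ ℚ.< ℚ.½ ℚ.* ε
  half {ε} 0<ε = ℚ.positive⁻¹ _ {{ℚ.pos*pos⇒pos ℚ.½ ε {{ℚ.positive 0<ε}}}}

  half+half : ∀ ε → ℚ.½ ℚ.* ε ℚ.+ ℚ.½ ℚ.* ε ≡ ε
  half+half ε = trans (sym (ℚ.*-distribʳ-+ ε ℚ.½ ℚ.½)) (ℚ.*-identityˡ ε)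

p≤∣p∣ : ∀ p → p ℚ.≤ ℚ.∣ p ∣
p≤∣p∣ p with ℚ.≤-total 0ℚ p
... | inj₁ 0≤p = ℚ.≤-reflexive (sym (ℚ.0≤p⇒∣p∣≡p 0≤p))
... | inj₂ p≤0 = ℚ.≤-trans p≤0 (ℚ.0≤∣p∣ p)

∣p∣-least : ∀ {p r} → p ℚ.≤ r → ℚ.- p ℚ.≤ r → ℚ.∣ p ∣ ℚ.≤ r
∣p∣-least {p} p≤r -p≤r with ℚ.∣p∣≡p∨∣p∣≡-p p
... | inj₁ eq = subst (ℚ._≤ _) (sym eq) p≤r
... | inj₂ eq = subst (ℚ._≤ _) (sym eq) -p≤r


private
  y+[x-y]≡x : ∀ x y → y ℚ.+ (x ℚ.- y) ≡ x
  y+[x-y]≡x = solve 2 (λ x y → y :+ (x :- y) := x) refl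
    where open +-*-Solver

  -[x-y]≡y-x : ∀ x y → ℚ.- (x ℚ.- y) ≡ y ℚ.- x
  -[x-y]≡y-x = solve 2 (λ x y → :- (x :- y) := y :- x) refl
    where open +-*-Solver

  x≤y+ε⇒x-y≤ε : ∀ {x y ε} → x ℚ.≤ y ℚ.+ ε → x ℚ.- y ℚ.≤ ε
  x≤y+ε⇒x-y≤ε {x} {y} {ε} p =
    subst (x ℚ.- y ℚ.≤_) (cancel y ε) (ℚ.+-monoˡ-≤ (ℚ.- y) p)
    where
    open +-*-Solver
    cancel : ∀ y ε → y ℚ.+ ε ℚ.- y ≡ ε
    cancel = solve 2 (λ y ε → y :+ ε :- y := ε) refl

  x-y≤ε⇒x≤y+ε : ∀ {x y ε} → x ℚ.- y ℚ.≤ ε → x ℚ.≤ y ℚ.+ ε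
  x-y≤ε⇒x≤y+ε {x} {y} {ε} p = subst (ℚ._≤ y ℚ.+ ε) (y+[x-y]≡x x y) (ℚ.+-monoʳ-≤ y p)

  exchange : ∀ a b c d → (a ℚ.+ b) ℚ.+ (c ℚ.+ d) ≡ (a ℚ.+ c) ℚ.+ (b ℚ.+ d)
  exchange = solve 4 (λ a b c d → (a :+ b) :+ (c :+ d) := (a :+ c) :+ (b :+ d)) refl
    where open +-*-Solver

  factor : ∀ a b c → a ℚ.* b ℚ.- a ℚ.* c ≡ a ℚ.* (b ℚ.- c)
  factor = solve 3 (λ a b c → a :* b :- a :* c := a :* (b :- c)) refl
    where open +-*-Solver

≗⇒≈ : ∀ {x y} → (∀ n → seq x n ≡ seq y n) → x ≈ʳ y
≗⇒≈ {x} {y} eq ε 0<ε = 0 , λ n _ → subst (ℚ._< ε) (sym (cong ℚ.∣_∣ (x-y≡0 n))) 0<ε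
  where
  x-y≡0 : ∀ n → seq x n ℚ.- seq y n ≡ 0ℚ
  x-y≡0 n = trans (cong (ℚ._- seq y n) (eq n)) (ℚ.+-inverseʳ (seq y n))

≈-refl : ∀ {x} → x ≈ʳ x
≈-refl {x} = ≗⇒≈ {x} {x} (λ _ → refl)

≈-sym : ∀ {x y} → x ≈ʳ y → y ≈ʳ x
≈-sym {x} {y} x≈y ε 0<ε with x≈y ε 0<ε
... | N , close = N , λ n N≤n → subst (ℚ._< ε) (flip-∣∣ n) (close n N≤n)
  where
  flip-∣∣ : ∀ n → ℚ.∣ seq x n ℚ.- seq y n ∣ ≡ ℚ.∣ seq y n ℚ.- seq x n ∣
  flip-∣∣ n = trans (sym (ℚ.∣-p∣≡∣p∣ _)) (cong ℚ.∣_∣ (-[x-y]≡y-x (seq x n) (seq y n)))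

≈⇒≤ : ∀ {x y} → x ≈ʳ y → x ≤ʳ y
≈⇒≤ {x} {y} x≈y ε 0<ε with x≈y ε 0<ε
... | N , close = N , λ n N≤n → x-y≤ε⇒x≤y+ε (ℚ.≤-trans (p≤∣p∣ _) (ℚ.<⇒≤ (close n N≤n)))

≤-antisymʳ : ∀ {x y} → x ≤ʳ y → y ≤ʳ x → x ≈ʳ y
≤-antisymʳ {x} {y} x≤y y≤x ε 0<ε with x≤y (ℚ.½ ℚ.* ε) (half 0<ε) | y≤x (ℚ.½ ℚ.* ε) (half 0<ε)
... | M , p | N , q = M ⊔ N , λ n M⊔N≤n → ℚ.≤-<-trans
  (∣p∣-least (x≤y+ε⇒x-y≤ε (p n (m⊔n≤o⇒m≤o M N M⊔N≤n)))
             (subst (ℚ._≤ ℚ.½ ℚ.* ε) (sym (-[x-y]≡y-x (seq x n) (seq y n)))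
               (x≤y+ε⇒x-y≤ε (q n (m⊔n≤o⇒n≤o M N M⊔N≤n)))))
  (subst₂ ℚ._<_ (ℚ.+-identityʳ _) (half+half ε) (ℚ.+-monoʳ-< (ℚ.½ ℚ.* ε) (half 0<ε)))

≤-transʳ : ∀ {x y z} → x ≤ʳ y → y ≤ʳ z → x ≤ʳ z
≤-transʳ {x} {y} {z} x≤y y≤z ε 0<ε with x≤y (ℚ.½ ℚ.* ε) (half 0<ε) | y≤z (ℚ.½ ℚ.* ε) (half 0<ε)
... | M , p | N , q = M ⊔ N , λ n M⊔N≤n → begin
  seq x n                                     ≤⟨ p n (m⊔n≤o⇒m≤o M N M⊔N≤n) ⟩
  seq y n ℚ.+ ℚ.½ ℚ.* ε                       ≤⟨ ℚ.+-monoˡ-≤ _ (q n (m⊔n≤o⇒n≤o M N M⊔N≤n)) ⟩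
  seq z n ℚ.+ ℚ.½ ℚ.* ε ℚ.+ ℚ.½ ℚ.* ε         ≡⟨ ℚ.+-assoc (seq z n) _ _ ⟩
  seq z n ℚ.+ (ℚ.½ ℚ.* ε ℚ.+ ℚ.½ ℚ.* ε)       ≡⟨ cong (seq z n ℚ.+_) (half+half ε) ⟩
  seq z n ℚ.+ ε                               ∎
  where open ℚ.≤-Reasoning

+-mono-≤ʳ : ∀ {x x′ y y′} → x ≤ʳ x′ → y ≤ʳ y′ → (x +ʳ y) ≤ʳ (x′ +ʳ y′)
+-mono-≤ʳ {x} {x′} {y} {y′} x≤x′ y≤y′ ε 0<ε
  with x≤x′ (ℚ.½ ℚ.* ε) (half 0<ε) | y≤y′ (ℚ.½ ℚ.* ε) (half 0<ε)
... | M , p | N , q = M ⊔ N , λ n M⊔N≤n → begin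
  seq x n ℚ.+ seq y n
    ≤⟨ ℚ.+-mono-≤ (p n (m⊔n≤o⇒m≤o M N M⊔N≤n)) (q n (m⊔n≤o⇒n≤o M N M⊔N≤n)) ⟩
  (seq x′ n ℚ.+ ℚ.½ ℚ.* ε) ℚ.+ (seq y′ n ℚ.+ ℚ.½ ℚ.* ε)
    ≡⟨ exchange (seq x′ n) (ℚ.½ ℚ.* ε) (seq y′ n) (ℚ.½ ℚ.* ε) ⟩
  (seq x′ n ℚ.+ seq y′ n) ℚ.+ (ℚ.½ ℚ.* ε ℚ.+ ℚ.½ ℚ.* ε)
    ≡⟨ cong (seq x′ n ℚ.+ seq y′ n ℚ.+_) (half+half ε) ⟩
  (seq x′ n ℚ.+ seq y′ n) ℚ.+ ε    ∎
  where open ℚ.≤-Reasoning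

≈-trans : ∀ {x y z} → x ≈ʳ y → y ≈ʳ z → x ≈ʳ z
≈-trans {x} {y} {z} p q = ≤-antisymʳ {x} {z}
  (≤-transʳ {x} {y} {z} (≈⇒≤ {x} {y} p) (≈⇒≤ {y} {z} q))
  (≤-transʳ {z} {y} {x} (≈⇒≤ {z} {y} (≈-sym {y} {z} q)) (≈⇒≤ {y} {x} (≈-sym {x} {y} p)))

+-congʳ : ∀ {x x′ y y′} → x ≈ʳ x′ → y ≈ʳ y′ → (x +ʳ y) ≈ʳ (x′ +ʳ y′)
+-congʳ {x} {x′} {y} {y′} p q = ≤-antisymʳ {x +ʳ y} {x′ +ʳ y′}
  (+-mono-≤ʳ {x} {x′} {y} {y′} (≈⇒≤ {x} {x′} p) (≈⇒≤ {y} {y′} q))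
  (+-mono-≤ʳ {x′} {x} {y′} {y} (≈⇒≤ {x′} {x} (≈-sym {x} {x′} p)) (≈⇒≤ {y′} {y} (≈-sym {y} {y′} q)))

≈-≤-trans : ∀ {x y z} → x ≈ʳ y → y ≤ʳ z → x ≤ʳ z
≈-≤-trans {x} {y} {z} x≈y = ≤-transʳ {x} {y} {z} (≈⇒≤ {x} {y} x≈y)

≤-≈-trans : ∀ {x y z} → x ≤ʳ y → y ≈ʳ z → x ≤ʳ z
≤-≈-trans {x} {y} {z} x≤y y≈z = ≤-transʳ {x} {y} {z} x≤y (≈⇒≤ {y} {z} y≈z)

+-congˡʳ : ∀ x {y y′} → y ≈ʳ y′ → (x +ʳ y) ≈ʳ (x +ʳ y′)
+-congˡʳ x {y} {y′} = +-congʳ {x} {x} {y} {y′} (≈-refl {x})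

+-congʳʳ : ∀ y {x x′} → x ≈ʳ x′ → (x +ʳ y) ≈ʳ (x′ +ʳ y)
+-congʳʳ y {x} {x′} x≈x′ = +-congʳ {x} {x′} {y} {y} x≈x′ (≈-refl {y})

bounded : ∀ x → ∃[ B ] ℚ.Positive B × ∃[ N ] ∀ n → N ≤ n → ℚ.∣ seq x n ∣ ℚ.≤ B
bounded x with cauchy x 1ℚ (ℚ.positive⁻¹ 1ℚ)
... | N , close = ℚ.∣ seq x N ∣ ℚ.+ 1ℚ , ℚ.nonNeg+pos⇒pos ℚ.∣ seq x N ∣ {{ℚ.∣-∣-nonNeg (seq x N)}} 1ℚ , N ,
  λ n N≤n → begin
    ℚ.∣ seq x n ∣                               ≡⟨ cong ℚ.∣_∣ (y+[x-y]≡x (seq x n) (seq x N)) ⟨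
    ℚ.∣ seq x N ℚ.+ (seq x n ℚ.- seq x N) ∣     ≤⟨ ℚ.∣p+q∣≤∣p∣+∣q∣ (seq x N) _ ⟩
    ℚ.∣ seq x N ∣ ℚ.+ ℚ.∣ seq x n ℚ.- seq x N ∣ ≤⟨ ℚ.+-monoʳ-≤ ℚ.∣ seq x N ∣ (ℚ.<⇒≤ (close n N N≤n ≤-refl)) ⟩
    ℚ.∣ seq x N ∣ ℚ.+ 1ℚ                        ∎
  where open ℚ.≤-Reasoning

private
  divide : ∀ ε → 0ℚ ℚ.< ε → ∀ B → ℚ.Positive B → ∃[ δ ] 0ℚ ℚ.< δ × B ℚ.* δ ≡ ε
  divide ε 0<ε B B⁺ = B⁻¹ ℚ.* ε , ℚ.positive⁻¹ _ {{ℚ.pos*pos⇒pos B⁻¹ {{ℚ.1/pos⇒pos B {{B⁺}}}} ε {{ℚ.positive 0<ε}}}} ,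
    trans (sym (ℚ.*-assoc B B⁻¹ ε)) (trans (cong (ℚ._* ε) (ℚ.*-inverseʳ B {{B≢0}})) (ℚ.*-identityˡ ε))
    where
    B≢0 = ℚ.pos⇒nonZero B {{B⁺}}
    B⁻¹ = (ℚ.1/ B) {{B≢0}}

private
  scaled-close : ∀ B → ℚ.Positive B → ∀ a b c {δ} → ℚ.∣ a ∣ ℚ.≤ B → ℚ.∣ b ℚ.- c ∣ ℚ.< δ →
                 ℚ.∣ a ℚ.* b ℚ.- a ℚ.* c ∣ ℚ.< B ℚ.* δ
  scaled-close B B⁺ a b c {δ} ∣a∣≤B close = begin-strict
    ℚ.∣ a ℚ.* b ℚ.- a ℚ.* c ∣     ≡⟨ cong ℚ.∣_∣ (factor a b c) ⟩
    ℚ.∣ a ℚ.* (b ℚ.- c) ∣         ≡⟨ ℚ.∣p*q∣≡∣p∣*∣q∣ a (b ℚ.- c) ⟩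
    ℚ.∣ a ∣ ℚ.* ℚ.∣ b ℚ.- c ∣
      ≤⟨ ℚ.*-monoʳ-≤-nonNeg ℚ.∣ b ℚ.- c ∣ {{ℚ.∣-∣-nonNeg (b ℚ.- c)}} ∣a∣≤B ⟩
    B ℚ.* ℚ.∣ b ℚ.- c ∣           <⟨ ℚ.*-monoʳ-<-pos B {{B⁺}} close ⟩
    B ℚ.* δ                       ∎
    where open ℚ.≤-Reasoning

*-congˡʳ : ∀ x {y y′} → y ≈ʳ y′ → (x *ʳ y) ≈ʳ (x *ʳ y′)
*-congˡʳ x {y} {y′} y≈y′ ε 0<ε =
  let B , B⁺ , M , bound = bounded x
      δ , 0<δ , Bδ≡ε = divide ε 0<ε B B⁺
      N , close = y≈y′ δ 0<δ
  in M ⊔ N , λ n M⊔N≤n →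
       subst (ℚ.∣ seq x n ℚ.* seq y n ℚ.- seq x n ℚ.* seq y′ n ∣ ℚ.<_) Bδ≡ε
         (scaled-close B B⁺ (seq x n) (seq y n) (seq y′ n)
           (bound n (m⊔n≤o⇒m≤o M N M⊔N≤n)) (close n (m⊔n≤o⇒n≤o M N M⊔N≤n)))

*-commʳ : ∀ x y → (x *ʳ y) ≈ʳ (y *ʳ x)
*-commʳ x y = ≗⇒≈ {x *ʳ y} {y *ʳ x} λ n → ℚ.*-comm (seq x n) (seq y n)

*-congʳʳ : ∀ y {x x′} → x ≈ʳ x′ → (x *ʳ y) ≈ʳ (x′ *ʳ y)
*-congʳʳ y {x} {x′} x≈x′ = ≈-trans {x *ʳ y} {y *ʳ x} {x′ *ʳ y} (*-commʳ x y)
  (≈-trans {y *ʳ x} {y *ʳ x′} {x′ *ʳ y} (*-congˡʳ y {x} {x′} x≈x′) (*-commʳ y x′))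

-- Integers and rationals inside the reals

ι : ℤ → ℚ
ι i = i ℚ./ 1

private
  toℚᵘ-ι : ∀ i → ℚ.toℚᵘ (ι i) ℚᵘ.≃ ℚᵘ.mkℚᵘ i 0
  toℚᵘ-ι i = ℚ.toℚᵘ-fromℚᵘ (ℚᵘ.mkℚᵘ i 0)

ι-+ : ∀ i j → ι (i ℤ.+ j) ≡ ι i ℚ.+ ι j
ι-+ i j = ℚ.toℚᵘ-injective (begin
  ℚ.toℚᵘ (ι (i ℤ.+ j))                   ≈⟨ toℚᵘ-ι (i ℤ.+ j) ⟩
  ℚᵘ.mkℚᵘ (i ℤ.+ j) 0                    ≈⟨ ℚᵘ.*≡* (cong (ℤ._* ℤ.1ℤ) (sym (cong₂ ℤ._+_ (ℤ.*-identityʳ i) (ℤ.*-identityʳ j)))) ⟩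
  ℚᵘ.mkℚᵘ i 0 ℚᵘ.+ ℚᵘ.mkℚᵘ j 0           ≈⟨ ℚᵘ.+-cong (toℚᵘ-ι i) (toℚᵘ-ι j) ⟨
  ℚ.toℚᵘ (ι i) ℚᵘ.+ ℚ.toℚᵘ (ι j)         ≈⟨ ℚ.toℚᵘ-homo-+ (ι i) (ι j) ⟨
  ℚ.toℚᵘ (ι i ℚ.+ ι j)                   ∎)
  where open ℚᵘ.≃-Reasoning

ι-mono-≤ : ∀ {i j} → i ℤ.≤ j → ι i ℚ.≤ ι j
ι-mono-≤ {i} {j} i≤j = ℚ.toℚᵘ-cancel-≤ (begin
  ℚ.toℚᵘ (ι i)     ≃⟨ toℚᵘ-ι i ⟩
  ℚᵘ.mkℚᵘ i 0      ≤⟨ ℚᵘ.*≤* (ℤ.*-monoʳ-≤-nonNeg ℤ.1ℤ i≤j) ⟩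
  ℚᵘ.mkℚᵘ j 0      ≃⟨ toℚᵘ-ι j ⟨
  ℚ.toℚᵘ (ι j)     ∎)
  where open ℚᵘ.≤-Reasoning

ι-cancel-≤ : ∀ {i j} → ι i ℚ.≤ ι j → i ℤ.≤ j
ι-cancel-≤ {i} {j} ιi≤ιj = ℤ.*-cancelʳ-≤-pos i j ℤ.1ℤ (unwrap (begin
  ℚᵘ.mkℚᵘ i 0      ≃⟨ toℚᵘ-ι i ⟨
  ℚ.toℚᵘ (ι i)     ≤⟨ ℚ.toℚᵘ-mono-≤ ιi≤ιj ⟩
  ℚ.toℚᵘ (ι j)     ≃⟨ toℚᵘ-ι j ⟩
  ℚᵘ.mkℚᵘ j 0      ∎))
  where
  open ℚᵘ.≤-Reasoning
  unwrap : ℚᵘ.mkℚᵘ i 0 ℚᵘ.≤ ℚᵘ.mkℚᵘ j 0 → i ℤ.* ℤ.1ℤ ℤ.≤ j ℤ.* ℤ.1ℤ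
  unwrap (ℚᵘ.*≤* p) = p

fromℚ-mono-≤ : ∀ {p r} → p ℚ.≤ r → fromℚ p ≤ʳ fromℚ r
fromℚ-mono-≤ {p} {r} p≤r ε 0<ε = 0 , λ _ _ → ℚ.≤-trans p≤r
  (subst (ℚ._≤ r ℚ.+ ε) (ℚ.+-identityʳ r) (ℚ.+-monoʳ-≤ r (ℚ.<⇒≤ 0<ε)))

fromℚ-cancel-≤ : ∀ {p r} → fromℚ p ≤ʳ fromℚ r → p ℚ.≤ r
fromℚ-cancel-≤ {p} {r} p≤r = ℚ.≮⇒≥ λ r<p →
  let 0<δ : 0ℚ ℚ.< p ℚ.- r
      0<δ = subst (ℚ._< p ℚ.- r) (ℚ.+-inverseʳ r) (ℚ.+-monoˡ-< (ℚ.- r) r<p)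
      -- Half of the gap is a tolerance small enough to keep `r` plus the tolerance strictly below
      -- `p`.
      N , close = p≤r (ℚ.½ ℚ.* (p ℚ.- r)) (half 0<δ)
  in ℚ.<-irrefl refl (begin-strict
       p                                         ≤⟨ close N ≤-refl ⟩
       r ℚ.+ ℚ.½ ℚ.* (p ℚ.- r)                   ≡⟨ cong (r ℚ.+_) (ℚ.+-identityʳ (ℚ.½ ℚ.* (p ℚ.- r))) ⟨
       r ℚ.+ (ℚ.½ ℚ.* (p ℚ.- r) ℚ.+ 0ℚ)          <⟨ ℚ.+-monoʳ-< r (ℚ.+-monoʳ-< (ℚ.½ ℚ.* (p ℚ.- r)) (half 0<δ)) ⟩
       r ℚ.+ (ℚ.½ ℚ.* (p ℚ.- r) ℚ.+ ℚ.½ ℚ.* (p ℚ.- r)) ≡⟨ cong (r ℚ.+_) (half+half (p ℚ.- r)) ⟩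
       r ℚ.+ (p ℚ.- r)                           ≡⟨ y+[x-y]≡x p r ⟩
       p                                         ∎)
  where open ℚ.≤-Reasoning

fromℤ-cancel-≤ : ∀ i j → fromℤ i ≤ʳ fromℤ j → i ℤ.≤ j
fromℤ-cancel-≤ i j p = ι-cancel-≤ (fromℚ-cancel-≤ {ι i} {ι j} p)

private
  0≤p*q : ∀ {p r} → 0ℚ ℚ.≤ p → 0ℚ ℚ.≤ r → 0ℚ ℚ.≤ p ℚ.* r
  0≤p*q {p} {r} 0≤p 0≤r =
    ℚ.nonNegative⁻¹ _ {{ℚ.nonNeg*nonNeg⇒nonNeg p {{ℚ.nonNegative 0≤p}} r {{ℚ.nonNegative 0≤r}}}}

  0≤p+q : ∀ {p r} → 0ℚ ℚ.≤ p → 0ℚ ℚ.≤ r → 0ℚ ℚ.≤ p ℚ.+ r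
  0≤p+q 0≤p 0≤r = ℚ.+-mono-≤ 0≤p 0≤r

  0≤q-p : ∀ {p r} → p ℚ.≤ r → 0ℚ ℚ.≤ r ℚ.- p
  0≤q-p {p} {r} p≤r = subst (ℚ._≤ r ℚ.- p) (ℚ.+-inverseʳ p) (ℚ.+-monoˡ-≤ (ℚ.- p) p≤r)

  split⁺ : ∀ a b A B δ → a ℚ.* (b ℚ.+ δ) ℚ.+ ((A ℚ.- a) ℚ.* δ ℚ.+ B ℚ.* δ) ≡ a ℚ.* b ℚ.+ (A ℚ.+ B) ℚ.* δ
  split⁺ = solve 5 (λ a b A B δ → a :* (b :+ δ) :+ ((A :- a) :* δ :+ B :* δ) := a :* b :+ (A :+ B) :* δ) refl
    where open +-*-Solver

  split⁻ : ∀ a b A B δ → (0ℚ ℚ.- a) ℚ.* (B ℚ.- b) ℚ.+ ((a ℚ.+ δ) ℚ.* B ℚ.+ A ℚ.* δ) ≡ a ℚ.* b ℚ.+ (A ℚ.+ B) ℚ.* δ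
  split⁻ = solve 5 (λ a b A B δ → (con 0ℚ :- a) :* (B :- b) :+ ((a :+ δ) :* B :+ A :* δ) := a :* b :+ (A :+ B) :* δ) refl
    where open +-*-Solver

  -- Terms of nonnegative Cauchy sequences are only known to be at least `-δ`, so the product can
  -- fall below 0, but by no more than `(A + B) δ`. Depending on the sign of `a`, the identity
  -- `split⁺` or `split⁻` writes the right-hand side as a sum of products of nonnegative factors.
  approx-nonneg : ∀ a b {A B δ} → ℚ.∣ a ∣ ℚ.≤ A → ℚ.∣ b ∣ ℚ.≤ B → 0ℚ ℚ.≤ δ → 0ℚ ℚ.≤ a ℚ.+ δ → 0ℚ ℚ.≤ b ℚ.+ δ →
                  0ℚ ℚ.≤ a ℚ.* b ℚ.+ (A ℚ.+ B) ℚ.* δ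
  approx-nonneg a b {A} {B} {δ} ∣a∣≤A ∣b∣≤B 0≤δ 0≤a+δ 0≤b+δ with ℚ.≤-total 0ℚ a
  ... | inj₁ 0≤a = subst (0ℚ ℚ.≤_) (split⁺ a b A B δ)
    (0≤p+q (0≤p*q 0≤a 0≤b+δ)
      (0≤p+q (0≤p*q (0≤q-p (ℚ.≤-trans (p≤∣p∣ a) ∣a∣≤A)) 0≤δ)
             (0≤p*q (ℚ.≤-trans (ℚ.0≤∣p∣ b) ∣b∣≤B) 0≤δ)))
  ... | inj₂ a≤0 = subst (0ℚ ℚ.≤_) (split⁻ a b A B δ)
    (0≤p+q (0≤p*q (0≤q-p a≤0) (0≤q-p (ℚ.≤-trans (p≤∣p∣ b) ∣b∣≤B)))
      (0≤p+q (0≤p*q 0≤a+δ (ℚ.≤-trans (ℚ.0≤∣p∣ b) ∣b∣≤B))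
             (0≤p*q (ℚ.≤-trans (ℚ.0≤∣p∣ a) ∣a∣≤A) 0≤δ)))

*-nonnegʳ : ∀ {x y} → 0ℝ ≤ʳ x → 0ℝ ≤ʳ y → 0ℝ ≤ʳ (x *ʳ y)
*-nonnegʳ {x} {y} 0≤x 0≤y ε 0<ε =
  let A , A⁺ , K , xbound = bounded x
      B , B⁺ , L , ybound = bounded y
      δ , 0<δ , Cδ≡ε = divide ε 0<ε (A ℚ.+ B) (ℚ.pos+pos⇒pos A {{A⁺}} B {{B⁺}})
      M , xclose = 0≤x δ 0<δ
      N , yclose = 0≤y δ 0<δ
  in (K ⊔ L) ⊔ (M ⊔ N) , λ n p →
       let K⊔L≤n = m⊔n≤o⇒m≤o (K ⊔ L) (M ⊔ N) p
           M⊔N≤n = m⊔n≤o⇒n≤o (K ⊔ L) (M ⊔ N) p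
       in subst (λ ε → 0ℚ ℚ.≤ seq x n ℚ.* seq y n ℚ.+ ε) Cδ≡ε
            (approx-nonneg (seq x n) (seq y n)
              (xbound n (m⊔n≤o⇒m≤o K L K⊔L≤n)) (ybound n (m⊔n≤o⇒n≤o K L K⊔L≤n)) (ℚ.<⇒≤ 0<δ)
              (xclose n (m⊔n≤o⇒m≤o M N M⊔N≤n)) (yclose n (m⊔n≤o⇒n≤o M N M⊔N≤n)))

private
  distrib-- : ∀ a x y ε → x ℚ.* (y ℚ.- a) ℚ.+ ε ℚ.+ x ℚ.* a ≡ x ℚ.* y ℚ.+ ε
  distrib-- = solve 4 (λ a x y ε → x :* (y :- a) :+ ε :+ x :* a := x :* y :+ ε) refl
    where open +-*-Solver

  regroup-- : ∀ x y ε → y ℚ.+ ε ℚ.- x ≡ y ℚ.- x ℚ.+ ε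
  regroup-- = solve 3 (λ x y ε → y :+ ε :- x := y :- x :+ ε) refl
    where open +-*-Solver

  -1*p : ∀ p → (ℚ.- 1ℚ) ℚ.* p ≡ ℚ.- p
  -1*p = solve 1 (λ p → (:- con 1ℚ) :* p := :- p) refl
    where open +-*-Solver

-ʳ_ : ℝ → ℝ
-ʳ x = fromℚ (ℚ.- 1ℚ) *ʳ x

*-monoˡ-≤ʳ : ∀ {w x y} → 0ℝ ≤ʳ w → x ≤ʳ y → (w *ʳ x) ≤ʳ (w *ʳ y)
*-monoˡ-≤ʳ {w} {x} {y} 0≤w x≤y ε 0<ε =
  let N , close = *-nonnegʳ {w} {y +ʳ (-ʳ x)} 0≤w 0≤y-x ε 0<ε
  in N , λ n N≤n → subst₂ ℚ._≤_ (ℚ.+-identityˡ _) (distrib-- (seq x n) (seq w n) (seq y n) ε)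
       (ℚ.+-monoˡ-≤ (seq w n ℚ.* seq x n)
         (subst (λ z → 0ℚ ℚ.≤ seq w n ℚ.* (seq y n ℚ.+ z) ℚ.+ ε) (-1*p (seq x n)) (close n N≤n)))
  where
  0≤y-x : 0ℝ ≤ʳ (y +ʳ (-ʳ x))
  0≤y-x ε 0<ε = let N , close = x≤y ε 0<ε in N , λ n N≤n →
    subst₂ ℚ._≤_ (ℚ.+-inverseʳ (seq x n))
      (trans (regroup-- (seq x n) (seq y n) ε) (cong (λ z → seq y n ℚ.+ z ℚ.+ ε) (sym (-1*p (seq x n)))))
      (ℚ.+-monoˡ-≤ (ℚ.- seq x n) (close n N≤n))

-- Conical and convex combinations

-- Conical combinations of total weight W; building them one point at a time
-- avoids the double sums of iterated convex combinations.
data Cone {k} (S : Pred (Point k) 0ℓ) : ℝ → Point k → Set where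
  nil  : ∀ {W x} → W ≈ʳ 0ℝ → (∀ i → x i ≈ʳ 0ℝ) → Cone S W x
  cons : ∀ {w W W′ p x x′} → 0ℝ ≤ʳ w → S p → Cone S W x →
         W′ ≈ʳ (w +ʳ W) → (∀ i → x′ i ≈ʳ ((w *ʳ p i) +ʳ x i)) → Cone S W′ x′

module _ {k} {S : Pred (Point k) 0ℓ} where

  cone-resp-≈ : ∀ {W W′ x x′} → W′ ≈ʳ W → (∀ i → x′ i ≈ʳ x i) → Cone S W x → Cone S W′ x′
  cone-resp-≈ {W} {W′} {x} {x′} W′≈W x′≈x (nil W≈0 x≈0) =
    nil (≈-trans {W′} {W} {0ℝ} W′≈W W≈0) (λ i → ≈-trans {x′ i} {x i} {0ℝ} (x′≈x i) (x≈0 i))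
  cone-resp-≈ {W} {W′} {x} {x′} W′≈W x′≈x (cons {w} {V} {p = p} {y} 0≤w Sp cone eqW eqx) =
    cons {w = w} {V} {p = p} {y} 0≤w Sp cone (≈-trans {W′} {W} {w +ʳ V} W′≈W eqW)
      (λ i → ≈-trans {x′ i} {x i} {(w *ʳ p i) +ʳ y i} (x′≈x i) (eqx i))

  cone-+ : ∀ {W W′ x x′} → Cone S W x → Cone S W′ x′ → Cone S (W +ʳ W′) (λ i → x i +ʳ x′ i)
  cone-+ {W} {W′} {x} {x′} (nil W≈0 x≈0) = cone-resp-≈ (drop0 W W′ W≈0) (λ i → drop0 (x i) (x′ i) (x≈0 i))
    where
    drop0 : ∀ a c → a ≈ʳ 0ℝ → (a +ʳ c) ≈ʳ c
    drop0 a c a≈0 = ≈-trans {a +ʳ c} {0ℝ +ʳ c} {c} (+-congʳʳ c {a} {0ℝ} a≈0)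
                      (≗⇒≈ {0ℝ +ʳ c} {c} λ n → ℚ.+-identityˡ (seq c n))
  cone-+ {W} {W′} {x} {x′} (cons {w} {V} {p = p} {y} 0≤w Sp cone eqW eqx) cone′ =
    cons {w = w} {p = p} 0≤w Sp (cone-+ cone cone′) (reassoc W w V W′ eqW) (λ i → reassoc (x i) (w *ʳ p i) (y i) (x′ i) (eqx i))
    where
    reassoc : ∀ a c d e → a ≈ʳ (c +ʳ d) → (a +ʳ e) ≈ʳ (c +ʳ (d +ʳ e))
    reassoc a c d e eq = ≈-trans {a +ʳ e} {(c +ʳ d) +ʳ e} {c +ʳ (d +ʳ e)}
      (+-congʳʳ e {a} {c +ʳ d} eq)
      (≗⇒≈ {(c +ʳ d) +ʳ e} {c +ʳ (d +ʳ e)} λ n → ℚ.+-assoc (seq c n) (seq d n) (seq e n))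

  cone-* : ∀ c {W x} → 0ℝ ≤ʳ c → Cone S W x → Cone S (c *ʳ W) (λ i → c *ʳ x i)
  cone-* c {W} {x} 0≤c (nil W≈0 x≈0) = nil (zero* W W≈0) (λ i → zero* (x i) (x≈0 i))
    where
    zero* : ∀ a → a ≈ʳ 0ℝ → (c *ʳ a) ≈ʳ 0ℝ
    zero* a a≈0 = ≈-trans {c *ʳ a} {c *ʳ 0ℝ} {0ℝ} (*-congˡʳ c {a} {0ℝ} a≈0)
                    (≗⇒≈ {c *ʳ 0ℝ} {0ℝ} λ n → ℚ.*-zeroʳ (seq c n))
  cone-* c {W} {x} 0≤c (cons {w} {V} {p = p} {y} 0≤w Sp cone eqW eqx) =
    cons {w = c *ʳ w} {p = p} (*-nonnegʳ {c} {w} 0≤c 0≤w) Sp (cone-* c 0≤c cone) (distrib W w V eqW)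
      (λ i → ≈-trans {c *ʳ x i} {(c *ʳ (w *ʳ p i)) +ʳ (c *ʳ y i)} {((c *ʳ w) *ʳ p i) +ʳ (c *ʳ y i)}
        (distrib (x i) (w *ʳ p i) (y i) (eqx i))
        (+-congʳʳ (c *ʳ y i) {c *ʳ (w *ʳ p i)} {(c *ʳ w) *ʳ p i}
          (≗⇒≈ {c *ʳ (w *ʳ p i)} {(c *ʳ w) *ʳ p i} λ n → sym (ℚ.*-assoc (seq c n) (seq w n) (seq (p i) n)))))
    where
    distrib : ∀ a d e → a ≈ʳ (d +ʳ e) → (c *ʳ a) ≈ʳ ((c *ʳ d) +ʳ (c *ʳ e))
    distrib a d e eq = ≈-trans {c *ʳ a} {c *ʳ (d +ʳ e)} {(c *ʳ d) +ʳ (c *ʳ e)} (*-congˡʳ c {a} {d +ʳ e} eq)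
      (≗⇒≈ {c *ʳ (d +ʳ e)} {(c *ʳ d) +ʳ (c *ʳ e)} λ n → ℚ.*-distribˡ-+ (seq c n) (seq d n) (seq e n))

  conv⇒cone : ∀ {x} → Conv S x → Cone S 1ℝ x
  conv⇒cone {x} conv = cone-resp-≈ (≈-sym {sumℝ weight} {1ℝ} weights≈1) x≈combine (sums _ point weight point∈S weight≥0)
    where
    open Conv conv
    sums : ∀ m (p : Fin m → Point k) w → (∀ j → S (p j)) → (∀ j → 0ℝ ≤ʳ w j) →
           Cone S (sumℝ w) (λ i → sumℝ (λ j → w j *ʳ p j i))
    sums zero    p w _  _   = nil (≈-refl {0ℝ}) (λ _ → ≈-refl {0ℝ})
    sums (suc m) p w Sp 0≤w =
      cons {w = w Fin.zero} {p = p Fin.zero} (0≤w Fin.zero) (Sp Fin.zero)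
        (sums m (p ∘ Fin.suc) (w ∘ Fin.suc) (Sp ∘ Fin.suc) (0≤w ∘ Fin.suc))
        (≈-refl {sumℝ w}) (λ i → ≈-refl {sumℝ (λ j → w j *ʳ p j i)})

  cone⇒conv : ∀ {x} → Cone S 1ℝ x → Conv S x
  cone⇒conv cone = let m , p , w , Sp , 0≤w , W≈ , x≈ = family cone in record
    { size = m ; point = p ; weight = w ; point∈S = Sp ; weight≥0 = 0≤w
    ; weights≈1 = ≈-sym {1ℝ} {sumℝ w} W≈ ; x≈combine = x≈ }
    where
    family : ∀ {W x} → Cone S W x → Σ[ m ∈ ℕ ] Σ[ p ∈ (Fin m → Point k) ] Σ[ w ∈ (Fin m → ℝ) ]
             (∀ j → S (p j)) × (∀ j → 0ℝ ≤ʳ w j) × W ≈ʳ sumℝ w × (∀ i → x i ≈ʳ sumℝ (λ j → w j *ʳ p j i))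
    family (nil W≈0 x≈0) = 0 , (λ ()) , (λ ()) , (λ ()) , (λ ()) , W≈0 , x≈0
    family {W} {x} (cons {w} {V} {p = p} {y} 0≤w Sp cone eqW eqx) =
      let m , ps , ws , Sps , 0≤ws , V≈ , y≈ = family cone in
      suc m , (λ { Fin.zero → p ; (Fin.suc j) → ps j }) , (λ { Fin.zero → w ; (Fin.suc j) → ws j }) ,
      (λ { Fin.zero → Sp ; (Fin.suc j) → Sps j }) , (λ { Fin.zero → 0≤w ; (Fin.suc j) → 0≤ws j }) ,
      ≈-trans {W} {w +ʳ V} {w +ʳ sumℝ ws} eqW (+-congˡʳ w {V} {sumℝ ws} V≈) ,
      λ i → ≈-trans {x i} {(w *ʳ p i) +ʳ y i} {(w *ʳ p i) +ʳ sumℝ (λ j → ws j *ʳ ps j i)} (eqx i)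
              (+-congˡʳ (w *ʳ p i) {y i} {sumℝ (λ j → ws j *ʳ ps j i)} (y≈ i))

-- A point used with weight `w` is replaced by `w` times a combination of total weight 1. This again
-- has total weight `w`, so the overall weight `W` does not change.
cone-bind : ∀ {k} {S T : Pred (Point k) 0ℓ} → S ⊆ Cone T 1ℝ → ∀ {W x} → Cone S W x → Cone T W x
cone-bind S⊆T (nil W≈0 x≈0) = nil W≈0 x≈0
cone-bind S⊆T {W} (cons {w} {V} {p = p} {y} 0≤w Sp cone eqW eqx) =
  cone-resp-≈ (≈-trans {W} {w +ʳ V} {(w *ʳ 1ℝ) +ʳ V} eqW
                (+-congʳʳ V {w} {w *ʳ 1ℝ} (≗⇒≈ {w} {w *ʳ 1ℝ} λ n → sym (ℚ.*-identityʳ (seq w n)))))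
              eqx
              (cone-+ (cone-* w 0≤w (S⊆T Sp)) (cone-bind S⊆T cone))

conv-bind : ∀ {k} {S T : Pred (Point k) 0ℓ} → S ⊆ Conv T → Conv S ⊆ Conv T
conv-bind S⊆T = cone⇒conv ∘ cone-bind (conv⇒cone ∘ S⊆T) ∘ conv⇒cone

conv-singleton : ∀ {k} {S : Pred (Point k) 0ℓ} → S ⊆ Conv S
conv-singleton {S = S} {x} Sx = cone⇒conv (cons {w = 1ℝ} {W = 0ℝ} {p = x} {x = λ _ → 0ℝ}
  (fromℚ-mono-≤ {0ℚ} {1ℚ} (ℚ.<⇒≤ (ℚ.positive⁻¹ 1ℚ))) Sx
  (nil (≈-refl {0ℝ}) (λ _ → ≈-refl {0ℝ})) (≗⇒≈ {1ℝ} {1ℝ +ʳ 0ℝ} (λ _ → refl))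
  (λ i → ≗⇒≈ {x i} {(1ℝ *ʳ x i) +ʳ 0ℝ} λ n →
    sym (trans (ℚ.+-identityʳ _) (ℚ.*-identityˡ (seq (x i) n)))))

conv-segment : ∀ {k} {S : Pred (Point k) 0ℓ} {x y z : Point k} r t → 0ℚ ℚ.≤ r → 0ℚ ℚ.≤ t → r ℚ.+ t ≡ 1ℚ →
               Conv S x → Conv S y → (∀ i → z i ≈ʳ ((fromℚ r *ʳ x i) +ʳ (fromℚ t *ʳ y i))) → Conv S z
conv-segment r t 0≤r 0≤t r+t≡1 x∈ y∈ z≈ = cone⇒conv (cone-resp-≈
  (≗⇒≈ {1ℝ} {(fromℚ r *ʳ 1ℝ) +ʳ (fromℚ t *ʳ 1ℝ)} λ _ →
    trans (sym r+t≡1) (sym (cong₂ ℚ._+_ (ℚ.*-identityʳ r) (ℚ.*-identityʳ t))))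
  z≈
  (cone-+ (cone-* (fromℚ r) (fromℚ-mono-≤ {0ℚ} {r} 0≤r) (conv⇒cone x∈))
          (cone-* (fromℚ t) (fromℚ-mono-≤ {0ℚ} {t} 0≤t) (conv⇒cone y∈))))

-- Linear functionals on convex hulls

record Linear {k} (F : Point k → ℝ) : Set where
  field
    cong-≈ : ∀ {x y} → (∀ i → x i ≈ʳ y i) → F x ≈ʳ F y
    zeroˡ  : F (λ _ → 0ℝ) ≈ʳ 0ℝ
    affine : ∀ w p x → F (λ i → (w *ʳ p i) +ʳ x i) ≈ʳ ((w *ʳ F p) +ʳ F x)

module _ {k} {F : Point k → ℝ} (linear : Linear F) where
  open Linear linear

  -- The field `affine` has the shape of the constructor `cons`, so the bound follows by induction
  -- along the combination. For a cone of weight `W` the bound has to be scaled to `W *ʳ C`.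
  linear-bound : ∀ {S C} → (∀ {p} → S p → F p ≤ʳ C) → ∀ {W x} → Cone S W x → F x ≤ʳ (W *ʳ C)
  linear-bound {S} {C} bound {W} {x} (nil W≈0 x≈0) = ≈⇒≤ {F x} {W *ʳ C}
    (≈-trans {F x} {0ℝ} {W *ʳ C} (≈-trans {F x} {F (λ _ → 0ℝ)} {0ℝ} (cong-≈ x≈0) zeroˡ)
      (≈-sym {W *ʳ C} {0ℝ} (≈-trans {W *ʳ C} {0ℝ *ʳ C} {0ℝ} (*-congʳʳ C {W} {0ℝ} W≈0)
        (≗⇒≈ {0ℝ *ʳ C} {0ℝ} λ n → ℚ.*-zeroˡ (seq C n)))))
  linear-bound {S} {C} bound {W} {x} (cons {w} {V} {p = p} {y} 0≤w Sp cone eqW eqx) =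
    ≈-≤-trans {F x} {(w *ʳ F p) +ʳ F y} {W *ʳ C}
      (≈-trans {F x} {F (λ i → (w *ʳ p i) +ʳ y i)} {(w *ʳ F p) +ʳ F y} (cong-≈ eqx) (affine w p y))
      (≤-≈-trans {(w *ʳ F p) +ʳ F y} {(w *ʳ C) +ʳ (V *ʳ C)} {W *ʳ C}
        (+-mono-≤ʳ {w *ʳ F p} {w *ʳ C} {F y} {V *ʳ C}
          (*-monoˡ-≤ʳ {w} {F p} {C} 0≤w (bound Sp)) (linear-bound {C = C} bound cone))
        (≈-trans {(w *ʳ C) +ʳ (V *ʳ C)} {(w +ʳ V) *ʳ C} {W *ʳ C}
          (≗⇒≈ {(w *ʳ C) +ʳ (V *ʳ C)} {(w +ʳ V) *ʳ C} λ n → sym (ℚ.*-distribʳ-+ (seq C n) (seq w n) (seq V n)))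
          (*-congʳʳ C {w +ʳ V} {W} (≈-sym {W} {w +ʳ V} eqW))))

  conv-bound : ∀ {S C} → (∀ {p} → S p → F p ≤ʳ C) → ∀ {x} → Conv S x → F x ≤ʳ C
  conv-bound {S} {C} bound {x} conv = ≤-transʳ {F x} {1ℝ *ʳ C} {C} (linear-bound {C = C} bound (conv⇒cone conv))
    (≈⇒≤ {1ℝ *ʳ C} {C} (≗⇒≈ {1ℝ *ʳ C} {C} λ n → ℚ.*-identityˡ (seq C n)))

-- Rado's theorem

fromℕ : ℕ → ℝ
fromℕ n = fromℤ (ℤ.+ n)

fromℕ-mono-≤ : ∀ m n → m ≤ n → fromℕ m ≤ʳ fromℕ n
fromℕ-mono-≤ m n m≤n = fromℚ-mono-≤ {ι (ℤ.+ m)} {ι (ℤ.+ n)} (ι-mono-≤ (ℤ.+≤+ m≤n))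

fromℕ-cancel-≤ : ∀ m n → fromℕ m ≤ʳ fromℕ n → m ≤ n
fromℕ-cancel-≤ m n p = ℤ.drop‿+≤+ (fromℤ-cancel-≤ (ℤ.+ m) (ℤ.+ n) p)

pt : ∀ {k} → List ℕ → Point k
pt β i = fromℕ (nth β (toℕ i))

vecOf : ∀ k → List ℕ → Vec ℕ k
vecOf k β = Vec.tabulate (nth β ∘ toℕ)

toList-vecOf : ∀ {k} β → length β ≡ k → Vec.toList (vecOf k β) ≡ β
toList-vecOf []      refl = refl
toList-vecOf (x ∷ β) refl = cong (x ∷_) (toList-vecOf β refl)

nth-toList : ∀ {k} (α : Vec ℕ k) i → nth (Vec.toList α) (toℕ i) ≡ Vec.lookup α i
nth-toList (x ∷ α) Fin.zero    = refl
nth-toList (x ∷ α) (Fin.suc i) = nth-toList α i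

embed-toList : ∀ {k} (α : Vec ℕ k) i → embed (Vec.map ℤ.+_ α) i ≡ pt (Vec.toList α) i
embed-toList α i = cong fromℤ (trans (Vec.lookup-map i ℤ.+_ α) (cong ℤ.+_ (sym (nth-toList α i))))

≡⇒≈ : ∀ {x y : ℝ} → x ≡ y → x ≈ʳ y
≡⇒≈ {x} refl = ≈-refl {x}

≈embed⇒≈pt : ∀ {k} (α : Vec ℕ k) {x : Point k} → (∀ i → x i ≈ʳ embed (Vec.map ℤ.+_ α) i) → ∀ i → x i ≈ʳ pt (Vec.toList α) i
≈embed⇒≈pt α {x} x≈ i = ≈-trans {x i} {embed (Vec.map ℤ.+_ α) i} {pt (Vec.toList α) i} (x≈ i) (≡⇒≈ (embed-toList α i))

conv-resp-≈ : ∀ {k} {S : Pred (Point k) 0ℓ} {x y} → (∀ i → y i ≈ʳ x i) → Conv S x → Conv S y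
conv-resp-≈ y≈x = cone⇒conv ∘ cone-resp-≈ (≈-refl {1ℝ}) y≈x ∘ conv⇒cone

↭-extract : ∀ {A : Set} {x : A} {as bs} → x ∷ as ↭ bs → ∃₂ λ ls rs → bs ≡ ls ++ x ∷ rs × as ↭ ls ++ rs
↭-extract p with ∈-∃++ (∈-resp-↭ p (here refl))
... | ls , rs , refl = ls , rs , refl , drop-mid [] ls p

++-split : ∀ {A : Set} {y : A} ls {rs ls′ rs′} → ls ++ rs ≡ ls′ ++ y ∷ rs′ →
           (∃[ ms ] rs ≡ ms ++ y ∷ rs′ × ls′ ≡ ls ++ ms) ⊎ (∃[ ms ] ls ≡ ls′ ++ y ∷ ms × rs′ ≡ ms ++ rs)
++-split []       {ls′ = ls′}     eq = inj₁ (ls′ , eq , refl)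
++-split (z ∷ ls) {ls′ = []}      eq with refl , eq′ ← ∷-injective eq = inj₂ (ls , refl , sym eq′)
++-split (z ∷ ls) {ls′ = w ∷ ls′} eq with refl , eq′ ← ∷-injective eq with ++-split ls eq′
... | inj₁ (ms , p , q) = inj₁ (ms , p , cong (z ∷_) q)
... | inj₂ (ms , p , q) = inj₂ (ms , cong (z ∷_) p , q)

↭-two : ∀ {A : Set} {x y : A} {as bs} → x ∷ y ∷ as ↭ bs → ∃[ ls ] ∃[ ms ] ∃[ rs ]
        (bs ≡ ls ++ x ∷ ms ++ y ∷ rs ⊎ bs ≡ ls ++ y ∷ ms ++ x ∷ rs) × as ↭ ls ++ ms ++ rs
↭-two p with ↭-extract p
... | ls , rs , refl , q with ↭-extract q
... | ls′ , rs′ , eq , r with ++-split ls eq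
... | inj₁ (ms , refl , refl) = ls , ms , rs′ , inj₁ refl , subst (_ ↭_) (++-assoc ls ms rs′) r
... | inj₂ (ms , refl , refl) = ls′ , ms , rs , inj₂ (++-assoc ls′ _ _) , r

record Segment (r t : ℚ) (as bs cs : List ℕ) : Set where
  constructor segment
  field nth≡ : ∀ i → ι (ℤ.+ nth cs i) ≡ r ℚ.* ι (ℤ.+ nth as i) ℚ.+ t ℚ.* ι (ℤ.+ nth bs i)

module _ {r t : ℚ} (r+t≡1 : r ℚ.+ t ≡ 1ℚ) where

  segment-constant : ∀ p → p ≡ r ℚ.* p ℚ.+ t ℚ.* p
  segment-constant p = trans (sym (ℚ.*-identityˡ p)) (trans (cong (ℚ._* p) (sym r+t≡1)) (ℚ.*-distribʳ-+ p r t))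

  segment-refl : ∀ as → Segment r t as as as
  segment-refl as = segment λ i → segment-constant (ι (ℤ.+ nth as i))

  segment-∷ : ∀ x y z {as bs cs} → ι (ℤ.+ z) ≡ r ℚ.* ι (ℤ.+ x) ℚ.+ t ℚ.* ι (ℤ.+ y) →
              Segment r t as bs cs → Segment r t (x ∷ as) (y ∷ bs) (z ∷ cs)
  segment-∷ x y z eq (segment nth≡) = segment λ { zero → eq ; (suc i) → nth≡ i }

  segment-++ : ∀ ls {as bs cs} → Segment r t as bs cs → Segment r t (ls ++ as) (ls ++ bs) (ls ++ cs)
  segment-++ []       s = s
  segment-++ (x ∷ ls) s = segment-∷ x x x (segment-constant (ι (ℤ.+ x))) (segment-++ ls s)

  segment-two : ∀ ls ms rs {x y z x′ y′ z′} →
    ι (ℤ.+ z) ≡ r ℚ.* ι (ℤ.+ x) ℚ.+ t ℚ.* ι (ℤ.+ y) → ι (ℤ.+ z′) ≡ r ℚ.* ι (ℤ.+ x′) ℚ.+ t ℚ.* ι (ℤ.+ y′) →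
    Segment r t (ls ++ x ∷ ms ++ x′ ∷ rs) (ls ++ y ∷ ms ++ y′ ∷ rs) (ls ++ z ∷ ms ++ z′ ∷ rs)
  segment-two ls ms rs {x} {y} {z} {x′} {y′} {z′} eq eq′ =
    segment-++ ls (segment-∷ x y z eq (segment-++ ms (segment-∷ x′ y′ z′ eq′ (segment-refl rs))))

  conv-segmentList : ∀ {k} {S : Pred (Point k) 0ℓ} {as bs cs} → 0ℚ ℚ.≤ r → 0ℚ ℚ.≤ t → Segment r t as bs cs →
                     Conv S (pt as) → Conv S (pt bs) → Conv S (pt cs)
  conv-segmentList {as = as} {bs} {cs} 0≤r 0≤t (segment nth≡) as∈ bs∈ =
    conv-segment r t 0≤r 0≤t r+t≡1 as∈ bs∈ λ i →
      ≗⇒≈ {pt cs i} {(fromℚ r *ʳ pt as i) +ʳ (fromℚ t *ʳ pt bs i)} λ _ → nth≡ (toℕ i)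

private
  box-weights : ∀ c e t → e ℚ.* t ≡ 1ℚ →
    ((1ℚ ℚ.- t) ℚ.* (c ℚ.+ e) ℚ.+ t ℚ.* c ≡ c ℚ.+ e ℚ.- 1ℚ) × ((1ℚ ℚ.- t) ℚ.* c ℚ.+ t ℚ.* (c ℚ.+ e) ≡ c ℚ.+ 1ℚ)
  box-weights c e t et≡1 =
    trans (first c e t) (cong (λ u → c ℚ.+ e ℚ.- u) et≡1) , trans (second c e t) (cong (c ℚ.+_) et≡1)
    where
    open +-*-Solver
    first : ∀ c e t → (1ℚ ℚ.- t) ℚ.* (c ℚ.+ e) ℚ.+ t ℚ.* c ≡ c ℚ.+ e ℚ.- e ℚ.* t
    first = solve 3 (λ c e t → (con 1ℚ :- t) :* (c :+ e) :+ t :* c := c :+ e :- e :* t) refl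
    second : ∀ c e t → (1ℚ ℚ.- t) ℚ.* c ℚ.+ t ℚ.* (c ℚ.+ e) ≡ c ℚ.+ e ℚ.* t
    second = solve 3 (λ c e t → (con 1ℚ :- t) :* c :+ t :* (c :+ e) := c :+ e :* t) refl

  p+1-1≡p : ∀ p → p ℚ.+ 1ℚ ℚ.- 1ℚ ≡ p
  p+1-1≡p = solve 1 (λ p → p :+ con 1ℚ :- con 1ℚ := p) refl
    where open +-*-Solver

ι-suc : ∀ n → ι (ℤ.+ suc n) ≡ ι (ℤ.+ n) ℚ.+ 1ℚ
ι-suc n = trans (cong (λ m → ι (ℤ.+ m)) (+-comm 1 n)) (ι-+ (ℤ.+ n) (ℤ.+ 1))

-- (x, y+1) lies on the segment from (x+1, y) to (y, x+1), at parameter t = 1/(x+1-y).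
box-point : ∀ {x y} → y < x → Σ[ t ∈ ℚ ] 0ℚ ℚ.≤ t × t ℚ.≤ 1ℚ ×
  (ι (ℤ.+ x) ≡ (1ℚ ℚ.- t) ℚ.* ι (ℤ.+ suc x) ℚ.+ t ℚ.* ι (ℤ.+ y)) ×
  (ι (ℤ.+ suc y) ≡ (1ℚ ℚ.- t) ℚ.* ι (ℤ.+ y) ℚ.+ t ℚ.* ι (ℤ.+ suc x))
box-point {x} {y} y<x = t , ℚ.<⇒≤ 0<t , t≤1 ,
  sym (trans (cong (λ u → (1ℚ ℚ.- t) ℚ.* u ℚ.+ t ℚ.* ι (ℤ.+ y)) ι[1+x]≡)
    (trans (proj₁ weights) (trans (cong (ℚ._- 1ℚ) (trans (sym ι[1+x]≡) (ι-suc x))) (p+1-1≡p (ι (ℤ.+ x)))))) ,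
  sym (trans (cong (λ u → (1ℚ ℚ.- t) ℚ.* ι (ℤ.+ y) ℚ.+ t ℚ.* u) ι[1+x]≡) (trans (proj₂ weights) (sym (ι-suc y))))
  where
  d = suc x ∸ y
  e = ι (ℤ.+ d)
  1≤d : 1 ≤ d
  1≤d = m<n⇒0<n∸m (m<n⇒m<1+n y<x)
  1≤e : 1ℚ ℚ.≤ e
  1≤e = ι-mono-≤ (ℤ.+≤+ 1≤d)
  e⁺ : ℚ.Positive e
  e⁺ = ℚ.positive (ℚ.<-≤-trans (ℚ.positive⁻¹ 1ℚ) 1≤e)
  t-spec = divide 1ℚ (ℚ.positive⁻¹ 1ℚ) e e⁺
  t = proj₁ t-spec
  0<t = proj₁ (proj₂ t-spec)
  et≡1 = proj₂ (proj₂ t-spec)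
  t≤1 : t ℚ.≤ 1ℚ
  t≤1 = subst₂ ℚ._≤_ (ℚ.*-identityˡ t) et≡1
          (ℚ.*-monoʳ-≤-nonNeg t {{ℚ.nonNegative (ℚ.<⇒≤ 0<t)}} 1≤e)
  ι[1+x]≡ : ι (ℤ.+ suc x) ≡ ι (ℤ.+ y) ℚ.+ e
  ι[1+x]≡ = trans (cong (λ m → ι (ℤ.+ m)) (sym (m+[n∸m]≡n (<⇒≤ (m<n⇒m<1+n y<x))))) (ι-+ (ℤ.+ y) (ℤ.+ d))
  weights = box-weights (ι (ℤ.+ y)) e t et≡1

1-p+p≡1 : ∀ p → 1ℚ ℚ.- p ℚ.+ p ≡ 1ℚ
1-p+p≡1 p = trans (ℚ.+-assoc 1ℚ (ℚ.- p) p) (cong (1ℚ ℚ.+_) (ℚ.+-inverseˡ p))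

place : ∀ {A : Set} {x y : A} {as ls ms rs} → as ↭ ls ++ ms ++ rs → x ∷ y ∷ as ↭ ls ++ x ∷ ms ++ y ∷ rs
place {x = x} {y} {ls = ls} {ms} {rs} as↭ =
  ↭-trans (Perm.prep x (↭-trans (Perm.prep y as↭)
    (↭-trans (↭-sym (shift y ls (ms ++ rs))) (Perm.++⁺ˡ ls (↭-sym (shift y ms rs))))))
  (↭-sym (shift x ls _))

module _ {k} {S : Pred (Point k) 0ℓ} where

  conv-box : ∀ ls ms rs {x y} → y < x →
    Conv S (pt (ls ++ suc x ∷ ms ++ y ∷ rs)) → Conv S (pt (ls ++ y ∷ ms ++ suc x ∷ rs)) →
    Conv S (pt (ls ++ x ∷ ms ++ suc y ∷ rs)) × Conv S (pt (ls ++ suc y ∷ ms ++ x ∷ rs))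
  conv-box ls ms rs {x} {y} y<x c c′ =
    let t , 0≤t , t≤1 , eqx , eqy = box-point y<x
        r+t≡1 = 1-p+p≡1 t
        0≤r   = 0≤q-p {t} {1ℚ} t≤1
    in conv-segmentList {1ℚ ℚ.- t} {t} r+t≡1 0≤r 0≤t
         (segment-two {1ℚ ℚ.- t} {t} r+t≡1 ls ms rs {suc x} {y} {x} {y} {suc x} {suc y} eqx eqy) c c′ ,
       conv-segmentList {1ℚ ℚ.- t} {t} r+t≡1 0≤r 0≤t
         (segment-two {1ℚ ℚ.- t} {t} r+t≡1 ls ms rs {y} {suc x} {suc y} {suc x} {y} {x} eqy eqx) c′ c

module _ (k : ℕ) (S : Pred (Point k) 0ℓ) where

  -- Asking for all rearrangements makes the predicate closed under permutations. It also supplies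
  -- both ends of the segment on which a box move takes place, since they differ by exchanging two
  -- entries.
  InConv : List ℕ → Set
  InConv α = ∀ β → α ↭ β → Conv S (pt β)

  inConv-closed : BoxClosed InConv
  inConv-closed .BoxClosed.perm α↭β α∈ γ β↭γ = α∈ γ (↭-trans α↭β β↭γ)
  inConv-closed .BoxClosed.box {x} {y} {α} y<x α∈ β p = placed (↭-two p)
    where
    both : ∀ ls ms rs → α ↭ ls ++ ms ++ rs → _
    both ls ms rs α↭ = conv-box ls ms rs y<x
      (α∈ (ls ++ suc x ∷ ms ++ y ∷ rs) (place α↭))
      (α∈ (ls ++ y ∷ ms ++ suc x ∷ rs) (↭-trans (Perm.swap (suc x) y ↭-refl) (place α↭)))
    placed : ∃[ ls ] ∃[ ms ] ∃[ rs ] (β ≡ ls ++ x ∷ ms ++ suc y ∷ rs ⊎ β ≡ ls ++ suc y ∷ ms ++ x ∷ rs) × α ↭ ls ++ ms ++ rs →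
             Conv S (pt β)
    placed (ls , ms , rs , inj₁ β≡ , α↭) = subst (Conv S ∘ pt) (sym β≡) (proj₁ (both ls ms rs α↭))
    placed (ls , ms , rs , inj₂ β≡ , α↭) = subst (Conv S ∘ pt) (sym β≡) (proj₂ (both ls ms rs α↭))

padded : ℕ → List ℕ → List ℕ
padded k μ = positiveParts μ ++ replicate (k ∸ length (positiveParts μ)) 0

length-padded : ∀ {k} μ → length (positiveParts μ) ≤ k → length (padded k μ) ≡ k
length-padded {k} μ ℓ≤k = trans (length-++ (positiveParts μ))
  (trans (cong (length (positiveParts μ) +_) (length-replicate _)) (m+[n∸m]≡n ℓ≤k))

permutation-point : ∀ {k} μ → length (positiveParts μ) ≤ k → ∀ {β} → padded k μ ↭ β →
                    Embedded (PermutationOf {k} μ) (pt β)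
permutation-point {k} μ ℓ≤k {β} μ↭β =
  Vec.map ℤ.+_ (vecOf k β) , (vecOf k β , refl , subst (_↭ padded k μ) (sym vecOf≡) (↭-sym μ↭β)) ,
  λ i → ≡⇒≈ (sym (trans (embed-toList (vecOf k β) i) (cong (λ γ → pt γ i) vecOf≡)))
  where
  vecOf≡ : Vec.toList (vecOf k β) ≡ β
  vecOf≡ = toList-vecOf β (trans (sym (↭-length μ↭β)) (length-padded μ ℓ≤k))

inConv-padded : ∀ {k} μ → length (positiveParts μ) ≤ k → InConv k (Embedded (PermutationOf μ)) (padded k μ)
inConv-padded μ ℓ≤k β μ↭β = conv-singleton (permutation-point μ ℓ≤k μ↭β)

-- Lattice points of convex hulls

private
  neg-anti : ∀ {x y ε} → x ℚ.≤ y ℚ.+ ε → (ℚ.- 1ℚ) ℚ.* y ℚ.≤ (ℚ.- 1ℚ) ℚ.* x ℚ.+ ε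
  neg-anti {x} {y} {ε} x≤y+ε = subst₂ ℚ._≤_ (left x y) (right x y ε)
    (ℚ.+-monoˡ-≤ (ℚ.- x ℚ.- y) x≤y+ε)
    where
    open +-*-Solver
    left : ∀ x y → x ℚ.+ (ℚ.- x ℚ.- y) ≡ (ℚ.- 1ℚ) ℚ.* y
    left = solve 2 (λ x y → x :+ (:- x :- y) := (:- con 1ℚ) :* y) refl
    right : ∀ x y ε → y ℚ.+ ε ℚ.+ (ℚ.- x ℚ.- y) ≡ (ℚ.- 1ℚ) ℚ.* x ℚ.+ ε
    right = solve 3 (λ x y ε → y :+ ε :+ (:- x :- y) := (:- con 1ℚ) :* x :+ ε) refl

  -1*-1*p : ∀ p → (ℚ.- 1ℚ) ℚ.* ((ℚ.- 1ℚ) ℚ.* p) ≡ p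
  -1*-1*p = solve 1 (λ p → (:- con 1ℚ) :* ((:- con 1ℚ) :* p) := p) refl
    where open +-*-Solver

  neg-affine : ∀ c w x y → c ℚ.* (w ℚ.* x ℚ.+ y) ≡ w ℚ.* (c ℚ.* x) ℚ.+ c ℚ.* y
  neg-affine = solve 4 (λ c w x y → c :* (w :* x :+ y) := w :* (c :* x) :+ c :* y) refl
    where open +-*-Solver

-‿anti-≤ʳ : ∀ {x y} → x ≤ʳ y → (-ʳ y) ≤ʳ (-ʳ x)
-‿anti-≤ʳ {x} {y} x≤y ε 0<ε = let N , close = x≤y ε 0<ε in
  N , λ n N≤n → neg-anti {seq x n} {seq y n} (close n N≤n)

-‿linear : ∀ {k} {F : Point k → ℝ} → Linear F → Linear (λ x → -ʳ F x)
-‿linear {F = F} linear = record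
  { cong-≈ = λ {x} {y} x≈y → *-congˡʳ (fromℚ (ℚ.- 1ℚ)) {F x} {F y} (cong-≈ x≈y)
  ; zeroˡ  = ≈-trans { -ʳ F (λ _ → 0ℝ)} { -ʳ 0ℝ} {0ℝ} (*-congˡʳ (fromℚ (ℚ.- 1ℚ)) {F (λ _ → 0ℝ)} {0ℝ} zeroˡ)
               (≗⇒≈ { -ʳ 0ℝ} {0ℝ} λ _ → refl)
  ; affine = λ w p x → ≈-trans { -ʳ F (λ i → (w *ʳ p i) +ʳ x i)} { -ʳ ((w *ʳ F p) +ʳ F x)} {(w *ʳ (-ʳ F p)) +ʳ (-ʳ F x)}
      (*-congˡʳ (fromℚ (ℚ.- 1ℚ)) {F (λ i → (w *ʳ p i) +ʳ x i)} {(w *ʳ F p) +ʳ F x} (affine w p x))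
      (≗⇒≈ { -ʳ ((w *ʳ F p) +ʳ F x)} {(w *ʳ (-ʳ F p)) +ʳ (-ʳ F x)} λ n →
        neg-affine (ℚ.- 1ℚ) (seq w n) (seq (F p) n) (seq (F x) n))
  }
  where open Linear linear

conv-bound-below : ∀ {k} {F : Point k → ℝ} → Linear F → ∀ {S C} → (∀ {p} → S p → C ≤ʳ F p) →
                   ∀ {x} → Conv S x → C ≤ʳ F x
conv-bound-below {F = F} linear {C = C} bound {x} conv =
  ≤-transʳ {C} { -ʳ (-ʳ C)} {F x} (≈⇒≤ {C} { -ʳ (-ʳ C)} (≈-sym { -ʳ (-ʳ C)} {C} (involutive C)))
    (≤-transʳ { -ʳ (-ʳ C)} { -ʳ (-ʳ F x)} {F x}
      (-‿anti-≤ʳ { -ʳ F x} { -ʳ C} (conv-bound (-‿linear linear) {C = -ʳ C} (λ {p} Sp → -‿anti-≤ʳ {C} {F p} (bound Sp)) conv))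
      (≈⇒≤ { -ʳ (-ʳ F x)} {F x} (involutive (F x))))
  where
  involutive : ∀ x → (-ʳ (-ʳ x)) ≈ʳ x
  involutive x = ≗⇒≈ { -ʳ (-ʳ x)} {x} λ n → -1*-1*p (seq x n)

coordinate-linear : ∀ {k} (i : Fin k) → Linear (λ x → x i)
coordinate-linear i = record
  { cong-≈ = λ x≈y → x≈y i
  ; zeroˡ  = ≈-refl {0ℝ}
  ; affine = λ w p x → ≈-refl {(w *ʳ p i) +ʳ x i} }

sumOver : ∀ {k} → List (Fin k) → Point k → ℝ
sumOver []       x = 0ℝ
sumOver (i ∷ is) x = x i +ʳ sumOver is x

sumOver-linear : ∀ {k} (is : List (Fin k)) → Linear (sumOver is)
sumOver-linear [] = record
  { cong-≈ = λ _ → ≈-refl {0ℝ}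
  ; zeroˡ  = ≈-refl {0ℝ}
  ; affine = λ w p x → ≗⇒≈ {0ℝ} {(w *ʳ 0ℝ) +ʳ 0ℝ} λ n → sym (cong (ℚ._+ 0ℚ) (ℚ.*-zeroʳ (seq w n))) }
sumOver-linear (i ∷ is) = record
  { cong-≈ = λ {x} {y} x≈y → +-congʳ {x i} {y i} {sumOver is x} {sumOver is y} (x≈y i) (cong-≈ x≈y)
  ; zeroˡ  = ≈-trans {0ℝ +ʳ sumOver is (λ _ → 0ℝ)} {0ℝ +ʳ 0ℝ} {0ℝ}
      (+-congˡʳ 0ℝ {sumOver is (λ _ → 0ℝ)} {0ℝ} zeroˡ)
      (≗⇒≈ {0ℝ +ʳ 0ℝ} {0ℝ} λ _ → refl)
  ; affine = λ w p x → ≈-trans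
      {((w *ʳ p i) +ʳ x i) +ʳ sumOver is (λ i → (w *ʳ p i) +ʳ x i)}
      {((w *ʳ p i) +ʳ x i) +ʳ ((w *ʳ sumOver is p) +ʳ sumOver is x)}
      {(w *ʳ (p i +ʳ sumOver is p)) +ʳ (x i +ʳ sumOver is x)}
      (+-congˡʳ ((w *ʳ p i) +ʳ x i) {sumOver is (λ i → (w *ʳ p i) +ʳ x i)}
        {(w *ʳ sumOver is p) +ʳ sumOver is x} (affine w p x))
      (≗⇒≈ {((w *ʳ p i) +ʳ x i) +ʳ ((w *ʳ sumOver is p) +ʳ sumOver is x)}
           {(w *ʳ (p i +ʳ sumOver is p)) +ʳ (x i +ʳ sumOver is x)}
        λ n → regroup (seq w n) (seq (p i) n) (seq (x i) n) (seq (sumOver is p) n) (seq (sumOver is x) n))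
  }
  where
  open Linear (sumOver-linear is)
  regroup : ∀ w a c d e → w ℚ.* a ℚ.+ c ℚ.+ (w ℚ.* d ℚ.+ e) ≡ w ℚ.* (a ℚ.+ d) ℚ.+ (c ℚ.+ e)
  regroup = solve 5 (λ w a c d e → w :* a :+ c :+ (w :* d :+ e) := w :* (a :+ d) :+ (c :+ e)) refl
    where open +-*-Solver

sumOver-pt : ∀ {k} (is : List (Fin k)) β → sumOver is (pt β) ≈ʳ fromℕ (sum (map (nth β ∘ toℕ) is))
sumOver-pt []       β = ≈-refl {0ℝ}
sumOver-pt (i ∷ is) β = ≈-trans {pt β i +ʳ sumOver is (pt β)} {pt β i +ʳ fromℕ rest} {fromℕ (nth β (toℕ i) + rest)}
  (+-congˡʳ (pt β i) {sumOver is (pt β)} {fromℕ rest} (sumOver-pt is β))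
  (≗⇒≈ {pt β i +ʳ fromℕ rest} {fromℕ (nth β (toℕ i) + rest)} λ _ → sym (ι-+ (ℤ.+ nth β (toℕ i)) (ℤ.+ rest)))
  where rest = sum (map (nth β ∘ toℕ) is)

sortDecreasing : ∀ α → ∃[ β ] α ↭ β × Decreasing β
sortDecreasing α = sort α , ↭-sym (sort-↭ α) , Linked⇒AllPairs (λ x≥y y≥z → ≤-trans y≥z x≥y) (sort-↗ α)
  where
  open import Data.List.Sort (Flip.decTotalOrder ≤-decTotalOrder) using (sort; sort-↭; sort-↗)
  open import Data.List.Relation.Unary.Linked.Properties using (Linked⇒AllPairs)

map-nth-allFin : ∀ {k} β → length β ≡ k → map (nth β ∘ toℕ) (allFin k) ≡ β
map-nth-allFin []      refl = refl
map-nth-allFin (x ∷ β) refl = cong (x ∷_) (trans (trans (map-tabulate Fin.suc (nth (x ∷ β) ∘ toℕ))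
  (sym (map-tabulate id (nth β ∘ toℕ)))) (map-nth-allFin β refl))

-- What is sorted is the list of coordinates and not just the list of entries: the prefix sums of
-- the sorted vector must be linear functionals that can be evaluated at every other point of the
-- hull as well.
sortCoordinates : ∀ {k} β → length β ≡ k →
                  ∃[ js ] allFin k ↭ js × Decreasing (map (nth β ∘ toℕ) js)
sortCoordinates {k} β len with sortDecreasing β
... | γ , β↭γ , γ-dec with ↭-map-inv (nth β ∘ toℕ) (subst (_↭ γ) (sym (map-nth-allFin β len)) β↭γ)
... | is , refl , p = is , p , γ-dec

reorder : ∀ {k} {is : List (Fin k)} → allFin k ↭ is → ∀ β → length β ≡ k → β ↭ map (nth β ∘ toℕ) is
reorder p β len = subst (_↭ map (nth β ∘ toℕ) _) (map-nth-allFin β len) (Perm.map⁺ (nth β ∘ toℕ) p)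

-- Saturation from domination

sum-filter-pos : ∀ μ → sum (positiveParts μ) ≡ sum μ
sum-filter-pos []          = refl
sum-filter-pos (zero ∷ μ)  = sum-filter-pos μ
sum-filter-pos (suc x ∷ μ) = cong (suc x +_) (sum-filter-pos μ)

sum-take-filter-pos : ∀ m μ → sum (take m μ) ≤ sum (take m (positiveParts μ))
sum-take-filter-pos zero    μ           = z≤n
sum-take-filter-pos (suc m) []          = z≤n
sum-take-filter-pos (suc m) (zero ∷ μ)  =
  ≤-trans (sum-take-filter-pos m μ) (sum-take-mono (positiveParts μ) (n≤1+n m))
sum-take-filter-pos (suc m) (suc x ∷ μ) = +-monoʳ-≤ (suc x) (sum-take-filter-pos m μ)

sum-take-++ : ∀ m xs ys → sum (take m xs) ≤ sum (take m (xs ++ ys))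
sum-take-++ zero    xs       ys = z≤n
sum-take-++ (suc m) []       ys = z≤n
sum-take-++ (suc m) (x ∷ xs) ys = +-monoʳ-≤ x (sum-take-++ m xs ys)

sum-zeros : ∀ m → sum (replicate m 0) ≡ 0
sum-zeros zero    = refl
sum-zeros (suc m) = sum-zeros m

sum-padded : ∀ k μ → sum (padded k μ) ≡ sum μ
sum-padded k μ = trans (sum-++ (positiveParts μ) _)
  (trans (cong (sum (positiveParts μ) +_) (sum-zeros (k ∸ length (positiveParts μ))))
    (trans (+-identityʳ _) (sum-filter-pos μ)))

length≤⇐sum-take : ∀ k {xs} → All (0 <_) xs → sum xs ≤ sum (take k xs) → length xs ≤ k
length≤⇐sum-take k       []         _ = z≤n
length≤⇐sum-take zero    {x ∷ xs} (0<x ∷ _)    p = contradiction (≤-trans 0<x (≤-trans (m≤m+n x (sum xs)) p)) λ ()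
length≤⇐sum-take (suc k) {x ∷ xs} (0<x ∷ 0<xs) p = s≤s (length≤⇐sum-take k 0<xs (+-cancelˡ-≤ x _ _ p))

sumAt : ∀ {k} → List (Fin k) → Vec ℕ k → ℕ
sumAt is α = sum (map (nth (Vec.toList α) ∘ toℕ) is)

sumOver-embed : ∀ {k} (is : List (Fin k)) α {x : Point k} → (∀ i → x i ≈ʳ embed (Vec.map ℤ.+_ α) i) →
                sumOver is x ≈ʳ fromℕ (sumAt is α)
sumOver-embed is α {x} x≈ = ≈-trans {sumOver is x} {sumOver is (pt (Vec.toList α))} {fromℕ (sumAt is α)}
  (Linear.cong-≈ (sumOver-linear is) (≈embed⇒≈pt α {x} x≈)) (sumOver-pt is (Vec.toList α))

-- W stands for the set of weights of the proper colourings of a graph.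
record DominatedWeights (W : List ℕ → Set) (μ : List ℕ) : Set where
  field
    boxClosed : BoxClosed W
    padding   : ∀ m {α} → W α → W (α ++ replicate m 0)
    dominated : ∀ {α} → W α → ∀ m → sum (take m α) ≤ sum (take m μ)
    total     : ∀ {α} → W α → sum α ≡ sum μ
    -- `μ` itself may carry zeros and be longer than the number of variables, as the greedy weight
    -- of `n` entries is. Only its positive parts can be padded to every admissible length.
    attained  : W (positiveParts μ)

module _ {W : List ℕ → Set} {μ : List ℕ} (dw : DominatedWeights W μ) where
  open DominatedWeights dw
  open BoxClosed boxClosed

  attained-padded : ∀ k → W (padded k μ)
  attained-padded k = padding _ attained

  -- By domination, as many entries of `μ` as `α` has already reach the full total, which leaves no
  -- room for a further positive part. Hence too few variables leave the support empty, in agreement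
  -- with the empty permutahedron.
  length-positiveParts-≤ : ∀ {α} → W α → length (positiveParts μ) ≤ length α
  length-positiveParts-≤ {α} Wα = length≤⇐sum-take (length α) (All.all-filter (0 <?_) μ) (begin
    sum (positiveParts μ)                        ≡⟨ sum-filter-pos μ ⟩
    sum μ                                        ≡⟨ total Wα ⟨
    sum α                                        ≡⟨ sum-take-length α ≤-refl ⟨
    sum (take (length α) α)                      ≤⟨ dominated Wα (length α) ⟩
    sum (take (length α) μ)                      ≤⟨ sum-take-filter-pos (length α) μ ⟩
    sum (take (length α) (positiveParts μ))      ∎)
    where open ≤-Reasoning

  majorized : ∀ {k Q α} → BoxClosed Q → Decreasing α → length α ≡ k → length (positiveParts μ) ≤ k →
              (∀ m → sum (take m α) ≤ sum (take m μ)) → sum α ≡ sum μ → Q (padded k μ) → Q α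
  majorized {k} Q-closed dec len ℓ≤k prefix eq =
    majorized-closed Q-closed dec (trans len (sym (length-padded μ ℓ≤k)))
      (λ m → ≤-trans (prefix m) (≤-trans (sum-take-filter-pos m μ) (sum-take-++ m (positiveParts μ) _)))
      (trans eq (sym (sum-padded k μ)))

  module _ {k : ℕ} (p : Poly k)
           (supp⇒W : ∀ α → coeff p α ≢ ℤ.0ℤ → W (Vec.toList α))
           (W⇒supp : ∀ α → W (Vec.toList α) → coeff p α ≢ ℤ.0ℤ) where

    length-positiveParts-≤k : ∀ α → coeff p α ≢ ℤ.0ℤ → length (positiveParts μ) ≤ k
    length-positiveParts-≤k α c≢0 =
      subst (length (positiveParts μ) ≤_) (Vec.length-toList α) (length-positiveParts-≤ (supp⇒W α c≢0))

    supp⊆permutahedron : Embedded (supp p) ⊆ Conv (Embedded (PermutationOf μ))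
    supp⊆permutahedron {x} (_ , (α , refl , c≢0) , x≈) with sortDecreasing (Vec.toList α)
    ... | β , α↭β , β-dec = conv-resp-≈ {x = pt (Vec.toList α)} {x} (≈embed⇒≈pt α {x} x≈)
      (majorized (inConv-closed k (Embedded (PermutationOf μ))) β-dec
        (trans (sym (↭-length α↭β)) (Vec.length-toList α)) ℓ≤k (dominated Wβ) (total Wβ)
        (inConv-padded μ ℓ≤k) (Vec.toList α) (↭-sym α↭β))
      where
      Wβ = perm α↭β (supp⇒W α c≢0)
      ℓ≤k = length-positiveParts-≤k α c≢0

    permutations⊆supp : Embedded (PermutationOf {k} μ) ⊆ Embedded (supp p)
    permutations⊆supp (z , (α , z≡ , α↭) , x≈) =
      z , (α , z≡ , W⇒supp α (perm (↭-sym α↭) (attained-padded k))) , x≈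

    -- A combination of total weight 1 involves at least one point of the support. The exponent of
    -- that point is the witness from which the bound on the number of positive parts of `μ` is
    -- obtained.
    newton-inhabited : ∀ {x} → Newton p x → ∃[ α ] coeff p α ≢ ℤ.0ℤ
    newton-inhabited record { size = zero ; weights≈1 = 0≈1 } =
      contradiction (fromℚ-cancel-≤ {1ℚ} {0ℚ} (≈⇒≤ {1ℝ} {0ℝ} (≈-sym {0ℝ} {1ℝ} 0≈1)))
        (λ 1≤0 → ℚ.<-irrefl refl (ℚ.<-≤-trans (ℚ.positive⁻¹ 1ℚ) 1≤0))
    newton-inhabited record { size = suc m ; point∈S = Sp } =
      let _ , (α , _ , c≢0) , _ = Sp Fin.zero in α , c≢0

    newton≐permutahedron : Newton p ≐ Permutahedron k μ
    newton≐permutahedron =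
      (λ x∈ → let α , c≢0 = newton-inhabited x∈ in length-positiveParts-≤k α c≢0 , conv-bind supp⊆permutahedron x∈) ,
      (λ (_ , x∈) → conv-bind (λ {y} y∈ → conv-singleton {x = y} (permutations⊆supp {y} y∈)) x∈)

    newton⇒nonneg : ∀ {z} → Newton p (embed z) → ∀ i → ℤ.0ℤ ℤ.≤ Vec.lookup z i
    newton⇒nonneg {z} z∈ i = fromℤ-cancel-≤ ℤ.0ℤ (Vec.lookup z i) (conv-bound-below (coordinate-linear i) {C = 0ℝ}
      (λ { {x} (_ , (α , refl , _) , x≈) → ≤-≈-trans {0ℝ} {embed (Vec.map ℤ.+_ α) i} {x i}
             (subst (λ a → 0ℝ ≤ʳ fromℤ a) (sym (Vec.lookup-map i ℤ.+_ α)) (fromℕ-mono-≤ 0 (Vec.lookup α i) z≤n))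
             (≈-sym {x i} {embed (Vec.map ℤ.+_ α) i} (x≈ i)) }) z∈)

    -- The coordinates are sorted with respect to `α`, and the same coordinates are summed at every
    -- point of the support. There they need not be in decreasing order, but the reordered exponent
    -- is again a weight, so its prefix sums are bounded by those of `μ`. Linearity carries these
    -- bounds, and the total in both directions, over to `α`. Then `α`, sorted, is majorized by the
    -- padded `μ`, and box moves reach it within `W`.
    newton⇒supp : ∀ α → Newton p (embed (Vec.map ℤ.+_ α)) → coeff p α ≢ ℤ.0ℤ
    newton⇒supp α z∈ with sortCoordinates (Vec.toList α) (Vec.length-toList α)
    ... | is , allFin↭is , dec = W⇒supp α (perm (↭-sym α↭) (majorized boxClosed dec
            (trans (sym (↭-length α↭)) (Vec.length-toList α)) ℓ≤k prefix
            (≤-antisym total-≤ total-≥) (attained-padded k)))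
      where
      α↭ = reorder allFin↭is (Vec.toList α) (Vec.length-toList α)
      ℓ≤k = let α′ , c≢0 = newton-inhabited z∈ in length-positiveParts-≤k α′ c≢0
      z≈ : ∀ js → sumOver js (embed (Vec.map ℤ.+_ α)) ≈ʳ fromℕ (sumAt js α)
      z≈ js = sumOver-embed js α {embed (Vec.map ℤ.+_ α)} λ i → ≈-refl {embed (Vec.map ℤ.+_ α) i}
      bound : ∀ js C → (∀ β → coeff p β ≢ ℤ.0ℤ → sumAt js β ≤ C) → sumAt js α ≤ C
      bound js C each = fromℕ-cancel-≤ (sumAt js α) C (≈-≤-trans {fromℕ (sumAt js α)} {sumOver js (embed (Vec.map ℤ.+_ α))} {fromℕ C}
        (≈-sym {sumOver js (embed (Vec.map ℤ.+_ α))} {fromℕ (sumAt js α)} (z≈ js))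
        (conv-bound (sumOver-linear js) {C = fromℕ C}
          (λ { {x} (_ , (β , refl , c≢0) , x≈) → ≈-≤-trans {sumOver js x} {fromℕ (sumAt js β)} {fromℕ C}
                 (sumOver-embed js β {x} x≈) (fromℕ-mono-≤ (sumAt js β) C (each β c≢0)) }) z∈))
      bound-below : ∀ js C → (∀ β → coeff p β ≢ ℤ.0ℤ → C ≤ sumAt js β) → C ≤ sumAt js α
      bound-below js C each = fromℕ-cancel-≤ C (sumAt js α) (≤-≈-trans {fromℕ C} {sumOver js (embed (Vec.map ℤ.+_ α))} {fromℕ (sumAt js α)}
        (conv-bound-below (sumOver-linear js) {C = fromℕ C}
          (λ { {x} (_ , (β , refl , c≢0) , x≈) → ≤-≈-trans {fromℕ C} {fromℕ (sumAt js β)} {sumOver js x}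
                 (fromℕ-mono-≤ C (sumAt js β) (each β c≢0)) (≈-sym {sumOver js x} {fromℕ (sumAt js β)} (sumOver-embed js β {x} x≈)) }) z∈)
        (z≈ js))
      reordered : ∀ β → coeff p β ≢ ℤ.0ℤ → W (map (nth (Vec.toList β) ∘ toℕ) is)
      reordered β c≢0 = perm (reorder allFin↭is (Vec.toList β) (Vec.length-toList β)) (supp⇒W β c≢0)
      prefix : ∀ m → sum (take m (map (nth (Vec.toList α) ∘ toℕ) is)) ≤ sum (take m μ)
      prefix m = subst (λ js → sum js ≤ sum (take m μ)) (sym (take-map m is))
        (bound (take m is) (sum (take m μ)) λ β c≢0 →
          subst (λ js → sum js ≤ sum (take m μ)) (take-map m is) (dominated (reordered β c≢0) m))
      total-≤ : sumAt is α ≤ sum μ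
      total-≤ = bound is (sum μ) λ β c≢0 → ≤-reflexive (total (reordered β c≢0))
      total-≥ : sum μ ≤ sumAt is α
      total-≥ = bound-below is (sum μ) λ β c≢0 → ≤-reflexive (sym (total (reordered β c≢0)))

    saturated : SNP p
    saturated =
      (λ {z} z∈ → conv-singleton (z , z∈ , λ i → ≈-refl {embed z i})) ,
      (λ {z} z∈ → let z≡ = nonneg z (newton⇒nonneg {z} z∈) in
        Vec.map ℤ.∣_∣ z , z≡ , newton⇒supp (Vec.map ℤ.∣_∣ z) (subst (Newton p ∘ embed) z≡ z∈))
      where
      nonneg : ∀ {k} (z : Vec ℤ k) → (∀ i → ℤ.0ℤ ℤ.≤ Vec.lookup z i) → z ≡ Vec.map ℤ.+_ (Vec.map ℤ.∣_∣ z)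
      nonneg []      _   = refl
      nonneg (a ∷ z) 0≤z = cong₂ _∷_ (sym (ℤ.0≤i⇒+∣i∣≡i (0≤z Fin.zero))) (nonneg z (0≤z ∘ Fin.suc))

-- The support of the chromatic symmetric polynomial

weightVec : ∀ k → List ℕ → Vec ℕ k
weightVec k cs = Vec.tabulate λ i → occurrences (toℕ i) cs

lookup-weightVec : ∀ {k} cs (i : Fin k) → Vec.lookup (weightVec k cs) i ≡ occurrences (toℕ i) cs
lookup-weightVec cs i = Vec.lookup∘tabulate _ i

vec-ext : ∀ {n} {xs ys : Vec ℕ n} → (∀ i → Vec.lookup xs i ≡ Vec.lookup ys i) → xs ≡ ys
vec-ext {xs = xs} {ys} eq = trans (sym (Vec.tabulate∘lookup xs)) (trans (Vec.tabulate-cong eq) (Vec.tabulate∘lookup ys))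

weightVec-[] : ∀ k → weightVec k [] ≡ Vec.replicate k 0
weightVec-[] k = vec-ext λ i → trans (lookup-weightVec [] i) (sym (Vec.lookup-replicate i 0))

weightVec-∷ : ∀ {k} (c : Fin k) cs →
  Vec.zipWith _+_ (Vec.replicate k 0 Vec.[ c ]≔ 1) (weightVec k cs) ≡ weightVec k (toℕ c ∷ cs)
weightVec-∷ {k} c cs = vec-ext λ i → trans (Vec.lookup-zipWith _+_ i (Vec.replicate k 0 Vec.[ c ]≔ 1) (weightVec k cs))
  (trans (cong (Vec.lookup (Vec.replicate k 0 Vec.[ c ]≔ 1) i +_) (lookup-weightVec cs i))
    (trans (unit i) (sym (lookup-weightVec (toℕ c ∷ cs) i))))
  where
  unit : ∀ i → Vec.lookup (Vec.replicate k 0 Vec.[ c ]≔ 1) i + occurrences (toℕ i) cs ≡ occurrences (toℕ i) (toℕ c ∷ cs)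
  unit i with i Fin.≟ c
  ... | yes refl = trans (cong (_+ occurrences (toℕ c) cs) (Vec.lookup∘updateAt c (Vec.replicate k 0)))
                     (sym (count-accept (_≟ toℕ c) {xs = cs} refl))
  ... | no i≢c = trans (cong (_+ occurrences (toℕ i) cs)
                         (trans (Vec.lookup∘updateAt′ i c i≢c (Vec.replicate k 0)) (Vec.lookup-replicate i 0)))
                   (sym (count-reject (_≟ toℕ i) {xs = cs} (i≢c ∘ sym ∘ Fin.toℕ-injective)))

product-var : ∀ {A : Set} {k} (c : A → Fin k) xs →
              productₚ (map (var ∘ c) xs) ≡ (ℤ.1ℤ , weightVec k (map (toℕ ∘ c) xs)) ∷ []
product-var {k = k} c [] = cong (λ α → (ℤ.1ℤ , α) ∷ []) (sym (weightVec-[] k))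
product-var c (x ∷ xs) = trans (cong (var (c x) *ₚ_) (product-var c xs))
  (cong (λ α → (ℤ.1ℤ , α) ∷ []) (weightVec-∷ (c x) (map (toℕ ∘ c) xs)))

module _ {A : Set} {k} (w : A → Vec ℕ k) where

  sum-monomials : ∀ xs → sumₚ (map (λ x → (ℤ.1ℤ , w x) ∷ []) xs) ≡ map (λ x → ℤ.1ℤ , w x) xs
  sum-monomials []       = refl
  sum-monomials (x ∷ xs) = cong ((ℤ.1ℤ , w x) ∷_) (sum-monomials xs)

  -- All terms have coefficient 1, so nothing cancels: a coefficient counts colourings and vanishes
  -- only if there is none of that weight.
  coeff-monomials : ∀ xs α → coeff (map (λ x → ℤ.1ℤ , w x) xs) α ≡ ℤ.+ count (λ x → Vec.≡-dec _≟_ (w x) α) xs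
  coeff-monomials []       α = refl
  coeff-monomials (x ∷ xs) α with Vec.≡-dec _≟_ (w x) α
  ... | yes _ = cong (λ c → ℤ.1ℤ ℤ.+ c) (coeff-monomials xs α)
  ... | no  _ = coeff-monomials xs α

∈-allVecs : ∀ {A : Set} {xs : List A} {n} (f : Vec A n) → (∀ i → Vec.lookup f i ∈ xs) → f ∈ allVecs xs n
∈-allVecs []      _   = here refl
∈-allVecs (x ∷ f) f∈ = ∈-cartesianProductWith⁺ _∷_ (f∈ Fin.zero) (∈-allVecs f (f∈ ∘ Fin.suc))

GraphColouring : ∀ {n} → Graph n → List ℕ → Set
GraphColouring {n} G = Colouring (Adj G) (allFin n)

module _ {n} (G : Graph n) (k : ℕ) where

  private
    colours : Vec (Fin k) n → List ℕ
    colours f = map (toℕ ∘ Vec.lookup f) (allFin n)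

    properColourings : List (Vec (Fin k) n)
    properColourings = filter (proper? G) (allVecs (allFin k) n)

    coeff-X : ∀ α → coeff (X G k) α ≡ ℤ.+ count (λ f → Vec.≡-dec _≟_ (weightVec k (colours f)) α) properColourings
    coeff-X α = trans (cong (λ p → coeff p α) (trans
      (cong sumₚ (map-cong (λ f → product-var (Vec.lookup f) (allFin n)) properColourings))
      (sum-monomials (weightVec k ∘ colours) properColourings)))
      (coeff-monomials (weightVec k ∘ colours) properColourings α)

  coeff⇒colouring : ∀ α → coeff (X G k) α ≢ ℤ.0ℤ → GraphColouring G (Vec.toList α)
  coeff⇒colouring α c≢0
    with 0<count⇒∈ (λ f → Vec.≡-dec _≟_ (weightVec k (colours f)) α) properColourings
           (n≢0⇒n>0 λ eq → c≢0 (trans (coeff-X α) (cong ℤ.+_ eq)))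
  ... | f , f∈ , refl = record
    { colour = toℕ ∘ Vec.lookup f
    ; proper = λ {x} {y} xy eq → proj₂ (∈-filter⁻ (proper? G) {xs = allVecs (allFin k) n} f∈) x y xy (Fin.toℕ-injective eq)
    ; mult   = mult
    }
    where
    mult : HasMultiplicities (Vec.toList (weightVec k (colours f))) (colours f)
    mult c with c <? k
    ... | yes c<k = begin
      occurrences c (colours f)                                      ≡⟨ cong (λ c → occurrences c (colours f)) (Fin.toℕ-fromℕ< c<k) ⟨
      occurrences (toℕ (fromℕ< c<k)) (colours f)                     ≡⟨ lookup-weightVec (colours f) (fromℕ< c<k) ⟨
      Vec.lookup (weightVec k (colours f)) (fromℕ< c<k)              ≡⟨ nth-toList (weightVec k (colours f)) (fromℕ< c<k) ⟨
      nth (Vec.toList (weightVec k (colours f))) (toℕ (fromℕ< c<k))  ≡⟨ cong (nth (Vec.toList (weightVec k (colours f)))) (Fin.toℕ-fromℕ< c<k) ⟩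
      nth (Vec.toList (weightVec k (colours f))) c                   ∎
      where open ≡-Reasoning
    ... | no c≮k = trans
      (count-none (_≟ c) (All.map⁺ (All.universal (λ { i refl → c≮k (Fin.toℕ<n (Vec.lookup f i)) }) (allFin n))))
      (sym (nth-overflow (Vec.toList (weightVec k (colours f)))
        (≤-trans (≤-reflexive (Vec.length-toList (weightVec k (colours f)))) (≮⇒≥ c≮k))))

  colouring⇒coeff : ∀ α → GraphColouring G (Vec.toList α) → coeff (X G k) α ≢ ℤ.0ℤ
  colouring⇒coeff α g c≡0 = >⇒≢ (∈⇒0<count (λ f → Vec.≡-dec _≟_ (weightVec k (colours f)) α)
      (∈-filter⁺ (proper? G) (∈-allVecs f (λ _ → ∈-allFin _)) f-proper) f-weight)
    (ℤ.+-injective (trans (sym (coeff-X α)) c≡0))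
    where
    open Colouring g
    colour<k : ∀ x → colour x < k
    colour<k x = subst (colour x <_) (Vec.length-toList α)
      (colour<length {Vec.toList α} {map colour (allFin n)} mult (∈-map⁺ colour (∈-allFin x)))
    f : Vec (Fin k) n
    f = Vec.tabulate λ x → fromℕ< (colour<k x)
    toℕ-f : ∀ x → toℕ (Vec.lookup f x) ≡ colour x
    toℕ-f x = trans (cong toℕ (Vec.lookup∘tabulate (λ x → fromℕ< (colour<k x)) x)) (Fin.toℕ-fromℕ< (colour<k x))
    f-proper : Proper G f
    f-proper x y xy eq = proper xy (trans (sym (toℕ-f x)) (trans (cong toℕ eq) (toℕ-f y)))
    f-weight : weightVec k (colours f) ≡ α
    f-weight = vec-ext λ i → begin
      Vec.lookup (weightVec k (colours f)) i     ≡⟨ lookup-weightVec (colours f) i ⟩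
      occurrences (toℕ i) (colours f)            ≡⟨ cong (occurrences (toℕ i)) (map-cong toℕ-f (allFin n)) ⟩
      occurrences (toℕ i) (map colour (allFin n)) ≡⟨ mult (toℕ i) ⟩
      nth (Vec.toList α) (toℕ i)                 ≡⟨ nth-toList α i ⟩
      Vec.lookup α i                             ∎
      where open ≡-Reasoning

dominatedWeights⇒SNP×Newton : ∀ {n} (G : Graph n) {μ} → DominatedWeights (GraphColouring G) μ → ∀ k →
  SNP (X G k) × Newton (X G k) ≐ Permutahedron k μ
dominatedWeights⇒SNP×Newton G dw k =
  saturated dw (X G k) (coeff⇒colouring G k) (colouring⇒coeff G k) ,
  newton≐permutahedron dw (X G k) (coeff⇒colouring G k) (colouring⇒coeff G k)

-- Unit interval graphs: box moves

swap₀₁ : ℕ → ℕ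
swap₀₁ 0             = 1
swap₀₁ 1             = 0
swap₀₁ (suc (suc c)) = suc (suc c)

swap₀₁-involutive : ∀ c → swap₀₁ (swap₀₁ c) ≡ c
swap₀₁-involutive 0             = refl
swap₀₁-involutive 1             = refl
swap₀₁-involutive (suc (suc c)) = refl

swap₀₁-injective : ∀ {c d} → swap₀₁ c ≡ swap₀₁ d → c ≡ d
swap₀₁-injective eq = trans (sym (swap₀₁-involutive _)) (trans (cong swap₀₁ eq) (swap₀₁-involutive _))

swap₀₁-≤1 : ∀ {c} → c ≤ 1 → swap₀₁ c ≤ 1
swap₀₁-≤1 z≤n       = ≤-refl
swap₀₁-≤1 (s≤s z≤n) = z≤n

swap₀₁-fixed : ∀ {c} → ¬ c ≤ 1 → swap₀₁ c ≡ c
swap₀₁-fixed {0}           ¬≤1 = contradiction z≤n ¬≤1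
swap₀₁-fixed {1}           ¬≤1 = contradiction ≤-refl ¬≤1
swap₀₁-fixed {suc (suc c)} _   = refl

Increasing : ∀ {n} → List (Fin n) → Set
Increasing = AllPairs Fin._<_

allFin-increasing : ∀ n → Increasing (allFin n)
allFin-increasing n = AllPairs.tabulate⁺-< id

increasing-split : ∀ {n} us {w : Fin n} {ws} → Increasing (us ++ w ∷ ws) →
                   All (Fin._< w) us × All (w Fin.≤_) (w ∷ ws)
increasing-split []       (w<ws ∷ _) = [] , ≤-refl ∷ All.map <⇒≤ w<ws
increasing-split (u ∷ us) (u<   ∷ p) =
  let us<w , w≤ws = increasing-split us p in All.lookup u< (∈-++⁺ʳ us (here refl)) ∷ us<w , w≤ws

-- The umbrella-free ordering condition of indifference graphs: an edge makes a clique of all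
-- vertices from one of its ends to the other.
record IsUnitInterval {n} (G : Graph n) : Set where
  constructor unitInterval
  field interval : ∀ {u x y w} → u Fin.≤ x → x Fin.< y → y Fin.≤ w → Adj G u w → Adj G x y

module _ {n} (G : Graph n) (unit : IsUnitInterval G) (f : Fin n → ℕ)
         (f-proper : ∀ {x y} → Adj G x y → f x ≢ f y) where
  open IsUnitInterval unit

  private
    class : ℕ → List (Fin n) → ℕ
    class c = count (λ x → f x ≟ c)

    class-∷ʳ : ∀ {c} us {w} → f w ≡ c → class c (us ∷ʳ w) ≡ suc (class c us)
    class-∷ʳ {c} us {w} fw≡c = trans (count-++ (λ x → f x ≟ c) us (w ∷ []))
      (trans (cong (class c us +_) (count-accept (λ x → f x ≟ c) {xs = []} fw≡c)) (+-comm _ 1))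

    class-∷ʳ-≢ : ∀ {c} us {w} → f w ≢ c → class c (us ∷ʳ w) ≡ class c us
    class-∷ʳ-≢ {c} us {w} fw≢c = trans (count-++ (λ x → f x ≟ c) us (w ∷ []))
      (trans (cong (class c us +_) (count-reject (λ x → f x ≟ c) {xs = []} fw≢c)) (+-identityʳ _))

  -- A surplus of exactly 1 means that exchanging the colours 0 and 1 on `before` takes one vertex
  -- from class 0 and gives one to class 1, which is the effect of a box move. The condition `apart`
  -- keeps this exchange proper across the cut.
  record Cut (xs : List (Fin n)) : Set where
    field
      {before after} : List (Fin n)
      {pivot}        : Fin n
      xs≡     : xs ≡ before ++ pivot ∷ after
      surplus : class 0 before ≡ suc (class 1 before)
      apart   : ∀ {x y} → x ∈ before → y ∈ pivot ∷ after → f x ≤ 1 → f y ≤ 1 → ¬ Adj G x y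

  -- Scanning xs, the number of 0s minus the number of 1s first reaches 2 at a vertex w
  -- of colour 0, and the last vertex x before w of colour 0 or 1 has colour 0 as well.
  -- As x and w are not adjacent, no edge between the two colours crosses over.
  data Scanned (us : List (Fin n)) : Set where
    low  : class 0 us ≤ class 1 us → Scanned us
    high : ∀ {x} → x ∈ us → f x ≡ 0 → class 0 us ≡ suc (class 1 us) →
           (∀ {y} → y ∈ us → f y ≤ 1 → y Fin.≤ x) → Scanned us

  -- In both scanning states class 0 leads class 1 by at most 1. A lead of at least 2 on the whole
  -- list therefore forces a cut before the end is reached.
  findCut : ∀ {xs} us ws → us ++ ws ≡ xs → Increasing xs → Scanned us → 2 + class 1 xs ≤ class 0 xs → Cut xs
  findCut us [] refl _ (low p) excess rewrite ++-identityʳ us =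
    contradiction (≤-trans excess p) (≤⇒≯ (n≤1+n _))
  findCut us [] refl _ (high _ _ p _) excess rewrite ++-identityʳ us | p =
    contradiction excess (<-irrefl refl)
  findCut us (w ∷ ws) refl inc st excess with f w ≟ 0 | f w ≟ 1 | st
  ... | yes fw≡0 | _ | low p with class 0 us ≟ class 1 us
  ...   | no ≢ = findCut (us ∷ʳ w) ws (∷ʳ-++ us w ws) inc
          (low (subst₂ _≤_ (sym (class-∷ʳ us fw≡0)) (sym (class-∷ʳ-≢ us (λ fw≡1 → 0≢1+n (trans (sym fw≡0) fw≡1))))
            (≤∧≢⇒< p ≢))) excess
  ...   | yes eq = findCut (us ∷ʳ w) ws (∷ʳ-++ us w ws) inc
          (high (∈-++⁺ʳ us (here refl)) fw≡0
            (trans (class-∷ʳ us fw≡0) (cong suc (trans eq (sym (class-∷ʳ-≢ us (λ fw≡1 → 0≢1+n (trans (sym fw≡0) fw≡1)))))))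
            latest) excess
    where
    latest : ∀ {y} → y ∈ us ∷ʳ w → f y ≤ 1 → y Fin.≤ w
    latest y∈ _ with ∈-++⁻ us y∈
    ... | inj₁ y∈us        = <⇒≤ (All.lookup (proj₁ (increasing-split us inc)) y∈us)
    ... | inj₂ (here refl) = ≤-refl
  findCut us (w ∷ ws) refl inc st excess | yes fw≡0 | _ | high {x} x∈us fx≡0 eq last = record
    { xs≡ = refl ; surplus = eq
    ; apart = λ {u} {z} u∈us z∈ fu≤1 fz≤1 uz → f-proper
        (interval (last u∈us fu≤1) (All.lookup (proj₁ (increasing-split us inc)) x∈us)
          (All.lookup (proj₂ (increasing-split us inc)) z∈) uz)
        (trans fx≡0 (sym fw≡0)) }
  findCut us (w ∷ ws) refl inc st excess | no fw≢0 | yes fw≡1 | st′ = findCut (us ∷ʳ w) ws (∷ʳ-++ us w ws) inc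
    (low (subst₂ _≤_ (sym (class-∷ʳ-≢ us fw≢0)) (sym (class-∷ʳ us fw≡1)) (bound st′))) excess
    where
    bound : Scanned us → class 0 us ≤ suc (class 1 us)
    bound (low p)         = m≤n⇒m≤1+n p
    bound (high _ _ eq _) = ≤-reflexive eq
  findCut us (w ∷ ws) refl inc st excess | no fw≢0 | no fw≢1 | low p = findCut (us ∷ʳ w) ws (∷ʳ-++ us w ws) inc
    (low (subst₂ _≤_ (sym (class-∷ʳ-≢ us fw≢0)) (sym (class-∷ʳ-≢ us fw≢1)) p)) excess
  findCut us (w ∷ ws) refl inc st excess | no fw≢0 | no fw≢1 | high {x} x∈us fx≡0 eq last =
    findCut (us ∷ʳ w) ws (∷ʳ-++ us w ws) inc
      (high (∈-++⁺ˡ x∈us) fx≡0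
        (trans (class-∷ʳ-≢ us fw≢0) (trans eq (cong suc (sym (class-∷ʳ-≢ us fw≢1))))) last′) excess
    where
    last′ : ∀ {y} → y ∈ us ∷ʳ w → f y ≤ 1 → y Fin.≤ x
    last′ y∈ fy≤1 with ∈-++⁻ us y∈
    last′ y∈ fy≤1 | inj₁ y∈us = last y∈us fy≤1
    last′ {y} y∈ fy≤1 | inj₂ (here refl) with f y | fy≤1
    ... | 0 | _ = contradiction refl fw≢0
    ... | 1 | _ = contradiction refl fw≢1
    ... | suc (suc _) | s≤s ()

  private
    recolour : ∀ {P : Set} → Dec P → ℕ → ℕ
    recolour (yes _) c = swap₀₁ c
    recolour (no _)  c = c

  recolourPrefix : ∀ {x y α} → y < x → HasMultiplicities (suc x ∷ y ∷ α) (map f (allFin n)) →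
             GraphColouring G (x ∷ suc y ∷ α)
  recolourPrefix {x} {y} {α} y<x mult = record { colour = g ; proper = g-proper ; mult = g-mult }
    where
    class≡ : ∀ c → class c (allFin n) ≡ nth (suc x ∷ y ∷ α) c
    class≡ c = trans (sym (count-map (_≟ c) f (allFin n))) (mult c)

    -- The strict inequality `y < x` says that class 0, of size `suc x`, leads class 1, of size `y`,
    -- by at least 2.
    open Cut (findCut [] (allFin n) refl (allFin-increasing n) (low z≤n)
      (subst₂ (λ a b → 2 + a ≤ b) (sym (class≡ 1)) (sym (class≡ 0)) (s≤s y<x)))

    ordered = increasing-split before (subst Increasing xs≡ (allFin-increasing n))

    g : Fin n → ℕ
    g z = recolour (z Fin.<? pivot) (f z)

    side : ∀ z → z ∈ before ⊎ z ∈ pivot ∷ after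
    side z = ∈-++⁻ before (subst (z ∈_) xs≡ (∈-allFin z))

    g-before : ∀ {z} → z ∈ before → g z ≡ swap₀₁ (f z)
    g-before {z} z∈ with z Fin.<? pivot
    ... | yes _ = refl
    ... | no z≮ = contradiction (All.lookup (proj₁ ordered) z∈) z≮

    g-after : ∀ {z} → z ∈ pivot ∷ after → g z ≡ f z
    g-after {z} z∈ with z Fin.<? pivot
    ... | yes z< = contradiction (All.lookup (proj₂ ordered) z∈) (<⇒≱ z<)
    ... | no _ = refl

    across : ∀ {u z} → u ∈ before → z ∈ pivot ∷ after → Adj G u z → swap₀₁ (f u) ≢ f z
    across {u} u∈ z∈ uz eq with f u ≤? 1
    ... | yes fu≤1 = apart u∈ z∈ fu≤1 (subst (_≤ 1) eq (swap₀₁-≤1 fu≤1)) uz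
    ... | no ¬fu≤1 = f-proper uz (trans (sym (swap₀₁-fixed ¬fu≤1)) eq)

    g-proper : ∀ {u z} → Adj G u z → g u ≢ g z
    g-proper {u} {z} uz eq with side u | side z
    ... | inj₁ u∈ | inj₁ z∈ = f-proper uz (swap₀₁-injective (trans (sym (g-before u∈)) (trans eq (g-before z∈))))
    ... | inj₁ u∈ | inj₂ z∈ = across u∈ z∈ uz (trans (sym (g-before u∈)) (trans eq (g-after z∈)))
    ... | inj₂ u∈ | inj₁ z∈ = across z∈ u∈ (symm G uz) (trans (sym (g-before z∈)) (trans (sym eq) (g-after u∈)))
    ... | inj₂ u∈ | inj₂ z∈ = f-proper uz (trans (sym (g-after u∈)) (trans eq (g-after z∈)))

    split-class : ∀ c → class c (allFin n) ≡ class c before + class c (pivot ∷ after)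
    split-class c = trans (cong (class c) xs≡) (count-++ (λ z → f z ≟ c) before (pivot ∷ after))

    g-class : ∀ c → occurrences c (map g (allFin n)) ≡ class (swap₀₁ c) before + class c (pivot ∷ after)
    g-class c = begin
      occurrences c (map g (allFin n))                        ≡⟨ count-map (_≟ c) g (allFin n) ⟩
      count g? (allFin n)                                     ≡⟨ cong (count g?) xs≡ ⟩
      count g? (before ++ pivot ∷ after)                      ≡⟨ count-++ g? before (pivot ∷ after) ⟩
      count g? before + count g? (pivot ∷ after)              ≡⟨ cong₂ _+_
        (count-cong g? (λ z → f z ≟ swap₀₁ c) before
          (λ z∈ gz≡c → trans (sym (swap₀₁-involutive _)) (cong swap₀₁ (trans (sym (g-before z∈)) gz≡c)))
          (λ z∈ fz≡ → trans (g-before z∈) (trans (cong swap₀₁ fz≡) (swap₀₁-involutive c))))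
        (count-cong g? (λ z → f z ≟ c) (pivot ∷ after)
          (λ z∈ gz≡c → trans (sym (g-after z∈)) gz≡c) (λ z∈ fz≡c → trans (g-after z∈) fz≡c)) ⟩
      class (swap₀₁ c) before + class c (pivot ∷ after)       ∎
      where
      open ≡-Reasoning
      g? = λ z → g z ≟ c

    g-mult : HasMultiplicities (x ∷ suc y ∷ α) (map g (allFin n))
    g-mult 0 = trans (g-class 0) (suc-injective
      (trans (cong (_+ class 0 (pivot ∷ after)) (sym surplus)) (trans (sym (split-class 0)) (class≡ 0))))
    g-mult 1 = trans (g-class 1) (trans (cong (_+ class 1 (pivot ∷ after)) surplus)
      (cong suc (trans (sym (split-class 1)) (class≡ 1))))
    g-mult (suc (suc c)) = trans (g-class (suc (suc c))) (trans (sym (split-class (suc (suc c)))) (class≡ (suc (suc c))))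

unitInterval-boxClosed : ∀ {n} {G : Graph n} → IsUnitInterval G → BoxClosed (GraphColouring G)
unitInterval-boxClosed unit .BoxClosed.perm = Colouring-resp-↭
unitInterval-boxClosed {G = G} unit .BoxClosed.box y<x f = recolourPrefix G unit colour proper y<x mult
  where open Colouring f

-- Unit interval graphs: the greedy colouring

Unique-resp-↭ : ∀ {A : Set} {xs ys : List A} → xs ↭ ys → Unique xs → Unique ys
Unique-resp-↭ p = SetoidPerm.Unique-resp-↭ (setoid _) (↭⇒↭ₛ p)

unique-⊆⇒length-≤ : ∀ {A : Set} {xs ys : List A} → Unique xs → (∀ {x} → x ∈ xs → x ∈ ys) → length xs ≤ length ys
unique-⊆⇒length-≤ [] _ = z≤n
unique-⊆⇒length-≤ {xs = x ∷ xs} (x∉xs ∷ u) xs⊆ys with ∈-∃++ (xs⊆ys (here refl))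
... | ls , rs , refl = ≤-trans (s≤s (unique-⊆⇒length-≤ u xs⊆))
  (≤-reflexive (↭-length (↭-sym (shift x ls rs))))
  where
  xs⊆ : ∀ {z} → z ∈ xs → z ∈ ls ++ rs
  xs⊆ z∈ with ∈-resp-↭ (shift x ls rs) (xs⊆ys (there z∈))
  ... | here refl = contradiction refl (All.lookup x∉xs z∈)
  ... | there z∈′ = z∈′

lookupAssoc : ∀ {A B : Set} → DecidableEquality A → B → List (A × B) → A → B
lookupAssoc _≟_ d []             x = d
lookupAssoc _≟_ d ((y , z) ∷ ps) x with x ≟ y
... | yes _ = z
... | no  _ = lookupAssoc _≟_ d ps x

lookupAssoc-∈ : ∀ {A B : Set} (_≟_ : DecidableEquality A) (d : B) {ps x y} → Unique (map proj₁ ps) →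
                (x , y) ∈ ps → lookupAssoc _≟_ d ps x ≡ y
lookupAssoc-∈ _≟_ d {(x′ , y′) ∷ ps} {x} (x′∉ ∷ u) p with x ≟ x′ | p
... | yes _    | here refl = refl
... | yes refl | there p′  = contradiction refl (All.lookup x′∉ (∈-map⁺ proj₁ p′))
... | no x≢x   | here refl = contradiction refl x≢x
... | no _     | there p′  = lookupAssoc-∈ _≟_ d u p′

private
  search : List ℕ → ℕ → ℕ → ℕ
  search cs zero       c = c
  search cs (suc fuel) c with c ∈? cs
  ... | yes _ = search cs fuel (suc c)
  ... | no  _ = c

  -- The local search of smallestUnused cannot be named; the omitted left-hand side
  -- is inferred to be it.
  mutual
    search-agrees : ∀ cs fuel c → _ ≡ search cs fuel c

    smallestUnused≡search : ∀ cs → smallestUnused cs ≡ search cs (length cs) 1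
    smallestUnused≡search cs with length cs | 1
    ... | fuel | c = search-agrees cs fuel c

    search-agrees cs zero       c = refl
    search-agrees cs (suc fuel) c with c ∈? cs
    ... | yes _ = search-agrees cs fuel (suc c)
    ... | no  _ = refl

  search-≥ : ∀ cs fuel c → c ≤ search cs fuel c
  search-≥ cs zero       c = ≤-refl
  search-≥ cs (suc fuel) c with c ∈? cs
  ... | yes _ = ≤-trans (n≤1+n c) (search-≥ cs fuel (suc c))
  ... | no  _ = ≤-refl

  search-≤ : ∀ cs fuel c → search cs fuel c ≤ fuel + c
  search-≤ cs zero       c = ≤-refl
  search-≤ cs (suc fuel) c with c ∈? cs
  ... | yes _ = subst (search cs fuel (suc c) ≤_) (+-suc fuel c) (search-≤ cs fuel (suc c))
  ... | no  _ = m≤n+m c (suc fuel)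

  search-minimal : ∀ cs fuel c {d} → c ≤ d → d < search cs fuel c → d ∈ cs
  search-minimal cs zero       c c≤d d<c = contradiction c≤d (<⇒≱ d<c)
  search-minimal cs (suc fuel) c {d} c≤d d<s with c ∈? cs
  ... | no _ = contradiction c≤d (<⇒≱ d<s)
  ... | yes c∈ with m≤n⇒m<n∨m≡n c≤d
  ...   | inj₁ c<d  = search-minimal cs fuel (suc c) c<d d<s
  ...   | inj₂ refl = c∈

  search-full : ∀ cs fuel c → search cs fuel c ∈ cs → search cs fuel c ≡ fuel + c
  search-full cs zero       c _ = refl
  search-full cs (suc fuel) c s∈ with c ∈? cs
  ... | no c∉ = contradiction s∈ c∉
  ... | yes _ = trans (search-full cs fuel (suc c) s∈) (+-suc fuel c)

smallestUnused>0 : ∀ cs → 0 < smallestUnused cs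
smallestUnused>0 cs = subst (0 <_) (sym (smallestUnused≡search cs)) (search-≥ cs (length cs) 1)

smallestUnused-≤ : ∀ cs → smallestUnused cs ≤ suc (length cs)
smallestUnused-≤ cs = subst₂ _≤_ (sym (smallestUnused≡search cs)) (+-comm (length cs) 1) (search-≤ cs (length cs) 1)

smallestUnused-minimal : ∀ cs {d} → 0 < d → d < smallestUnused cs → d ∈ cs
smallestUnused-minimal cs 0<d d< = search-minimal cs (length cs) 1 0<d (subst (_ <_) (smallestUnused≡search cs) d<)

-- The search returns its last candidate `suc (length cs)` without testing it. Were this candidate
-- used, then all smaller positive numbers would be used too, and `cs` would contain more distinct
-- numbers than it has entries.
smallestUnused-∉ : ∀ cs → smallestUnused cs ∉ cs
smallestUnused-∉ cs s∈ = <-irrefl refl (begin-strict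
  length cs                         <⟨ n<1+n _ ⟩
  suc (length cs)                   ≡⟨ trans (length-map suc (upTo (suc (length cs)))) (length-upTo (suc (length cs))) ⟨
  length (map suc (upTo (suc (length cs)))) ≤⟨ unique-⊆⇒length-≤ (Unique.map⁺ suc-injective (Unique.upTo⁺ (suc (length cs)))) ⊆cs ⟩
  length cs                         ∎)
  where
  open ≤-Reasoning
  s≡ : smallestUnused cs ≡ suc (length cs)
  s≡ = trans (smallestUnused≡search cs)
         (trans (search-full cs (length cs) 1 (subst (_∈ cs) (smallestUnused≡search cs) s∈)) (+-comm (length cs) 1))
  ⊆cs : ∀ {d} → d ∈ map suc (upTo (suc (length cs))) → d ∈ cs
  ⊆cs d∈ with ∈-map⁻ suc d∈
  ... | e , e∈ , refl with m≤n⇒m<n∨m≡n (∈-upTo⁻ e∈)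
  ...   | inj₁ e< = smallestUnused-minimal cs z<s (subst (suc e <_) (sym s≡) e<)
  ...   | inj₂ eq = subst (_∈ cs) (trans s≡ (sym eq)) s∈

module _ {n} (G : Graph n) where

  private
    adjacentTo? : ∀ w (e : Fin n × ℕ) → Dec (Adj G (proj₁ e) w)
    adjacentTo? w (u , _) = adj? G u w

  record GreedyChoice (st : List (Fin n × ℕ)) (w : Fin n) (c : ℕ) : Set where
    field
      later    : ∀ {u d} → (u , d) ∈ st → u Fin.< w
      positive : 0 < c
      bound    : c ≤ suc (length st)
      fresh    : ∀ {u d} → (u , d) ∈ st → Adj G u w → c ≢ d
      minimal  : ∀ {d} → 0 < d → d < c → ∃[ u ] (u , d) ∈ st × Adj G u w

  data GreedyState : List (Fin n × ℕ) → Set where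
    []  : GreedyState []
    _∷_ : ∀ {st w c} → GreedyChoice st w c → GreedyState st → GreedyState ((w , c) ∷ st)

  greedyChoice : ∀ st w → (∀ {u d} → (u , d) ∈ st → u Fin.< w) →
                 GreedyChoice st w (smallestUnused (map proj₂ (filter (adjacentTo? w) st)))
  greedyChoice st w later = record
    { later    = later
    ; positive = smallestUnused>0 used
    ; bound    = ≤-trans (smallestUnused-≤ used) (s≤s (subst (_≤ length st) (sym (length-map proj₂ nbrs)) (length-filter (adjacentTo? w) st)))
    ; fresh    = λ u∈ uw eq → smallestUnused-∉ used
                   (subst (_∈ used) (sym eq) (∈-map⁺ proj₂ (∈-filter⁺ (adjacentTo? w) u∈ uw)))
    ; minimal  = minimal
    }
    where
    nbrs = filter (adjacentTo? w) st
    used = map proj₂ nbrs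
    minimal : ∀ {d} → 0 < d → d < smallestUnused used → ∃[ u ] (u , d) ∈ st × Adj G u w
    minimal 0<d d< with ∈-map⁻ proj₂ (smallestUnused-minimal used 0<d d<)
    ... | (u , _) , u∈ , refl = u , ∈-filter⁻ (adjacentTo? w) u∈

  foldl-greedyState : ∀ st ws → GreedyState st → Increasing ws → (∀ {u d w} → (u , d) ∈ st → w ∈ ws → u Fin.< w) →
                      GreedyState (foldl (greedyStep G) st ws)
  foldl-greedyState st []       gs _           _     = gs
  foldl-greedyState st (w ∷ ws) gs (w< ∷ inc) st<ws =
    foldl-greedyState _ ws (greedyChoice st w (λ u∈ → st<ws u∈ (here refl)) ∷ gs) inc
      λ { (here refl) w′∈ → All.lookup w< w′∈ ; (there u∈) w′∈ → st<ws u∈ (there w′∈) }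

  foldl-vertices : ∀ st ws → map proj₁ (foldl (greedyStep G) st ws) ↭ ws ++ map proj₁ st
  foldl-vertices st []       = ↭-refl
  foldl-vertices st (w ∷ ws) = ↭-trans (foldl-vertices _ ws) (shift w ws (map proj₁ st))

  greedyState : GreedyState (greedy G)
  greedyState = foldl-greedyState [] (allFin n) [] (allFin-increasing n) λ ()

  greedy-vertices : map proj₁ (greedy G) ↭ allFin n
  greedy-vertices = subst (map proj₁ (greedy G) ↭_) (++-identityʳ (allFin n)) (foldl-vertices [] (allFin n))

  -- The default 0 is never returned, because every vertex occurs in `greedy G`.
  greedyColour : Fin n → ℕ
  greedyColour = lookupAssoc Fin._≟_ 0 (greedy G)

  length-greedy : length (greedy G) ≡ n
  length-greedy = trans (sym (length-map proj₁ (greedy G))) (trans (↭-length greedy-vertices) (length-tabulate id))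

  greedyColour-∈ : ∀ {w c} → (w , c) ∈ greedy G → greedyColour w ≡ c
  greedyColour-∈ = lookupAssoc-∈ Fin._≟_ 0 (Unique-resp-↭ (↭-sym greedy-vertices) (Unique.allFin⁺ n))

  ∈-greedy : ∀ w → (w , greedyColour w) ∈ greedy G
  ∈-greedy w with ∈-map⁻ proj₁ (∈-resp-↭ (↭-sym greedy-vertices) (∈-allFin w))
  ... | (_ , c) , w∈ , refl = subst (λ c → (w , c) ∈ greedy G) (sym (greedyColour-∈ w∈)) w∈

  greedyState-positive : ∀ {st w c} → GreedyState st → (w , c) ∈ st → 0 < c
  greedyState-positive (choice ∷ _) (here refl) = GreedyChoice.positive choice
  greedyState-positive (_ ∷ gs)     (there w∈)  = greedyState-positive gs w∈

  greedyState-bounded : ∀ {st w c} → GreedyState st → (w , c) ∈ st → c ≤ length st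
  greedyState-bounded (choice ∷ _) (here refl) = GreedyChoice.bound choice
  greedyState-bounded (_ ∷ gs)     (there w∈)  = m≤n⇒m≤1+n (greedyState-bounded gs w∈)

  greedyState-proper : ∀ {st u w c} → GreedyState st → (u , c) ∈ st → (w , c) ∈ st → ¬ Adj G u w
  greedyState-proper (_ ∷ _)      (here refl) (here refl) uw = irrefl G refl uw
  greedyState-proper (choice ∷ _) (here refl) (there w∈)  uw = GreedyChoice.fresh choice w∈ (symm G uw) refl
  greedyState-proper (choice ∷ _) (there u∈)  (here refl) uw = GreedyChoice.fresh choice u∈ uw refl
  greedyState-proper (_ ∷ gs)     (there u∈)  (there w∈)  uw = greedyState-proper gs u∈ w∈ uw

  suc-pred-greedyColour : ∀ w → suc (pred (greedyColour w)) ≡ greedyColour w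
  suc-pred-greedyColour w with greedyColour w | greedyState-positive greedyState (∈-greedy w)
  ... | suc c | _ = refl

  greedyColouring : GraphColouring G (greedyWeight G)
  greedyColouring = record
    -- Greedy colours start at 1, whereas positions in a weight start at 0. Positivity of the greedy
    -- colours makes the shift injective.
    { colour = pred ∘ greedyColour
    ; proper = λ {x} {y} xy eq → greedyState-proper greedyState (∈-greedy x)
        (subst (λ c → (y , c) ∈ greedy G)
          (trans (sym (suc-pred-greedyColour y)) (trans (cong suc (sym eq)) (suc-pred-greedyColour x))) (∈-greedy y)) xy
    ; mult   = mult
    }
    where
    class : ℕ → ℕ
    class c = length (filter (λ (_ , d) → d ≟ suc c) (greedy G))
    nth-map-upTo : ∀ (h : ℕ → ℕ) m {c} → c < m → nth (map h (upTo m)) c ≡ h c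
    nth-map-upTo h m {c} c<m = trans (cong (λ xs → nth xs c) (map-upTo h m)) (go h m c<m)
      where
      go : ∀ h m {c} → c < m → nth (applyUpTo h m) c ≡ h c
      go h (suc m) {zero}  _         = refl
      go h (suc m) {suc c} (s≤s c<m) = go (h ∘ suc) m c<m
    occurrences≡class : ∀ c → occurrences c (map (pred ∘ greedyColour) (allFin n)) ≡ class c
    occurrences≡class c = begin
      occurrences c (map (pred ∘ greedyColour) (allFin n))
        ≡⟨ count-↭ (_≟ c) (Perm.map⁺ (pred ∘ greedyColour) (↭-sym greedy-vertices)) ⟩
      occurrences c (map (pred ∘ greedyColour) (map proj₁ (greedy G)))
        ≡⟨ cong (occurrences c) (map-∘ (greedy G)) ⟨
      occurrences c (map (pred ∘ greedyColour ∘ proj₁) (greedy G))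
        ≡⟨ count-map (_≟ c) (pred ∘ greedyColour ∘ proj₁) (greedy G) ⟩
      count (λ (w , _) → pred (greedyColour w) ≟ c) (greedy G)
        ≡⟨ count-cong _ (λ (_ , d) → d ≟ suc c) (greedy G)
             (λ {(w , d)} w∈ eq → trans (sym (greedyColour-∈ w∈)) (trans (sym (suc-pred-greedyColour w)) (cong suc eq)))
             (λ {(w , d)} w∈ eq → cong pred (trans (greedyColour-∈ w∈) eq)) ⟩
      class c ∎
      where open ≡-Reasoning
    mult : HasMultiplicities (greedyWeight G) (map (pred ∘ greedyColour) (allFin n))
    mult c with c <? n
    ... | yes c<n = trans (occurrences≡class c) (sym (nth-map-upTo class n c<n))
    ... | no c≮n  = trans (occurrences≡class c) (trans
      (count-none (λ (_ , d) → d ≟ suc c) {xs = greedy G} (All.tabulate λ { w∈ refl →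
        c≮n (subst (suc c ≤_) length-greedy (greedyState-bounded greedyState w∈)) }))
      (sym (nth-overflow (greedyWeight G) (≤-trans (≤-reflexive (trans (length-map class (upTo n)) (length-upTo n))) (≮⇒≥ c≮n)))))

  module _ (unit : IsUnitInterval G) (f : Fin n → ℕ) (f-proper : ∀ {x y} → Adj G x y → f x ≢ f y) (m : ℕ) where
    open IsUnitInterval unit

    private
      chosen? : (e : Fin n × ℕ) → Dec (f (proj₁ e) < m)
      chosen? (u , _) = f u <? m

      greedyChosen? : (e : Fin n × ℕ) → Dec (proj₂ e ≤ m)
      greedyChosen? (_ , c) = c ≤? m

      chosen greedyChosen : List (Fin n × ℕ) → ℕ
      chosen       = count chosen?
      greedyChosen = count greedyChosen?

    -- The state lists the vertex coloured last at its head, so vertices decrease along it. Once an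
    -- entry is not adjacent to `w`, the interval property excludes all smaller vertices, and the
    -- earlier neighbours of `w` form an initial segment.
    neighbours : ∀ {st w} → GreedyState st → (∀ {u d} → (u , d) ∈ st → u Fin.< w) → ∃[ near ] ∃[ far ]
                 st ≡ near ++ far × (∀ {u d} → (u , d) ∈ near → Adj G u w) × (∀ {u d} → (u , d) ∈ far → ¬ Adj G u w)
    neighbours [] _ = [] , [] , refl , (λ ()) , (λ ())
    neighbours {(u , _) ∷ st} {w} (choice ∷ gs) st<w with adj? G u w
    ... | no ¬uw = [] , _ , refl , (λ ()) , λ
      { (here refl) uw → ¬uw uw
      ; (there u′∈) u′w → ¬uw (interval (<⇒≤ (GreedyChoice.later choice u′∈)) (st<w (here refl)) ≤-refl u′w) }
    ... | yes uw with neighbours gs (st<w ∘ there)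
    ...   | near , far , refl , adj , ¬adj = _ ∷ near , far , refl , (λ { (here refl) → uw ; (there u∈) → adj u∈ }) , ¬adj

    clique : ∀ near {far w} → GreedyState (near ++ far) → (∀ {u d} → (u , d) ∈ near → u Fin.< w) →
             (∀ {u d} → (u , d) ∈ near → Adj G u w) → AllPairs (λ (x , _) (y , _) → Adj G y x) near
    clique []       _             _   _   = []
    clique (_ ∷ near) (choice ∷ gs) <w adj =
      All.tabulate (λ y∈ → interval ≤-refl (GreedyChoice.later choice (∈-++⁺ˡ y∈)) (<⇒≤ (<w (here refl))) (adj (there y∈))) ∷
      clique near gs (<w ∘ there) (adj ∘ there)

    greedyState-suffix : ∀ near {far} → GreedyState (near ++ far) → GreedyState far
    greedyState-suffix []         gs       = gs
    greedyState-suffix (_ ∷ near) (_ ∷ gs) = greedyState-suffix near gs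

    clique-chosen : ∀ st → AllPairs (λ (x , _) (y , _) → Adj G y x) st → chosen st ≤ m
    clique-chosen st pairs = subst₂ _≤_ (length-map (f ∘ proj₁) (filter chosen? st)) (length-upTo m)
      (unique-⊆⇒length-≤
        (AllPairs.map⁺ (AllPairs.filter⁺ chosen? (AllPairs.map (λ yx eq → f-proper yx (sym eq)) pairs)))
        λ c∈ → case ∈-map⁻ (f ∘ proj₁) c∈ of λ { (_ , u∈ , refl) → ∈-upTo⁺ (proj₂ (∈-filter⁻ chosen? {xs = st} u∈)) })

    -- If w gets a colour > m, then the m smallest colours all occur in the clique formed by
    -- its earlier neighbours, whereas f uses at most m of its own first m colours on it and w.
    chosen-≤ : ∀ k {st} → length st ≤ k → GreedyState st → chosen st ≤ greedyChosen st
    chosen-≤ _ _ [] = z≤n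
    chosen-≤ (suc k) {(w , c) ∷ st} (s≤s ℓ≤k) (choice ∷ gs) with c ≤? m
    ... | yes c≤m = begin
      chosen ((w , c) ∷ st)          ≤⟨ chosen-∷ ⟩
      suc (chosen st)                ≤⟨ s≤s (chosen-≤ k ℓ≤k gs) ⟩
      suc (greedyChosen st)          ≡⟨ count-accept greedyChosen? {xs = st} c≤m ⟨
      greedyChosen ((w , c) ∷ st)    ∎
      where
      open ≤-Reasoning
      chosen-∷ : chosen ((w , c) ∷ st) ≤ suc (chosen st)
      chosen-∷ = subst (_≤ suc (chosen st)) (sym (count-++ chosen? ((w , c) ∷ []) st))
        (+-monoˡ-≤ (chosen st) (count-≤ chosen? ((w , c) ∷ [])))
    ... | no c≰m with neighbours gs (GreedyChoice.later choice)
    ...   | near , far , refl , adj , ¬adj = begin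
      chosen ((w , c) ∷ near ++ far)              ≡⟨ count-++ chosen? ((w , c) ∷ near) far ⟩
      -- The induction drops all of `near` at once and continues with `far`. This is not a
      -- structural recursion on the state, which is why the bound `k` on the length is carried
      -- along.
      chosen ((w , c) ∷ near) + chosen far        ≤⟨ +-mono-≤ near-chosen (chosen-≤ k
        (≤-trans (subst (length far ≤_) (sym (length-++ near)) (m≤n+m _ _)) ℓ≤k) (greedyState-suffix near gs)) ⟩
      m + greedyChosen far                        ≤⟨ +-monoˡ-≤ (greedyChosen far) near-greedyChosen ⟩
      greedyChosen near + greedyChosen far        ≡⟨ count-++ greedyChosen? near far ⟨
      greedyChosen (near ++ far)                  ≡⟨ count-reject greedyChosen? {xs = near ++ far} c≰m ⟨
      greedyChosen ((w , c) ∷ near ++ far)        ∎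
      where
      open ≤-Reasoning
      near-chosen : chosen ((w , c) ∷ near) ≤ m
      near-chosen = clique-chosen ((w , c) ∷ near)
        (All.tabulate adj ∷ clique near gs (GreedyChoice.later choice ∘ ∈-++⁺ˡ) adj)
      ⊆near : ∀ {d} → d ∈ map suc (upTo m) → d ∈ map proj₂ (filter greedyChosen? near)
      ⊆near d∈ with ∈-map⁻ suc d∈
      ... | e , e∈ , refl with GreedyChoice.minimal choice z<s (<-≤-trans (s≤s (∈-upTo⁻ e∈)) (≰⇒> c≰m))
      ...   | u , u∈ , uw with ∈-++⁻ near u∈
      ...     | inj₁ u∈near = ∈-map⁺ proj₂ (∈-filter⁺ greedyChosen? u∈near (∈-upTo⁻ e∈))
      ...     | inj₂ u∈far  = contradiction uw (¬adj u∈far)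
      near-greedyChosen : m ≤ greedyChosen near
      near-greedyChosen = subst₂ _≤_ (trans (length-map suc (upTo m)) (length-upTo m)) (length-map proj₂ (filter greedyChosen? near))
        (unique-⊆⇒length-≤ (Unique.map⁺ suc-injective (Unique.upTo⁺ m)) ⊆near)

    count-≤-greedy : count (λ x → f x <? m) (allFin n) ≤ count (λ x → pred (greedyColour x) <? m) (allFin n)
    count-≤-greedy = begin
      count (λ x → f x <? m) (allFin n)                     ≡⟨ count-↭ (λ x → f x <? m) (↭-sym greedy-vertices) ⟩
      count (λ x → f x <? m) (map proj₁ (greedy G))         ≡⟨ count-map (λ x → f x <? m) proj₁ (greedy G) ⟩
      chosen (greedy G)                                     ≤⟨ chosen-≤ _ ≤-refl greedyState ⟩
      greedyChosen (greedy G)                               ≡⟨ count-cong greedyChosen? (λ (w , _) → pred (greedyColour w) <? m) (greedy G)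
        (λ {(w , _)} w∈ c≤m → subst (_≤ m) (trans (sym (greedyColour-∈ w∈)) (sym (suc-pred-greedyColour w))) c≤m)
        (λ {(w , _)} w∈ <m → subst (_≤ m) (trans (suc-pred-greedyColour w) (greedyColour-∈ w∈)) <m) ⟩
      count (λ (w , _) → pred (greedyColour w) <? m) (greedy G)    ≡⟨ count-map (λ x → pred (greedyColour x) <? m) proj₁ (greedy G) ⟨
      count (λ x → pred (greedyColour x) <? m) (map proj₁ (greedy G)) ≡⟨ count-↭ (λ x → pred (greedyColour x) <? m) greedy-vertices ⟩
      count (λ x → pred (greedyColour x) <? m) (allFin n)   ∎
      where open ≤-Reasoning

↭-positiveParts : ∀ μ → ∃[ m ] μ ↭ positiveParts μ ++ replicate m 0
↭-positiveParts [] = 0 , ↭-refl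
↭-positiveParts (zero ∷ μ) = let m , p = ↭-positiveParts μ in
  suc m , ↭-trans (Perm.prep 0 p) (↭-sym (shift 0 (positiveParts μ) (replicate m 0)))
↭-positiveParts (suc x ∷ μ) = let m , p = ↭-positiveParts μ in m , Perm.prep (suc x) p

colouring-positiveParts : ∀ {A : Set} {R : Rel A 0ℓ} {vs μ} → Colouring R vs μ → Colouring R vs (positiveParts μ)
colouring-positiveParts {μ = μ} f = let m , p = ↭-positiveParts μ in
  Colouring-resp-nth (nth-++-zeros (positiveParts μ) m) (Colouring-resp-↭ p f)

unitInterval-dominated : ∀ {n} {G : Graph n} → IsUnitInterval G → DominatedWeights (GraphColouring G) (greedyWeight G)
unitInterval-dominated {G = G} unit = record
  { boxClosed = unitInterval-boxClosed unit
  ; padding   = λ m {α} → Colouring-resp-nth (λ c → sym (nth-++-zeros α m c))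
  ; dominated = λ f m → subst₂ _≤_ (sym (sum-take≡ f m)) (sym (sum-take≡ (greedyColouring G) m))
                  (count-≤-greedy G unit (colour f) (proper f) m)
  ; total     = λ f → trans (sum≡ f) (sym (sum≡ (greedyColouring G)))
  ; attained  = colouring-positiveParts (greedyColouring G)
  }
  where open Colouring

northsBefore-mono : ∀ w {i j} → i ≤ j → northsBefore w i ≤ northsBefore w j
northsBefore-mono []          _         = z≤n
northsBefore-mono (north ∷ w) i≤j       = s≤s (northsBefore-mono w i≤j)
northsBefore-mono (east ∷ w)  z≤n       = z≤n
northsBefore-mono (east ∷ w)  (s≤s i≤j) = northsBefore-mono w i≤j

-- The Hessenberg function is weakly increasing, so an edge from `u` up to `w` gives
-- `y ≤ w < h(u) ≤ h(x)`.
indifferenceGraph-unitInterval : ∀ {n} (d : DyckPath n) → IsUnitInterval (indifferenceGraph d)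
indifferenceGraph-unitInterval d = unitInterval λ
  { u≤x x<y y≤w (inj₁ (_ , w<hu)) → inj₁ (x<y , <-≤-trans (≤-<-trans y≤w w<hu) (northsBefore-mono (steps d) u≤x))
  ; u≤x x<y y≤w (inj₂ (w<u , _)) → contradiction (≤-trans u≤x (≤-trans (<⇒≤ x<y) y≤w)) (<⇒≱ w<u) }

-- Co-bipartite graphs

module _ {P : Pred ℕ 0ℓ} (P? : Decidable P) where

  largest-≤ : ∀ m → largest P? m ≤ m
  largest-≤ zero = z≤n
  largest-≤ (suc m) with P? (suc m)
  ... | yes _ = ≤-refl
  ... | no  _ = m≤n⇒m≤1+n (largest-≤ m)

  largest-upper : ∀ m {j} → j ≤ m → P j → j ≤ largest P? m
  largest-upper zero    j≤m Pj = j≤m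
  largest-upper (suc m) j≤m Pj with P? (suc m) | m≤n⇒m<n∨m≡n j≤m
  ... | yes _ | _              = j≤m
  ... | no ¬P | inj₂ refl      = contradiction Pj ¬P
  ... | no _  | inj₁ (s≤s j≤m′) = largest-upper m j≤m′ Pj

  largest-satisfies : ∀ m → P 0 → P (largest P? m)
  largest-satisfies zero    P0 = P0
  largest-satisfies (suc m) P0 with P? (suc m)
  ... | yes Pm = Pm
  ... | no  _  = largest-satisfies m P0

module _ {n} (G : Graph n) where

  monomialCoeff⇒colouring : ∀ μ → monomialCoeff G μ ≢ ℤ.0ℤ → GraphColouring G μ
  monomialCoeff⇒colouring μ c≢0 =
    subst (GraphColouring G) (Vec.toList∘fromList μ) (coeff⇒colouring G (length μ) (Vec.fromList μ) c≢0)

  colouring⇒monomialCoeff : ∀ μ → GraphColouring G μ → monomialCoeff G μ ≢ ℤ.0ℤ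
  colouring⇒monomialCoeff μ f =
    colouring⇒coeff G (length μ) (Vec.fromList μ) (subst (GraphColouring G) (sym (Vec.toList∘fromList μ)) f)

occurrences-map-suc : ∀ c xs → occurrences (suc c) (map suc xs) ≡ occurrences c xs
occurrences-map-suc c xs = trans (count-map (_≟ suc c) suc xs)
  (count-cong (λ x → suc x ≟ suc c) (_≟ c) xs (λ _ → suc-injective) (λ _ → cong suc))

ones-multiplicities : ∀ n → HasMultiplicities (replicate n 1) (map toℕ (allFin n))
ones-multiplicities zero    c = refl
ones-multiplicities (suc n) c = trans (cong (occurrences c) (cong (0 ∷_) shifted)) (multiplicity c)
  where
  shifted : map toℕ (tabulate (Fin.suc {n})) ≡ map suc (map toℕ (allFin n))
  shifted = trans (map-tabulate Fin.suc toℕ) (trans (sym (map-tabulate id (suc ∘ toℕ))) (map-∘ (allFin n)))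
  multiplicity : ∀ c → occurrences c (0 ∷ map suc (map toℕ (allFin n))) ≡ nth (replicate (suc n) 1) c
  multiplicity zero    = trans (count-accept (_≟ 0) {xs = map suc (map toℕ (allFin n))} refl)
    (cong suc (count-none (_≟ 0) (All.map⁺ (All.universal (λ _ ()) (map toℕ (allFin n))))))
  multiplicity (suc c) = trans (count-reject (_≟ suc c) {x = 0} {xs = map suc (map toℕ (allFin n))} (λ ()))
    (trans (occurrences-map-suc c (map toℕ (allFin n))) (ones-multiplicities n c))

-- Giving all vertices different colours is always proper, so the coefficient for `j = 0` does not
-- vanish. Hence the fallback value 0 of `largest` is also an index with nonzero coefficient.
onesColouring : ∀ {n} (G : Graph n) → GraphColouring G (replicate n 1)
onesColouring {n} G = record
  { colour = toℕ
  ; proper = λ xy eq → irrefl G (Fin.toℕ-injective eq) xy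
  ; mult   = ones-multiplicities n }

nth-≤⇒All-≤ : ∀ {m} α → (∀ c → nth α c ≤ m) → All (_≤ m) α
nth-≤⇒All-≤ []      _ = []
nth-≤⇒All-≤ (x ∷ α) p = p 0 ∷ nth-≤⇒All-≤ α (p ∘ suc)

-- The number of entries 2 of a list with entries ≤ 2.
twos : List ℕ → ℕ
twos = sum ∘ map pred

sum-≤2 : ∀ {α} → All (_≤ 2) α → sum α ≤ length α + twos α
sum-≤2 [] = z≤n
sum-≤2 {x ∷ α} (x≤2 ∷ α≤2) = begin
  x + sum α                              ≤⟨ +-mono-≤ (x≤1+pred x) (sum-≤2 α≤2) ⟩
  suc (pred x) + (length α + twos α)     ≡⟨ cong suc (+-assoc (pred x) (length α) (twos α)) ⟨
  suc (pred x + length α + twos α)       ≡⟨ cong (λ y → suc (y + twos α)) (+-comm (pred x) (length α)) ⟩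
  suc (length α + pred x + twos α)       ≡⟨ cong suc (+-assoc (length α) (pred x) (twos α)) ⟩
  suc (length α + (pred x + twos α))     ∎
  where
  open ≤-Reasoning
  x≤1+pred : ∀ x → x ≤ suc (pred x)
  x≤1+pred zero    = z≤n
  x≤1+pred (suc x) = ≤-refl

sum-≤-2* : ∀ {α} → All (_≤ 2) α → sum α ≤ 2 * length α
sum-≤-2* [] = z≤n
sum-≤-2* {x ∷ α} (x≤2 ∷ α≤2) = subst (x + sum α ≤_) (sym (*-suc 2 (length α))) (+-mono-≤ x≤2 (sum-≤-2* α≤2))

twosOnes-↭ : ∀ {α} → All (_≤ 2) α → ∃₂ λ o z → α ↭ replicate (twos α) 2 ++ replicate o 1 ++ replicate z 0
twosOnes-↭ [] = 0 , 0 , ↭-refl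
twosOnes-↭ {0 ∷ α} (_ ∷ α≤2) = let o , z , p = twosOnes-↭ α≤2 in o , suc z ,
  ↭-trans (Perm.prep 0 p) (↭-trans (↭-sym (shift 0 (replicate (twos α) 2) _))
    (Perm.++⁺ˡ (replicate (twos α) 2) (↭-sym (shift 0 (replicate o 1) (replicate z 0)))))
twosOnes-↭ {1 ∷ α} (_ ∷ α≤2) = let o , z , p = twosOnes-↭ α≤2 in suc o , z ,
  ↭-trans (Perm.prep 1 p) (↭-sym (shift 1 (replicate (twos α) 2) _))
twosOnes-↭ {2 ∷ α} (_ ∷ α≤2) = let o , z , p = twosOnes-↭ α≤2 in o , z , Perm.prep 2 p
twosOnes-↭ {suc (suc (suc _)) ∷ α} (s≤s (s≤s ()) ∷ _)

sum-replicate-2 : ∀ m → sum (replicate m 2) ≡ 2 * m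
sum-replicate-2 zero    = refl
sum-replicate-2 (suc m) = trans (cong (2 +_) (sum-replicate-2 m)) (sym (*-suc 2 m))

sum-replicate-1 : ∀ m → sum (replicate m 1) ≡ m
sum-replicate-1 zero    = refl
sum-replicate-1 (suc m) = cong suc (sum-replicate-1 m)

sum-twosOnes : ∀ j r → sum (replicate j 2 ++ replicate r 1) ≡ 2 * j + r
sum-twosOnes j r = trans (sum-++ (replicate j 2) (replicate r 1)) (cong₂ _+_ (sum-replicate-2 j) (sum-replicate-1 r))

-- The prefix sum on the right is the minimum of `2 * m`, `m + j` and `2 * j + r`. For the prefix of
-- a weight, the three bounds express that entries are at most 2, that at most `j` of them equal 2,
-- and that the total is fixed.
sum-take-twosOnes : ∀ m j r {x} → x ≤ 2 * m → x ≤ m + j → x ≤ 2 * j + r →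
                    x ≤ sum (take m (replicate j 2 ++ replicate r 1))
sum-take-twosOnes zero    j       r       p _ _ = p
sum-take-twosOnes (suc m) zero    zero    _ _ p = p
sum-take-twosOnes (suc m) zero    (suc r) _ p q =
  ≤-trans (m≤n+m∸n _ 1) (s≤s (sum-take-twosOnes m zero r
    (≤-trans (∸-monoˡ-≤ 1 p) (+-monoʳ-≤ m z≤n)) (∸-monoˡ-≤ 1 p) (∸-monoˡ-≤ 1 q)))
sum-take-twosOnes (suc m) (suc j) r {x} p q s =
  ≤-trans (m≤n+m∸n x 2) (+-monoʳ-≤ 2 (sum-take-twosOnes m j r
    (∸-monoˡ-≤ 2 (subst (x ≤_) (*-suc 2 m) p))
    (∸-monoˡ-≤ 2 (subst (x ≤_) (cong suc (+-suc m j)) q))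
    (∸-monoˡ-≤ 2 (subst (λ y → x ≤ y + r) (*-suc 2 j) s))))

twos-take-≤ : ∀ m α → twos (take m α) ≤ twos α
twos-take-≤ zero    α       = z≤n
twos-take-≤ (suc m) []      = z≤n
twos-take-≤ (suc m) (x ∷ α) = +-monoʳ-≤ (pred x) (twos-take-≤ m α)

module _ {n} (G : Graph n) (cobipartite : CoBipartite G) where

  private
    side = proj₁ cobipartite
    j⁺ = largest (λ j → ¬? (monomialCoeff G (twosOnes n j) ℤ.≟ ℤ.0ℤ)) ⌊ n /2⌋

    bool-pigeonhole : ∀ {a b c : Bool} → a ≢ b → a ≢ c → b ≢ c → ⊥
    bool-pigeonhole {false} {false} a≢b _ _ = a≢b refl
    bool-pigeonhole {true}  {true}  a≢b _ _ = a≢b refl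
    bool-pigeonhole {false} {true} {false} _ a≢c _ = a≢c refl
    bool-pigeonhole {false} {true} {true}  _ _ b≢c = b≢c refl
    bool-pigeonhole {true} {false} {true}  _ a≢c _ = a≢c refl
    bool-pigeonhole {true} {false} {false} _ _ b≢c = b≢c refl

    2*⌊n/2⌋≤n : 2 * ⌊ n /2⌋ ≤ n
    2*⌊n/2⌋≤n = subst₂ _≤_ (cong (⌊ n /2⌋ +_) (sym (+-identityʳ ⌊ n /2⌋))) (⌊n/2⌋+⌈n/2⌉≡n n)
      (+-monoʳ-≤ ⌊ n /2⌋ (⌊n/2⌋≤⌈n/2⌉ n))

    2*j⁺≤n : 2 * j⁺ ≤ n
    2*j⁺≤n = ≤-trans (*-monoʳ-≤ 2 (largest-≤ _ ⌊ n /2⌋)) 2*⌊n/2⌋≤n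

  module _ {α} (f : GraphColouring G α) where
    open Colouring f

    nonadjacent⇒sides≢ : ∀ {x y} → x ≢ y → colour x ≡ colour y → side x ≢ side y
    nonadjacent⇒sides≢ x≢y eq = proj₂ cobipartite _ _ (x≢y , λ xy → proper xy eq)

    -- A colour class is a clique in the complement, and a bipartite graph has no triangle: three
    -- vertices cannot lie on pairwise different sides.
    class-≤2 : ∀ c → nth α c ≤ 2
    class-≤2 c = subst (_≤ 2) (occurrences≡nth c)
      (at-most-two _ (Unique.filter⁺ (λ x → colour x ≟ c) (Unique.allFin⁺ n)) (All.all-filter (λ x → colour x ≟ c) (allFin n)))
      where
      at-most-two : ∀ xs → Unique xs → All (λ x → colour x ≡ c) xs → length xs ≤ 2
      at-most-two []           _ _ = z≤n
      at-most-two (_ ∷ [])     _ _ = s≤s z≤n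
      at-most-two (_ ∷ _ ∷ []) _ _ = ≤-refl
      at-most-two (x ∷ y ∷ z ∷ _) ((x≢y ∷ x≢z ∷ _) ∷ (y≢z ∷ _) ∷ _) (cx ∷ cy ∷ cz ∷ _) = ⊥-elim (bool-pigeonhole
        (nonadjacent⇒sides≢ x≢y (trans cx (sym cy))) (nonadjacent⇒sides≢ x≢z (trans cx (sym cz)))
        (nonadjacent⇒sides≢ y≢z (trans cy (sym cz))))

    entries-≤2 : All (_≤ 2) α
    entries-≤2 = nth-≤⇒All-≤ α class-≤2

    sum≡n : sum α ≡ n
    sum≡n = trans sum≡ (length-tabulate id)

    -- Rearranged and without its zeros, a weight is itself of the form 2ᵗ1ⁿ⁻²ᵗ, the number of ones
    -- being determined by the total. The corresponding coefficient is then nonzero, and `j⁺` is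
    -- maximal with this property.
    twos-≤j⁺ : twos α ≤ j⁺
    twos-≤j⁺ with twosOnes-↭ entries-≤2
    ... | o , z , p = largest-upper _ ⌊ n /2⌋ t≤⌊n/2⌋
          (colouring⇒monomialCoeff G (twosOnes n t) (subst (λ o → GraphColouring G (replicate t 2 ++ replicate o 1)) o≡
            (Colouring-resp-nth (nth-++-zeros (replicate t 2 ++ replicate o 1) z) (Colouring-resp-↭ p′ f))))
      where
      t = twos α
      p′ : α ↭ (replicate t 2 ++ replicate o 1) ++ replicate z 0
      p′ = subst (α ↭_) (sym (++-assoc (replicate t 2) (replicate o 1) (replicate z 0))) p
      n≡ : n ≡ 2 * t + o
      n≡ = trans (sym sum≡n) (trans (sum-↭ p′)
        (trans (sum-++ (replicate t 2 ++ replicate o 1) (replicate z 0))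
          (trans (cong₂ _+_ (sum-twosOnes t o) (sum-zeros z)) (+-identityʳ _))))
      o≡ : o ≡ n ∸ 2 * t
      o≡ = trans (sym (m+n∸m≡n (2 * t) o)) (cong (_∸ 2 * t) (sym n≡))
      t≤⌊n/2⌋ : t ≤ ⌊ n /2⌋
      t≤⌊n/2⌋ = subst (_≤ ⌊ n /2⌋) (sym (n≡⌊n+n/2⌋ t))
        (⌊n/2⌋-mono (subst (t + t ≤_) (sym n≡) (≤-trans (≤-reflexive (cong (t +_) (sym (+-identityʳ t)))) (m≤m+n (2 * t) o))))

    dominated-twosOnes : ∀ m → sum (take m α) ≤ sum (take m (twosOnes n j⁺))
    dominated-twosOnes m = sum-take-twosOnes m j⁺ (n ∸ 2 * j⁺)
      (≤-trans (sum-≤-2* take≤2) (*-monoʳ-≤ 2 length-take-≤))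
      (≤-trans (sum-≤2 take≤2) (+-mono-≤ length-take-≤ (≤-trans (twos-take-≤ m α) twos-≤j⁺)))
      (≤-trans (sum-take-≤ m α) (≤-reflexive (trans sum≡n (sym (m+[n∸m]≡n 2*j⁺≤n)))))
      where
      take≤2 = All.take⁺ m entries-≤2
      length-take-≤ : length (take m α) ≤ m
      length-take-≤ = subst (_≤ m) (sym (length-take m α)) (m⊓n≤m m (length α))

  -- Since classes have at most two elements, a box move splits a class of size 2.
  splitClass : ∀ {α} → GraphColouring G (2 ∷ 0 ∷ α) → GraphColouring G (1 ∷ 1 ∷ α)
  splitClass {α} f with 0<count⇒∈ (λ x → colour x ≟ 0) (allFin n) (subst (0 <_) (sym (occurrences≡nth 0)) z<s)
    where open Colouring f
  ... | u , u∈ , cu≡0 with ∈-∃++ u∈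
  ...   | ls , rs , allFin≡ = record { colour = g ; proper = g-proper ; mult = g-mult }
    where
    open Colouring f
    others = ls ++ rs
    allFin↭ : allFin n ↭ u ∷ others
    allFin↭ = subst (_↭ u ∷ others) (sym allFin≡) (shift u ls rs)
    u∉others : u ∉ others
    u∉others u∈′ with Unique-resp-↭ allFin↭ (Unique.allFin⁺ n)
    ... | u∉ ∷ _ = All.lookup u∉ u∈′ refl
    colour≢1 : ∀ x → colour x ≢ 1
    colour≢1 x eq = >⇒≢ (∈⇒0<count (λ x → colour x ≟ 1) (∈-allFin x) eq) (occurrences≡nth 1)
    g : Fin n → ℕ
    g x with x Fin.≟ u
    ... | yes _ = 1
    ... | no  _ = colour x
    g-u : g u ≡ 1
    g-u with u Fin.≟ u
    ... | yes _  = refl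
    ... | no u≢u = contradiction refl u≢u
    g-other : ∀ {x} → x ≢ u → g x ≡ colour x
    g-other {x} x≢u with x Fin.≟ u
    ... | yes x≡u = contradiction x≡u x≢u
    ... | no _    = refl
    g-proper : ∀ {x y} → Adj G x y → g x ≢ g y
    g-proper {x} {y} xy with x Fin.≟ u | y Fin.≟ u
    ... | yes refl | yes refl = λ _ → irrefl G refl xy
    ... | yes refl | no _     = colour≢1 y ∘ sym
    ... | no _     | yes refl = colour≢1 x
    ... | no _     | no _     = proper xy
    count-others : ∀ c → count (λ x → g x ≟ c) others ≡ count (λ x → colour x ≟ c) others
    count-others c = count-cong (λ x → g x ≟ c) (λ x → colour x ≟ c) others
      (λ x∈ eq → trans (sym (g-other (λ { refl → u∉others x∈ }))) eq)
      (λ x∈ eq → trans (g-other (λ { refl → u∉others x∈ })) eq)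
    count-g : ∀ c → occurrences c (map g (allFin n)) ≡ count (λ x → g x ≟ c) (u ∷ others)
    count-g c = trans (count-map (_≟ c) g (allFin n)) (count-↭ (λ x → g x ≟ c) allFin↭)
    count-colour : ∀ c → count (λ x → colour x ≟ c) (u ∷ others) ≡ nth (2 ∷ 0 ∷ α) c
    count-colour c = trans (count-↭ (λ x → colour x ≟ c) (↭-sym allFin↭)) (occurrences≡nth c)
    g-mult : HasMultiplicities (1 ∷ 1 ∷ α) (map g (allFin n))
    g-mult 0 = trans (count-g 0) (trans (count-reject (λ x → g x ≟ 0) {x = u} {xs = others} (λ eq → 1+n≢0 (trans (sym g-u) eq)))
      (trans (count-others 0) (suc-injective (trans (sym (count-accept (λ x → colour x ≟ 0) {x = u} {xs = others} cu≡0)) (count-colour 0)))))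
    g-mult 1 = trans (count-g 1) (trans (count-accept (λ x → g x ≟ 1) {x = u} {xs = others} g-u)
      (cong suc (trans (count-others 1)
        (trans (sym (count-reject (λ x → colour x ≟ 1) {x = u} {xs = others} (colour≢1 u))) (count-colour 1)))))
    g-mult c@(suc (suc _)) = trans (count-g c)
      (trans (count-reject (λ x → g x ≟ c) {x = u} {xs = others} (λ eq → 0≢1+n (suc-injective (trans (sym g-u) eq))))
      (trans (count-others c)
      (trans (sym (count-reject (λ x → colour x ≟ c) {x = u} {xs = others} (λ eq → 0≢1+n (trans (sym cu≡0) eq)))) (count-colour c))))

  cobipartite-boxClosed : BoxClosed (GraphColouring G)
  cobipartite-boxClosed .BoxClosed.perm = Colouring-resp-↭
  -- The class being reduced has `suc x` vertices and at most two, so `y < x` leaves only `x = 1`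
  -- and `y = 0`.
  cobipartite-boxClosed .BoxClosed.box {1}           {0}     _        f = splitClass f
  cobipartite-boxClosed .BoxClosed.box {1}           {suc _} (s≤s ()) f
  cobipartite-boxClosed .BoxClosed.box {suc (suc x)}         _        f with class-≤2 f 0
  ... | s≤s (s≤s ())

  cobipartite-dominated : DominatedWeights (GraphColouring G) (λ-coBipartite G)
  cobipartite-dominated = record
    { boxClosed = cobipartite-boxClosed
    ; padding   = λ m {α} → Colouring-resp-nth (λ c → sym (nth-++-zeros α m c))
    ; dominated = dominated-twosOnes
    ; total     = λ f → trans (sum≡n f) (sym (trans (sum-twosOnes j⁺ (n ∸ 2 * j⁺)) (m+[n∸m]≡n 2*j⁺≤n)))
    ; attained  = colouring-positiveParts (monomialCoeff⇒colouring G (twosOnes n j⁺)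
        (largest-satisfies (λ j → ¬? (monomialCoeff G (twosOnes n j) ℤ.≟ ℤ.0ℤ)) ⌊ n /2⌋
          (colouring⇒monomialCoeff G (twosOnes n 0) (onesColouring G))))
    }

-- Matchings of bicoloured graphs

unique-↭ : ∀ {A : Set} {xs ys : List A} → Unique xs → Unique ys →
           (∀ {x} → x ∈ xs → x ∈ ys) → (∀ {x} → x ∈ ys → x ∈ xs) → xs ↭ ys
unique-↭ {xs = []} {[]}     _ _ _ _ = ↭-refl
unique-↭ {xs = []} {y ∷ ys} _ _ _ ys⊆xs with () ← ys⊆xs (here refl)
unique-↭ {xs = x ∷ xs} (x∉ ∷ uxs) uys xs⊆ys ys⊆xs with ∈-∃++ (xs⊆ys (here refl))
... | ls , rs , refl with Unique-resp-↭ (shift x ls rs) uys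
...   | x∉′ ∷ u = ↭-trans (Perm.prep x (unique-↭ uxs u
          (λ z∈ → tail-∈ (λ { refl → All.lookup x∉ z∈ refl }) (∈-resp-↭ (shift x ls rs) (xs⊆ys (there z∈))))
          (λ z∈ → tail-∈ (λ { refl → All.lookup x∉′ z∈ refl }) (ys⊆xs (∈-resp-↭ (↭-sym (shift x ls rs)) (there z∈))))))
          (↭-sym (shift x ls rs))
  where
  tail-∈ : ∀ {A : Set} {x z : A} {zs} → z ≢ x → z ∈ x ∷ zs → z ∈ zs
  tail-∈ z≢x (here z≡x) = contradiction z≡x z≢x
  tail-∈ z≢x (there z∈) = z∈

unique-map : ∀ {A B : Set} (f : A → B) {xs} → Unique xs → (∀ {x y} → x ∈ xs → y ∈ xs → f x ≡ f y → x ≡ y) → Unique (map f xs)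
unique-map f [] _ = []
unique-map f (x∉ ∷ u) inj =
  All.map⁺ (All.tabulate λ y∈ eq → All.lookup x∉ y∈ (inj (here refl) (there y∈) eq)) ∷
  unique-map f u λ x∈ y∈ → inj (there x∈) (there y∈)

module _ {n : ℕ} where
  open import Data.List.Membership.DecPropositional (Fin._≟_ {n}) using () renaming (_∈?_ to _∈ᶠ?_)

  unused : List (Fin n) → List (Fin n)
  unused xs = filter (λ x → ¬? (x ∈ᶠ? xs)) (allFin n)

  unused-∉ : ∀ xs {x} → x ∈ unused xs → x ∉ xs
  unused-∉ xs = proj₂ ∘ ∈-filter⁻ (λ x → ¬? (x ∈ᶠ? xs)) {xs = allFin n}

  completion-unique : ∀ {xs} → Unique xs → Unique (xs ++ unused xs)
  completion-unique {xs} u = Unique.++⁺ u (Unique.filter⁺ (λ x → ¬? (x ∈ᶠ? xs)) (Unique.allFin⁺ n))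
    λ (x∈ , x∈′) → unused-∉ xs x∈′ x∈

  completion : ∀ {xs} → Unique xs → xs ++ unused xs ↭ allFin n
  completion {xs} u = unique-↭ (completion-unique u) (Unique.allFin⁺ n) (λ _ → ∈-allFin _) λ {x} _ → covered x
    where
    covered : ∀ x → x ∈ xs ++ unused xs
    covered x with x ∈ᶠ? xs
    ... | yes x∈ = ∈-++⁺ˡ x∈
    ... | no x∉  = ∈-++⁺ʳ xs (∈-filter⁺ (λ x → ¬? (x ∈ᶠ? xs)) (∈-allFin x) x∉)

members : ∀ {s} → Subset s → List (Fin s)
members []          = []
members (true  ∷ p) = Fin.zero ∷ map Fin.suc (members p)
members (false ∷ p) = map Fin.suc (members p)

length-members : ∀ {s} (p : Subset s) → length (members p) ≡ Subset.∣ p ∣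
length-members []          = refl
length-members (true  ∷ p) = cong suc (trans (length-map Fin.suc (members p)) (length-members p))
length-members (false ∷ p) = trans (length-map Fin.suc (members p)) (length-members p)

∈-members⁺ : ∀ {s x} {p : Subset s} → x Subset.∈ p → x ∈ members p
∈-members⁺ {p = _ ∷ _}     Vec.here        = here refl
∈-members⁺ {p = true  ∷ _} (Vec.there x∈p) = there (∈-map⁺ Fin.suc (∈-members⁺ x∈p))
∈-members⁺ {p = false ∷ _} (Vec.there x∈p) = ∈-map⁺ Fin.suc (∈-members⁺ x∈p)

∈-members⁻ : ∀ {s x} (p : Subset s) → x ∈ members p → x Subset.∈ p
∈-members⁻ (true ∷ p) (here refl) = Vec.here
∈-members⁻ (true ∷ p) (there x∈) with ∈-map⁻ Fin.suc x∈
... | y , y∈ , refl = Vec.there (∈-members⁻ p y∈)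
∈-members⁻ (false ∷ p) x∈ with ∈-map⁻ Fin.suc x∈
... | y , y∈ , refl = Vec.there (∈-members⁻ p y∈)

members-unique : ∀ {s} (p : Subset s) → Unique (members p)
members-unique []          = []
members-unique (true  ∷ p) = All.map⁺ (All.universal (λ _ ()) (members p)) ∷ Unique.map⁺ Fin.suc-injective (members-unique p)
members-unique (false ∷ p) = Unique.map⁺ Fin.suc-injective (members-unique p)

firstRow : ∀ {r s} → Fin s → Fin (suc r) × Fin s
firstRow b = Fin.zero , b

nextRow : ∀ {r s} → Fin r × Fin s → Fin (suc r) × Fin s
nextRow (a , b) = Fin.suc a , b

edges : ∀ {r s} → BicolouredGraph r s → List (Fin r × Fin s)
edges []      = []
edges (p ∷ H) = map firstRow (members p) ++ map nextRow (edges H)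

length-edges : ∀ {r s} (H : BicolouredGraph r s) → length (edges H) ≡ edgeCount H
length-edges []      = refl
length-edges (p ∷ H) = trans (length-++ (map firstRow (members p)))
  (cong₂ _+_ (trans (length-map firstRow (members p)) (length-members p)) (trans (length-map nextRow (edges H)) (length-edges H)))

∈-edges⁺ : ∀ {r s} (H : BicolouredGraph r s) {a b} → Edge H a b → (a , b) ∈ edges H
∈-edges⁺ (p ∷ H) {Fin.zero}  e = ∈-++⁺ˡ (∈-map⁺ firstRow (∈-members⁺ e))
∈-edges⁺ (p ∷ H) {Fin.suc a} e = ∈-++⁺ʳ (map firstRow (members p)) (∈-map⁺ nextRow (∈-edges⁺ H e))

∈-edges⁻ : ∀ {r s} (H : BicolouredGraph r s) {a b} → (a , b) ∈ edges H → Edge H a b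
∈-edges⁻ (p ∷ H) e with ∈-++⁻ (map firstRow (members p)) e
... | inj₁ e′ with _ , b∈ , refl ← ∈-map⁻ firstRow e′ = ∈-members⁻ p b∈
... | inj₂ e′ with _ , e″ , refl ← ∈-map⁻ nextRow e′ = ∈-edges⁻ H e″

edges-unique : ∀ {r s} (H : BicolouredGraph r s) → Unique (edges H)
edges-unique []      = []
edges-unique (p ∷ H) = Unique.++⁺ (Unique.map⁺ (λ { refl → refl }) (members-unique p))
  (Unique.map⁺ (λ { refl → refl }) (edges-unique H)) disjoint
  where
  disjoint : ∀ {e} → ¬ (e ∈ map firstRow (members p) × e ∈ map nextRow (edges H))
  disjoint (e∈ , e∈′) with ∈-map⁻ firstRow e∈ | ∈-map⁻ nextRow e∈′
  ... | _ , _ , refl | _ , _ , ()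

record Matching {r s} (H : BicolouredGraph r s) : Set where
  field
    pairs      : List (Fin r × Fin s)
    edge       : ∀ {a b} → (a , b) ∈ pairs → Edge H a b
    uniqueRows : Unique (map proj₁ pairs)
    uniqueCols : Unique (map proj₂ pairs)

module _ {A B : Set} where

  ∈-zip⁻ : ∀ (xs : List A) (ys : List B) {x y} → (x , y) ∈ zip xs ys → x ∈ xs × y ∈ ys
  ∈-zip⁻ (x ∷ xs) (y ∷ ys) (here refl) = here refl , here refl
  ∈-zip⁻ (x ∷ xs) (y ∷ ys) (there p)   = let x∈ , y∈ = ∈-zip⁻ xs ys p in there x∈ , there y∈

  zip-functional : ∀ {xs : List A} (ys : List B) {x y y′} → Unique xs → (x , y) ∈ zip xs ys → (x , y′) ∈ zip xs ys → y ≡ y′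
  zip-functional {_ ∷ _} (_ ∷ ys) _        (here refl) (here refl) = refl
  zip-functional {_ ∷ _} (_ ∷ ys) (x∉ ∷ _) (here refl) (there p)   = contradiction refl (All.lookup x∉ (proj₁ (∈-zip⁻ _ ys p)))
  zip-functional {_ ∷ _} (_ ∷ ys) (x∉ ∷ _) (there p)   (here refl) = contradiction refl (All.lookup x∉ (proj₁ (∈-zip⁻ _ ys p)))
  zip-functional {_ ∷ _} (_ ∷ ys) (_ ∷ u)  (there p)   (there p′)  = zip-functional ys u p p′

  zip-injective : ∀ (xs : List A) {ys : List B} {x x′ y} → Unique ys → (x , y) ∈ zip xs ys → (x′ , y) ∈ zip xs ys → x ≡ x′
  zip-injective (_ ∷ xs) {_ ∷ _} _        (here refl) (here refl) = refl
  zip-injective (_ ∷ xs) {_ ∷ _} (y∉ ∷ _) (here refl) (there p)   = contradiction refl (All.lookup y∉ (proj₂ (∈-zip⁻ xs _ p)))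
  zip-injective (_ ∷ xs) {_ ∷ _} (y∉ ∷ _) (there p)   (here refl) = contradiction refl (All.lookup y∉ (proj₂ (∈-zip⁻ xs _ p)))
  zip-injective (_ ∷ xs) {_ ∷ _} (_ ∷ u)  (there p)   (there p′)  = zip-injective xs u p p′

  zip-unique : ∀ {xs : List A} (ys : List B) → Unique xs → Unique (zip xs ys)
  zip-unique             []       u        = subst Unique (sym (zip-[] _)) []
    where
    zip-[] : ∀ xs → zip xs ([] {A = B}) ≡ []
    zip-[] []      = refl
    zip-[] (_ ∷ _) = refl
  zip-unique {xs = []}     (_ ∷ _)  _        = []
  zip-unique {xs = x ∷ xs} (y ∷ ys) (x∉ ∷ u) =
    All.tabulate (λ { p refl → All.lookup x∉ (proj₁ (∈-zip⁻ xs ys p)) refl }) ∷ zip-unique ys u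

  ∈-zip-++ : ∀ ps (xs : List A) (ys : List B) {p} → p ∈ ps → p ∈ zip (map proj₁ ps ++ xs) (map proj₂ ps ++ ys)
  ∈-zip-++ (_ ∷ ps) xs ys (here refl) = here refl
  ∈-zip-++ (_ ∷ ps) xs ys (there p∈)  = there (∈-zip-++ ps xs ys p∈)

module _ {r s : ℕ} where

  edge-∩⁺ : ∀ (H M : BicolouredGraph r s) {a b} → Edge H a b → Edge M a b → Edge (Vec.zipWith Subset._∩_ H M) a b
  edge-∩⁺ H M {a} {b} e e′ = subst (b Subset.∈_) (sym (Vec.lookup-zipWith Subset._∩_ a H M)) (Subset.x∈p∩q⁺ (e , e′))

  edge-∩⁻ : ∀ (H M : BicolouredGraph r s) {a b} → Edge (Vec.zipWith Subset._∩_ H M) a b → Edge H a b × Edge M a b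
  edge-∩⁻ H M {a} {b} e =
    Subset.x∈p∩q⁻ (Vec.lookup H a) (Vec.lookup M a) (subst (b Subset.∈_) (Vec.lookup-zipWith Subset._∩_ a H M) e)

  open import Data.List.Membership.DecPropositional (Product.≡-dec (Fin._≟_ {r}) (Fin._≟_ {s})) using () renaming (_∈?_ to _∈ᵖ?_)

  fromPairs : List (Fin r × Fin s) → BicolouredGraph r s
  fromPairs ps = Vec.tabulate λ a → Vec.tabulate λ b → does ((a , b) ∈ᵖ? ps)

  private
    lookup-fromPairs : ∀ ps a b → Vec.lookup (Vec.lookup (fromPairs ps) a) b ≡ does ((a , b) ∈ᵖ? ps)
    lookup-fromPairs ps a b = trans (cong (λ p → Vec.lookup p b) (Vec.lookup∘tabulate (λ a → Vec.tabulate λ b → does ((a , b) ∈ᵖ? ps)) a))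
      (Vec.lookup∘tabulate (λ b → does ((a , b) ∈ᵖ? ps)) b)

  fromPairs⁺ : ∀ {ps a b} → (a , b) ∈ ps → Edge (fromPairs ps) a b
  fromPairs⁺ {ps} {a} {b} p = Vec.lookup⇒[]= b _ (trans (lookup-fromPairs ps a b) (dec-true ((a , b) ∈ᵖ? ps) p))

  fromPairs⁻ : ∀ {ps a b} → Edge (fromPairs ps) a b → (a , b) ∈ ps
  fromPairs⁻ {ps} {a} {b} e with (a , b) ∈ᵖ? ps | trans (sym (Vec.[]=⇒lookup e)) (lookup-fromPairs ps a b)
  ... | yes p | _  = p
  ... | no _  | ()

  probability≢0⁻ : ∀ {A : Set} {P : Pred A 0ℓ} (P? : Decidable P) xs → probability P? xs ≢ 0ℚ → ∃[ x ] x ∈ xs × P x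
  probability≢0⁻ P? []          ≢0 = contradiction refl ≢0
  probability≢0⁻ P? xs@(_ ∷ ys) ≢0 with length (filter P? xs) ≟ 0
  ... | yes ≡0 = contradiction (trans (cong (λ m → ℤ.+ m ℚ./ suc (length ys)) ≡0) (ℚ.fromℚᵘ-cong {ℚᵘ.mkℚᵘ ℤ.0ℤ (length ys)} {ℚᵘ.0ℚᵘ} (ℚᵘ.*≡* refl))) ≢0
  ... | no ≢0′ = 0<count⇒∈ P? xs (n≢0⇒n>0 ≢0′)

  probability≢0⁺ : ∀ {A : Set} {P : Pred A 0ℓ} (P? : Decidable P) {xs x} → x ∈ xs → P x → probability P? xs ≢ 0ℚ
  probability≢0⁺ P? {xs@(_ ∷ ys)} x∈ Px ≡0 with ℚ.fromℚᵘ-injective {ℚᵘ.mkℚᵘ (ℤ.+ length (filter P? xs)) (length ys)} {ℚᵘ.0ℚᵘ} ≡0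
  ... | ℚᵘ.*≡* eq = >⇒≢ (∈⇒0<count P? x∈ Px) (ℤ.+-injective (trans (sym (ℤ.*-identityʳ _)) eq))

  ∈-maximumMatchings : ∀ {M : BicolouredGraph r s} → MaximumMatching M → M ∈ maximumMatchings
  ∈-maximumMatchings {M} max = ∈-filter⁺ maximumMatching? (∈-allVecs M λ a → ∈-allVecs (Vec.lookup M a) λ b → bool (Vec.lookup (Vec.lookup M a) b)) max
    where
    bool : ∀ x → x ∈ true ∷ false ∷ []
    bool true  = here refl
    bool false = there (here refl)

  module _ (H : BicolouredGraph r s) where

    maxCommon-≤ : maxCommon H ≤ r ⊓ s
    maxCommon-≤ = largest-≤ _ (r ⊓ s)

    matching-≤-maxCommon : (m : Matching H) → length (Matching.pairs m) ≤ maxCommon H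
    matching-≤-maxCommon m = ≤-trans size≤common (largest-upper _ (r ⊓ s) common≤
      (probability≢0⁺ (λ M → commonEdges H M ≟ commonEdges H M₀) (∈-maximumMatchings max) refl))
      where
      open Matching m
      rows = map proj₁ pairs ++ unused (map proj₁ pairs)
      cols = map proj₂ pairs ++ unused (map proj₂ pairs)
      full = zip rows cols
      M₀ = fromPairs full
      edges↭ : edges M₀ ↭ full
      edges↭ = unique-↭ (edges-unique M₀) (zip-unique cols (completion-unique uniqueRows))
        (λ e → fromPairs⁻ (∈-edges⁻ M₀ e)) (λ e → ∈-edges⁺ M₀ (fromPairs⁺ e))
      count≡ : edgeCount M₀ ≡ r ⊓ s
      count≡ = trans (sym (length-edges M₀)) (trans (↭-length edges↭) (trans (length-zipWith _,_ rows cols)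
        (cong₂ _⊓_ (trans (↭-length (completion uniqueRows)) (length-tabulate id))
                   (trans (↭-length (completion uniqueCols)) (length-tabulate id)))))
      max : MaximumMatching M₀
      max = (λ { a b a′ b′ e e′ →
                 (λ { refl → zip-functional cols (completion-unique uniqueRows) (fromPairs⁻ e) (fromPairs⁻ e′) }) ,
                 (λ { refl → zip-injective rows (completion-unique uniqueCols) (fromPairs⁻ e) (fromPairs⁻ e′) }) }) ,
            count≡
      N = Vec.zipWith Subset._∩_ H M₀
      common≤ : commonEdges H M₀ ≤ r ⊓ s
      common≤ = subst₂ _≤_ (length-edges N) (trans (length-edges M₀) count≡)
        (unique-⊆⇒length-≤ (edges-unique N) λ e → ∈-edges⁺ M₀ (proj₂ (edge-∩⁻ H M₀ (∈-edges⁻ N e))))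
      size≤common : length pairs ≤ commonEdges H M₀
      size≤common = subst (length pairs ≤_) (length-edges N) (unique-⊆⇒length-≤ (Unique.map⁻ uniqueRows)
        λ p → ∈-edges⁺ N (edge-∩⁺ H M₀ (edge p) (fromPairs⁺ (∈-zip-++ pairs _ _ p))))

    private
      q≢0⇒matching : ∀ j → commonProbability H j ≢ 0ℚ → Σ[ m ∈ Matching H ] length (Matching.pairs m) ≡ j
      q≢0⇒matching j q≢0 with probability≢0⁻ (λ M → commonEdges H M ≟ j) maximumMatchings q≢0
      ... | M , M∈ , refl = record
        { pairs      = edges N
        ; edge       = λ e → proj₁ (edge-∩⁻ H M (∈-edges⁻ N e))
        ; uniqueRows = unique-map proj₁ (edges-unique N)
            λ { {a , b} {_ , b′} e e′ refl → cong (a ,_) (proj₁ (matching a b a b′ (M-edge e) (M-edge e′)) refl) }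
        ; uniqueCols = unique-map proj₂ (edges-unique N)
            λ { {a , b} {a′ , _} e e′ refl → cong (_, b) (proj₂ (matching a b a′ b (M-edge e) (M-edge e′)) refl) }
        } , length-edges N
        where
        N = Vec.zipWith Subset._∩_ H M
        matching = proj₁ (proj₂ (∈-filter⁻ maximumMatching? {xs = allVecs (allVecs (true ∷ false ∷ []) s) r} M∈))
        M-edge : ∀ {a b} → (a , b) ∈ edges N → Edge M a b
        M-edge e = proj₂ (edge-∩⁻ H M (∈-edges⁻ N e))

      largest-satisfies-or-0 : ∀ {P : Pred ℕ 0ℓ} (P? : Decidable P) m → P (largest P? m) ⊎ largest P? m ≡ 0
      largest-satisfies-or-0 P? zero = inj₂ refl
      largest-satisfies-or-0 P? (suc m) with P? (suc m)
      ... | yes Pm = inj₁ Pm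
      ... | no  _  = largest-satisfies-or-0 P? m

    -- The edges that a maximum matching shares with `H` form a matching of `H`; for the fallback
    -- value 0 of `largest` the empty matching serves. Together with `matching-≤-maxCommon` this
    -- identifies `maxCommon H` as the matching number of `H`.
    maxCommon-matching : Σ[ m ∈ Matching H ] length (Matching.pairs m) ≡ maxCommon H
    maxCommon-matching with largest-satisfies-or-0 (λ j → ¬? (commonProbability H j ℚ.≟ 0ℚ)) (r ⊓ s)
    ... | inj₁ q≢0 = q≢0⇒matching (maxCommon H) q≢0
    ... | inj₂ ≡0  = record { pairs = [] ; edge = λ () ; uniqueRows = [] ; uniqueCols = [] } , sym ≡0

-- Colourings of part listings

Complete : ∀ {A : Set} → List A → Set
Complete xs = ∀ x → x ∈ xs

Isomorphic-incomparable : ∀ {A B : Set} {R : Rel A 0ℓ} {S : Rel B 0ℓ} → Isomorphic R S → Isomorphic (Incomparable R) (Incomparable S)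
Isomorphic-incomparable {R = R} {S} (φ , iso) = φ , record
  { isOrderMonomorphism = record
    { isOrderHomomorphism = record
      { cong = cong φ
      ; mono = λ (x≢y , ¬xy , ¬yx) → x≢y ∘ injective , ¬xy ∘ cancel , ¬yx ∘ cancel }
    ; injective = injective
    ; cancel    = λ (φx≢φy , ¬xy , ¬yx) → φx≢φy ∘ cong φ , ¬xy ∘ mono , ¬yx ∘ mono }
  ; surjective = surjective }
  where open IsOrderIsomorphism iso hiding (cong)

module _ {A B : Set} {R : Rel A 0ℓ} {S : Rel B 0ℓ} (iso : Isomorphic R S) {xs : List A} {ys : List B}
         (xs-unique : Unique xs) (xs-complete : Complete xs) (ys-unique : Unique ys) (ys-complete : Complete ys) where
  private φ = proj₁ iso
  open IsOrderIsomorphism (proj₂ iso) hiding (cong)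

  private
    ψ : B → A
    ψ y = proj₁ (surjective y)

    φ-ψ : ∀ y → φ (ψ y) ≡ y
    φ-ψ y = proj₂ (surjective y) refl

    map-φ : map φ xs ↭ ys
    map-φ = unique-↭ (Unique.map⁺ injective xs-unique) ys-unique (λ _ → ys-complete _)
      λ {y} _ → subst (_∈ map φ xs) (φ-ψ y) (∈-map⁺ φ (xs-complete (ψ y)))

  colouring-pull : ∀ {α} → Colouring S ys α → Colouring R xs α
  colouring-pull {α} f = record
    { colour = colour ∘ φ
    ; proper = proper ∘ mono
    ; mult   = HasMultiplicities-resp-↭ {α}
        (↭-trans (Perm.map⁺ colour (↭-sym map-φ)) (↭-reflexive (sym (map-∘ xs)))) mult }
    where open Colouring f

  colouring-push : ∀ {α} → Colouring R xs α → Colouring S ys α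
  colouring-push {α} f = record
    { colour = colour ∘ ψ
    ; proper = λ {x} {y} xy → proper (cancel (subst₂ S (sym (φ-ψ x)) (sym (φ-ψ y)) xy))
    ; mult   = HasMultiplicities-resp-↭ {α} (↭-trans (↭-reflexive eq) (Perm.map⁺ (colour ∘ ψ) map-φ)) mult }
    where
    open Colouring f
    eq : map colour xs ≡ map (colour ∘ ψ) (map φ xs)
    eq = trans (map-cong (λ x → cong colour (sym (injective (φ-ψ (φ x))))) xs) (map-∘ xs)

partVertices : ∀ p → List (PartVertex p)
partVertices (single i)       = tt ∷ []
partVertices (double i r s H) = map inj₁ (allFin r) ++ map inj₂ (allFin s)

partVertices-unique : ∀ p → Unique (partVertices p)
partVertices-unique (single i)       = [] ∷ []
partVertices-unique (double i r s H) = Unique.++⁺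
  (Unique.map⁺ (λ { refl → refl }) (Unique.allFin⁺ r)) (Unique.map⁺ (λ { refl → refl }) (Unique.allFin⁺ s)) disjoint
  where
  disjoint : ∀ {x} → ¬ (x ∈ map inj₁ (allFin r) × x ∈ map inj₂ (allFin s))
  disjoint (x∈ , x∈′) with ∈-map⁻ inj₁ x∈ | ∈-map⁻ inj₂ x∈′
  ... | _ , _ , refl | _ , _ , ()

partVertices-complete : ∀ p → Complete (partVertices p)
partVertices-complete (single i)       tt       = here refl
partVertices-complete (double i r s H) (inj₁ x) = ∈-++⁺ˡ (∈-map⁺ inj₁ (∈-allFin x))
partVertices-complete (double i r s H) (inj₂ y) = ∈-++⁺ʳ (map inj₁ (allFin r)) (∈-map⁺ inj₂ (∈-allFin y))

module _ {p : Part} {L : Listing} where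

  headVertex : PartVertex p → Vertex (p ∷ L)
  headVertex x = Fin.zero , x

  tailVertex : Vertex L → Vertex (p ∷ L)
  tailVertex (t , x) = Fin.suc t , x

  headVertex-injective : ∀ {x y} → headVertex x ≡ headVertex y → x ≡ y
  headVertex-injective refl = refl

  tailVertex-injective : ∀ {x y} → tailVertex x ≡ tailVertex y → x ≡ y
  tailVertex-injective refl = refl

  tailVertex-mono : ∀ {x y} → ListingOrder L x y → ListingOrder (p ∷ L) (tailVertex x) (tailVertex y)
  tailVertex-mono (inj₁ far)                            = inj₁ far
  tailVertex-mono (inj₂ (inj₁ (near , earlier)))        = inj₂ (inj₁ (near , s≤s earlier))
  tailVertex-mono (inj₂ (inj₂ (near , joined e)))       = inj₂ (inj₂ (near , joined e))

  tailVertex-cancel : ∀ {x y} → ListingOrder (p ∷ L) (tailVertex x) (tailVertex y) → ListingOrder L x y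
  tailVertex-cancel (inj₁ far)                          = inj₁ far
  tailVertex-cancel (inj₂ (inj₁ (near , s≤s earlier)))  = inj₂ (inj₁ (near , earlier))
  tailVertex-cancel (inj₂ (inj₂ (near , joined e)))     = inj₂ (inj₂ (near , joined e))

vertices : ∀ L → List (Vertex L)
vertices []      = []
vertices (p ∷ L) = map (headVertex {p} {L}) (partVertices p) ++ map (tailVertex {p} {L}) (vertices L)

vertices-unique : ∀ L → Unique (vertices L)
vertices-unique []      = []
vertices-unique (p ∷ L) = Unique.++⁺ (Unique.map⁺ headVertex-injective (partVertices-unique p))
  (Unique.map⁺ tailVertex-injective (vertices-unique L)) disjoint
  where
  disjoint : ∀ {x} → ¬ (x ∈ map (headVertex {p} {L}) (partVertices p) × x ∈ map (tailVertex {p} {L}) (vertices L))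
  disjoint (x∈ , x∈′) with ∈-map⁻ headVertex x∈ | ∈-map⁻ tailVertex x∈′
  ... | _ , _ , refl | _ , _ , ()

vertices-complete : ∀ L → Complete (vertices L)
vertices-complete (p ∷ L) (Fin.zero  , x) = ∈-++⁺ˡ (∈-map⁺ headVertex (partVertices-complete p x))
vertices-complete (p ∷ L) (Fin.suc t , x) =
  ∈-++⁺ʳ (map (headVertex {p} {L}) (partVertices p)) (∈-map⁺ tailVertex (vertices-complete L (t , x)))

-- A coloured vertex of a listing, reduced to its level and its colour.
Entry : Set
Entry = ℕ × ℕ

-- The condition on a vertex and a vertex of a later part.
Compatible : Entry → Entry → Set
Compatible (l , c) (l′ , c′) = c ≡ c′ → l ≢ l′ × l ≢ suc l′

-- Vertices on one level are pairwise incomparable, whence the injectivity of `g` and `h`. A lower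
-- and an upper vertex of the same part are comparable only along an edge, so only an edge lets them
-- share a colour.
PartColouring : Part → List Entry → Set
PartColouring (single i)       es = ∃[ c ] es ≡ (i , c) ∷ []
PartColouring (double i r s H) es = Σ[ g ∈ (Fin r → ℕ) ] Σ[ h ∈ (Fin s → ℕ) ]
  (∀ {x y} → g x ≡ g y → x ≡ y) × (∀ {x y} → h x ≡ h y → x ≡ y) × (∀ {x y} → g x ≡ h y → Edge H x y) ×
  es ≡ map (λ x → i , g x) (allFin r) ++ map (λ y → suc i , h y) (allFin s)

-- The condition between parts sees only levels and colours, and neither the vertices nor their
-- order. A part can therefore be exchanged for any listing that realises the same multisets of
-- entries.
data Word : Listing → List Entry → Set where
  []   : Word [] []
  cons : ∀ {p L es fs} → PartColouring p es → Word L fs →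
         (∀ {x y} → x ∈ es → y ∈ fs → Compatible x y) → Word (p ∷ L) (es ++ fs)

module _ (L : Listing) where

  entry : (Vertex L → ℕ) → Vertex L → Entry
  entry f x = level L x , f x

  ProperListing : (Vertex L → ℕ) → Set
  ProperListing f = ∀ {x y} → Incomparable (ListingOrder L) x y → f x ≢ f y

  ListingOrder-level : ∀ {x y} → ListingOrder L x y → level L x < level L y
  ListingOrder-level (inj₁ far)              = ≤-trans (n≤1+n _) far
  ListingOrder-level (inj₂ (inj₁ (near , _))) = ≤-reflexive near
  ListingOrder-level (inj₂ (inj₂ (near , _))) = ≤-reflexive near

  sameLevel⇒incomparable : ∀ {x y} → x ≢ y → level L x ≡ level L y → Incomparable (ListingOrder L) x y
  sameLevel⇒incomparable x≢y eq = x≢y , (λ xy → <⇒≢ (ListingOrder-level xy) eq) , (λ yx → <⇒≢ (ListingOrder-level yx) (sym eq))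

module _ {p : Part} {L : Listing} where

  ProperListing-tail : ∀ {f} → ProperListing (p ∷ L) f → ProperListing L (f ∘ tailVertex)
  ProperListing-tail f-proper (x≢y , ¬xy , ¬yx) =
    f-proper (x≢y ∘ tailVertex-injective , ¬xy ∘ tailVertex-cancel , ¬yx ∘ tailVertex-cancel)

  -- A vertex is incomparable with a vertex of a later part when it is on the same level or one
  -- level above it: between adjacent levels the order needs the lower vertex in the earlier part,
  -- or an edge inside a single part.
  headTail-compatible : ∀ {f} → ProperListing (p ∷ L) f → ∀ x y →
    Compatible (entry (p ∷ L) f (headVertex x)) (entry (p ∷ L) f (tailVertex y))
  headTail-compatible f-proper x y eq =
    (λ same → f-proper (sameLevel⇒incomparable (p ∷ L) (λ ()) same) eq) ,
    (λ above → f-proper ((λ ()) ,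
      (λ xy → <⇒≱ (ListingOrder-level (p ∷ L) xy) (≤-trans (n≤1+n _) (≤-reflexive (sym above)))) ,
      (λ { (inj₁ far) → <-irrefl (sym above) far
         ; (inj₂ (inj₁ (_ , ())))
         ; (inj₂ (inj₂ (_ , ()))) })) eq)

  compatible⇒comparable : ∀ x y → let l = level (p ∷ L) (headVertex x) ; l′ = level (p ∷ L) (tailVertex y) in
    l ≢ l′ → l ≢ suc l′ → ¬ Incomparable (ListingOrder (p ∷ L)) (headVertex x) (tailVertex y)
  compatible⇒comparable x y l≢l′ l≢1+l′ (_ , ¬xy , ¬yx) with <-cmp (level (p ∷ L) (headVertex x)) (level (p ∷ L) (tailVertex y))
  ... | tri≈ _ eq _ = l≢l′ eq
  ... | tri> _ _ l>l′ = ¬yx (inj₁ (≤∧≢⇒< l>l′ (l≢1+l′ ∘ sym)))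
  ... | tri< l<l′ _ _ with m≤n⇒m<n∨m≡n l<l′
  ...   | inj₁ far  = ¬xy (inj₁ far)
  ...   | inj₂ near = ¬xy (inj₂ (inj₁ (near , z<s)))

proper⇒word : ∀ L f → ProperListing L f → Word L (map (entry L f) (vertices L))
proper⇒word []      f _        = []
proper⇒word (p ∷ L) f f-proper = subst (Word (p ∷ L)) (sym entries≡)
  (cons (partColouring p f-proper) (proper⇒word L (f ∘ tailVertex) (ProperListing-tail {p} f-proper)) compatible)
  where
  heads : ∀ p (f : Vertex (p ∷ L) → ℕ) → List Entry
  heads p f = map (λ x → partLevel p x , f (headVertex x)) (partVertices p)
  entries≡ : map (entry (p ∷ L) f) (vertices (p ∷ L)) ≡ heads p f ++ map (entry L (f ∘ tailVertex)) (vertices L)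
  entries≡ = trans (map-++ (entry (p ∷ L) f) (map headVertex (partVertices p)) _)
    (cong₂ _++_ (sym (map-∘ (partVertices p))) (sym (map-∘ (vertices L))))
  compatible : ∀ {x y} → x ∈ heads p f → y ∈ map (entry L (f ∘ tailVertex)) (vertices L) → Compatible x y
  compatible x∈ y∈ with ∈-map⁻ _ x∈ | ∈-map⁻ (entry L (f ∘ tailVertex)) y∈
  ... | x , _ , refl | y , _ , refl = headTail-compatible {p} {L} f-proper x y
  partColouring : ∀ p {f : Vertex (p ∷ L) → ℕ} → ProperListing (p ∷ L) f → PartColouring p (heads p f)
  partColouring (single i) {f} _ = f (headVertex tt) , refl
  partColouring (double i r s H) {f} f-proper =
    (λ x → f (headVertex (inj₁ x))) , (λ y → f (headVertex (inj₂ y))) ,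
    (λ {x} {y} eq → decidable-stable (x Fin.≟ y) λ x≢y →
      f-proper (sameLevel⇒incomparable (double i r s H ∷ L) (λ { refl → x≢y refl }) refl) eq) ,
    (λ {x} {y} eq → decidable-stable (x Fin.≟ y) λ x≢y →
      f-proper (sameLevel⇒incomparable (double i r s H ∷ L) (λ { refl → x≢y refl }) refl) eq) ,
    (λ {x} {y} eq → decidable-stable (y Subset.∈? Vec.lookup H x) λ ¬xy → f-proper ((λ ()) ,
      (λ { (inj₁ far) → <-irrefl refl (s≤s⁻¹ far)
         ; (inj₂ (inj₁ (_ , ())))
         ; (inj₂ (inj₂ (_ , joined e))) → ¬xy e }) ,
      (λ yx → <⇒≱ (ListingOrder-level (double i r s H ∷ L) yx) (n≤1+n i))) eq) ,
    trans (map-++ _ (map inj₁ (allFin r)) _) (cong₂ _++_ (sym (map-∘ (allFin r))) (sym (map-∘ (allFin s))))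

partColour : ∀ p {es} → PartColouring p es → PartVertex p → ℕ
partColour (single i)       (c , _)     _        = c
partColour (double i r s H) (g , h , _) (inj₁ x) = g x
partColour (double i r s H) (g , h , _) (inj₂ y) = h y

partColour-entries : ∀ p {es} (col : PartColouring p es) →
                     map (λ x → partLevel p x , partColour p col x) (partVertices p) ≡ es
partColour-entries (single i) (c , refl) = refl
partColour-entries (double i r s H) (g , h , _ , _ , _ , refl) =
  trans (map-++ _ (map inj₁ (allFin r)) _) (cong₂ _++_ (sym (map-∘ (allFin r))) (sym (map-∘ (allFin s))))

partColour-proper : ∀ p {L es} (col : PartColouring p es) {x y} →
  Incomparable (ListingOrder (p ∷ L)) (headVertex x) (headVertex y) → partColour p col x ≢ partColour p col y
partColour-proper (single i)       _ (x≢y , _) _ = x≢y refl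
partColour-proper (double i r s H) (g , h , g-inj , h-inj , edge , _) {inj₁ x} {inj₁ y} (x≢y , _) eq =
  x≢y (cong (headVertex ∘ inj₁) (g-inj eq))
partColour-proper (double i r s H) (g , h , g-inj , h-inj , edge , _) {inj₂ x} {inj₂ y} (x≢y , _) eq =
  x≢y (cong (headVertex ∘ inj₂) (h-inj eq))
partColour-proper (double i r s H) (g , h , g-inj , h-inj , edge , _) {inj₁ x} {inj₂ y} (_ , ¬xy , _) eq =
  ¬xy (inj₂ (inj₂ (refl , joined (edge eq))))
partColour-proper (double i r s H) (g , h , g-inj , h-inj , edge , _) {inj₂ x} {inj₁ y} (_ , _ , ¬yx) eq =
  ¬yx (inj₂ (inj₂ (refl , joined (edge (sym eq)))))

word⇒proper : ∀ {L es} → Word L es → Σ[ f ∈ (Vertex L → ℕ) ] ProperListing L f × map (entry L f) (vertices L) ≡ es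
word⇒proper [] = (λ ()) , (λ { {()} }) , refl
word⇒proper (cons {p} {L} {es} {fs} col word compatible) with word⇒proper word
... | f , f-proper , refl = g , g-proper , entries≡
  where
  g : Vertex (p ∷ L) → ℕ
  g (Fin.zero  , x) = partColour p col x
  g (Fin.suc t , x) = f (t , x)
  across : ∀ x y → Compatible (entry (p ∷ L) g (headVertex x)) (entry L f y)
  across x y = compatible
    (subst ((partLevel p x , partColour p col x) ∈_) (partColour-entries p col)
      (∈-map⁺ (λ x → partLevel p x , partColour p col x) (partVertices-complete p x)))
    (∈-map⁺ (entry L f) (vertices-complete L y))
  g-proper : ProperListing (p ∷ L) g
  g-proper {Fin.zero  , x} {Fin.zero  , y} inc = partColour-proper p {L} col inc
  g-proper {Fin.zero  , x} {Fin.suc u , y} inc eq =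
    let l≢l′ , l≢1+l′ = across x (u , y) eq in compatible⇒comparable x (u , y) l≢l′ l≢1+l′ inc
  g-proper {Fin.suc t , x} {Fin.zero  , y} (x≢y , ¬xy , ¬yx) eq =
    let l≢l′ , l≢1+l′ = across y (t , x) (sym eq) in compatible⇒comparable y (t , x) l≢l′ l≢1+l′ (x≢y ∘ sym , ¬yx , ¬xy)
  g-proper {Fin.suc t , x} {Fin.suc u , y} (x≢y , ¬xy , ¬yx) =
    f-proper (x≢y ∘ cong tailVertex , ¬xy ∘ tailVertex-mono , ¬yx ∘ tailVertex-mono)
  entries≡ : map (entry (p ∷ L) g) (vertices (p ∷ L)) ≡ es ++ map (entry L f) (vertices L)
  entries≡ = trans (map-++ (entry (p ∷ L) g) (map headVertex (partVertices p)) _)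
    (cong₂ _++_ (trans (sym (map-∘ (partVertices p))) (partColour-entries p col)) (sym (map-∘ (vertices L))))

ListingColouring : Listing → List ℕ → Set
ListingColouring L = Colouring (Incomparable (ListingOrder L)) (vertices L)

listingColouring⇒word : ∀ {L α} → ListingColouring L α → ∃[ es ] Word L es × HasMultiplicities α (map proj₂ es)
listingColouring⇒word {L} {α} f = _ , proper⇒word L colour proper , subst (HasMultiplicities α) (map-∘ (vertices L)) mult
  where open Colouring f

word⇒listingColouring : ∀ {L α es} → Word L es → HasMultiplicities α (map proj₂ es) → ListingColouring L α
word⇒listingColouring {L} {α} word mult with word⇒proper word
... | f , f-proper , refl = record
  { colour = f ; proper = f-proper ; mult = subst (HasMultiplicities α) (sym (map-∘ (vertices L))) mult }

-- Replacing a bicoloured part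

word-++ : ∀ {L M es fs} → Word L es → Word M fs → (∀ {x y} → x ∈ es → y ∈ fs → Compatible x y) → Word (L ++ M) (es ++ fs)
word-++ [] word _ = word
word-++ {M = M} {fs = fs} (cons {es = es} {es′} col rest compatible) word compatible′ =
  subst (Word _) (sym (++-assoc es es′ fs))
    (cons col (word-++ rest word (λ x∈ → compatible′ (∈-++⁺ʳ es x∈))) λ x∈ y∈ → case ∈-++⁻ es′ y∈ of λ
      { (inj₁ y∈′) → compatible x∈ y∈′ ; (inj₂ y∈′) → compatible′ (∈-++⁺ˡ x∈) y∈′ })

word-split : ∀ L {M gs} → Word (L ++ M) gs → ∃₂ λ es fs → gs ≡ es ++ fs × Word L es × Word M fs ×
             (∀ {x y} → x ∈ es → y ∈ fs → Compatible x y)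
word-split []      word = [] , _ , refl , [] , word , λ ()
word-split (p ∷ L) (cons {es = es} col word compatible) with word-split L word
... | es′ , fs , refl , word′ , word″ , compatible′ =
  es ++ es′ , fs , sym (++-assoc es es′ fs) , cons col word′ (λ x∈ y∈ → compatible x∈ (∈-++⁺ˡ y∈)) , word″ ,
  λ x∈ y∈ → case ∈-++⁻ es x∈ of λ { (inj₁ x∈′) → compatible x∈′ (∈-++⁺ʳ es′ y∈) ; (inj₂ x∈′) → compatible′ x∈′ y∈ }

at : ℕ → List ℕ → List Entry
at l = map (l ,_)

∈-at⁻ : ∀ {l cs e} → e ∈ at l cs → ∃[ c ] c ∈ cs × e ≡ (l , c)
∈-at⁻ = ∈-map⁻ _

replicate-word : ∀ {l cs} → Unique cs → Word (replicate (length cs) (single l)) (at l cs)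
replicate-word [] = []
replicate-word {l} {c ∷ cs} (c∉ ∷ u) = cons {es = (l , c) ∷ []} (c , refl) (replicate-word u)
  λ { (here refl) y∈ c≡ → case ∈-at⁻ y∈ of λ { (_ , c∈ , refl) → contradiction c≡ (All.lookup c∉ c∈) } }

replicate-word⁻ : ∀ {l} m {es} → Word (replicate m (single l)) es → ∃[ cs ] es ≡ at l cs × Unique cs × length cs ≡ m
replicate-word⁻ zero    [] = [] , refl , [] , refl
replicate-word⁻ (suc m) (cons (c , refl) word compatible) with replicate-word⁻ m word
... | cs , refl , u , refl = c ∷ cs , refl ,
  All.tabulate (λ c∈ c≡ → proj₁ (compatible (here refl) (∈-map⁺ _ c∈) c≡) refl) ∷ u , refl

Disjoint : List ℕ → List ℕ → Set
Disjoint as bs = ∀ {c} → c ∈ as → c ∉ bs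

-- Lower vertices that come before upper ones lie below all of them, so no colour is excluded. This
-- is what lets the two levels of a replacing word share colours.
at-compatible-below : ∀ {l as bs x y} → x ∈ at l as → y ∈ at (suc l) bs → Compatible x y
at-compatible-below x∈ y∈ _ with ∈-at⁻ x∈ | ∈-at⁻ y∈
... | _ , _ , refl | _ , _ , refl = <⇒≢ (n<1+n _) , <⇒≢ (m<n⇒m<1+n (n<1+n _))

at-compatible-disjoint : ∀ {l l′ as bs} → Disjoint as bs → ∀ {x y} → x ∈ at l as → y ∈ at l′ bs → Compatible x y
at-compatible-disjoint disjoint x∈ y∈ c≡ with ∈-at⁻ x∈ | ∈-at⁻ y∈
at-compatible-disjoint disjoint x∈ y∈ refl | _ , c∈ , refl | _ , c∈′ , refl = contradiction c∈′ (disjoint c∈)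

at-disjoint-same : ∀ {l as bs} → (∀ {x y} → x ∈ at l as → y ∈ at l bs → Compatible x y) → Disjoint as bs
at-disjoint-same compatible c∈ c∈′ = proj₁ (compatible (∈-map⁺ _ c∈) (∈-map⁺ _ c∈′) refl) refl

at-disjoint-above : ∀ {l as bs} → (∀ {x y} → x ∈ at (suc l) as → y ∈ at l bs → Compatible x y) → Disjoint as bs
at-disjoint-above compatible c∈ c∈′ = proj₂ (compatible (∈-map⁺ _ c∈) (∈-map⁺ _ c∈′) refl) refl

-- The colours of a bicoloured part with matching number j: what matters for the rest
-- of the listing is the set of colours on either level, and these two sets can be
-- any sets of the right sizes with at most j common elements.
record Block (i r s j : ℕ) (es : List Entry) : Set where
  field
    shared lower upper : List ℕ
    unique   : Unique (shared ++ lower ++ upper)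
    lower≡   : length shared + length lower ≡ r
    upper≡   : length shared + length upper ≡ s
    shared≤  : length shared ≤ j
    entries  : es ↭ at i (shared ++ lower) ++ at (suc i) (shared ++ upper)

Unique-++⁻ : ∀ {A : Set} (xs : List A) {ys} → Unique (xs ++ ys) → Unique xs × Unique ys × (∀ {x} → x ∈ xs → x ∉ ys)
Unique-++⁻ []       u        = [] , u , λ ()
Unique-++⁻ (x ∷ xs) {ys} (x∉ ∷ u) =
  let uxs , uys , disjoint = Unique-++⁻ xs u in
  All.++⁻ˡ xs x∉ ∷ uxs , uys , λ { (here refl) x∈ → All.lookup (All.++⁻ʳ xs x∉) x∈ refl ; (there x∈) → disjoint x∈ }

filter-split : ∀ {A : Set} {P : Pred A 0ℓ} (P? : Decidable P) xs → xs ↭ filter P? xs ++ filter (¬? ∘ P?) xs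
filter-split P? []       = ↭-refl
filter-split P? (x ∷ xs) with P? x
... | yes _ = Perm.prep x (filter-split P? xs)
... | no  _ = ↭-trans (Perm.prep x (filter-split P? xs)) (↭-sym (shift x (filter P? xs) _))

common : List ℕ → List ℕ → List ℕ
common as bs = filter (_∈? bs) as

module _ {i r s j : ℕ} {as bs : List ℕ} (as-unique : Unique as) (bs-unique : Unique bs) where

  toBlock : length as ≡ r → length bs ≡ s → length (common as bs) ≤ j → ∀ {es} → es ↭ at i as ++ at (suc i) bs → Block i r s j es
  toBlock as≡r bs≡s common≤j es↭ = record
    { shared = common as bs ; lower = lower ; upper = upper
    ; unique = Unique.++⁺ (Unique.filter⁺ (_∈? bs) as-unique)
        (Unique.++⁺ (Unique.filter⁺ (¬? ∘ (_∈? bs)) as-unique) (Unique.filter⁺ (¬? ∘ (_∈? as)) bs-unique)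
          λ (c∈ , c∈′) → proj₂ (in-upper c∈′) (proj₁ (in-lower c∈)))
        λ (c∈ , c∈′) → case ∈-++⁻ lower c∈′ of λ
          { (inj₁ c∈l) → proj₂ (in-lower c∈l) (proj₂ (in-common c∈))
          ; (inj₂ c∈u) → proj₂ (in-upper c∈u) (proj₁ (in-common c∈)) }
    ; lower≡ = trans (sym (length-++ (common as bs))) (trans (↭-length (↭-sym as↭)) as≡r)
    ; upper≡ = trans (sym (length-++ (common as bs))) (trans (↭-length (↭-sym bs↭)) bs≡s)
    ; shared≤ = common≤j
    ; entries = ↭-trans es↭ (Perm.++⁺ (Perm.map⁺ (i ,_) as↭) (Perm.map⁺ (suc i ,_) bs↭)) }
    where
    lower = filter (¬? ∘ (_∈? bs)) as
    upper = filter (¬? ∘ (_∈? as)) bs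
    in-common : ∀ {c} → c ∈ common as bs → c ∈ as × c ∈ bs
    in-common = ∈-filter⁻ (_∈? bs)
    in-lower : ∀ {c} → c ∈ lower → c ∈ as × c ∉ bs
    in-lower = ∈-filter⁻ (¬? ∘ (_∈? bs))
    in-upper : ∀ {c} → c ∈ upper → c ∈ bs × c ∉ as
    in-upper = ∈-filter⁻ (¬? ∘ (_∈? as))
    as↭ : as ↭ common as bs ++ lower
    as↭ = filter-split (_∈? bs) as
    common↭ : filter (_∈? as) bs ↭ common as bs
    common↭ = unique-↭ (Unique.filter⁺ (_∈? as) bs-unique) (Unique.filter⁺ (_∈? bs) as-unique)
      (λ c∈ → let c∈bs , c∈as = ∈-filter⁻ (_∈? as) {xs = bs} c∈ in ∈-filter⁺ (_∈? bs) c∈as c∈bs)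
      (λ c∈ → let c∈as , c∈bs = in-common c∈ in ∈-filter⁺ (_∈? as) c∈bs c∈as)
    bs↭ : bs ↭ common as bs ++ upper
    bs↭ = ↭-trans (filter-split (_∈? as) bs) (Perm.++⁺ʳ upper common↭)

module _ {i r s : ℕ} (H : BicolouredGraph r s) where

  private j = maxCommon H

  -- A colour on both levels belongs to exactly one lower and one upper vertex, and these are
  -- joined. The shared colours thus give a matching of `H`, and there are at most `maxCommon H` of
  -- them.
  partColouring⇒block : ∀ {es} → PartColouring (double i r s H) es → Block i r s j es
  partColouring⇒block (g , h , g-inj , h-inj , edge , refl) =
    toBlock (Unique.map⁺ g-inj (Unique.allFin⁺ r)) (Unique.map⁺ h-inj (Unique.allFin⁺ s))
      (trans (length-map g (allFin r)) (length-tabulate id)) (trans (length-map h (allFin s)) (length-tabulate id))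
      (subst (_≤ j) size (matching-≤-maxCommon H matching))
      (↭-reflexive (cong₂ _++_ (map-∘ (allFin r)) (map-∘ (allFin s))))
    where
    as = map g (allFin r)
    bs = map h (allFin s)
    partners : ∀ cs → Unique cs → (∀ {c} → c ∈ cs → c ∈ as × c ∈ bs) → Σ[ ps ∈ List (Fin r × Fin s) ]
               map (g ∘ proj₁) ps ≡ cs × map (h ∘ proj₂) ps ≡ cs × (∀ {x y} → (x , y) ∈ ps → g x ≡ h y)
    partners []       _        _  = [] , refl , refl , λ ()
    partners (c ∷ cs) (_ ∷ u) ⊆ with ∈-map⁻ g (proj₁ (⊆ (here refl))) | ∈-map⁻ h (proj₂ (⊆ (here refl))) | partners cs u (⊆ ∘ there)
    ... | x , _ , eq | y , _ , eq′ | ps , rows , cols , same = (x , y) ∷ ps ,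
      cong₂ _∷_ (sym eq) rows , cong₂ _∷_ (sym eq′) cols ,
      λ { (here refl) → trans (sym eq) eq′ ; (there p∈) → same p∈ }
    cs = common as bs
    cs-unique : Unique cs
    cs-unique = Unique.filter⁺ (_∈? bs) (Unique.map⁺ g-inj (Unique.allFin⁺ r))
    result = partners cs cs-unique (∈-filter⁻ (_∈? bs))
    ps = proj₁ result
    matching : Matching H
    matching = record
      { pairs = ps
      ; edge = λ p∈ → edge (proj₂ (proj₂ (proj₂ result)) p∈)
      ; uniqueRows = Unique.map⁻ {f = g} (subst Unique (trans (sym (proj₁ (proj₂ result))) (map-∘ ps)) cs-unique)
      ; uniqueCols = Unique.map⁻ {f = h} (subst Unique (trans (sym (proj₁ (proj₂ (proj₂ result)))) (map-∘ ps)) cs-unique) }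
    size : length ps ≡ length cs
    size = trans (sym (length-map (g ∘ proj₁) ps)) (cong length (proj₁ (proj₂ result)))

  prescribe : ∀ {n} (xs : List (Fin n)) (cs : List ℕ) → Unique xs → length xs ≡ length cs →
              Σ[ g ∈ (Fin n → ℕ) ] map g xs ≡ cs
  prescribe []       []       _ _ = (λ _ → 0) , refl
  prescribe (x ∷ xs) (c ∷ cs) (x∉ ∷ u) len with prescribe xs cs u (suc-injective len)
  ... | g , eq = g′ , cong₂ _∷_ g′-x (trans (map-cong-local (All.map g′-≢ x∉)) eq)
    where
    g′ : _ → ℕ
    g′ y with x Fin.≟ y
    ... | yes _ = c
    ... | no  _ = g y
    g′-x : g′ x ≡ c
    g′-x with x Fin.≟ x
    ... | yes _  = refl
    ... | no x≢x = contradiction refl x≢x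
    g′-≢ : ∀ {y} → x ≢ y → g′ y ≡ g y
    g′-≢ {y} x≢y with x Fin.≟ y
    ... | yes x≡y = contradiction x≡y x≢y
    ... | no _    = refl

  prescribeBijectively : ∀ {n} (xs : List (Fin n)) (cs ds : List ℕ) → Unique xs → Unique (cs ++ ds) →
    length xs ≡ length cs → length cs + length ds ≡ n →
    Σ[ g ∈ (Fin n → ℕ) ] (∀ {x y} → g x ≡ g y → x ≡ y) × map g xs ≡ cs × map g (allFin n) ↭ cs ++ ds
  prescribeBijectively {n} xs cs ds u u′ len len′ =
    g , (λ {x} {y} → injective x y) , map-xs , ↭-trans (Perm.map⁺ g (↭-sym (completion u))) (↭-reflexive eq)
    where
    len″ : length (xs ++ unused xs) ≡ length (cs ++ ds)
    len″ = trans (↭-length (completion u)) (trans (length-tabulate id) (trans (sym len′) (sym (length-++ cs))))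
    spec = prescribe (xs ++ unused xs) (cs ++ ds) (completion-unique u) len″
    g = proj₁ spec
    eq = proj₂ spec
    map-xs : map g xs ≡ cs
    map-xs = ++-prefix (map g xs) cs (trans (length-map g xs) len) (trans (sym (map-++ g xs (unused xs))) eq)
      where
      ++-prefix : ∀ as bs {as′ bs′ : List ℕ} → length as ≡ length bs → as ++ as′ ≡ bs ++ bs′ → as ≡ bs
      ++-prefix []       []       _ _  = refl
      ++-prefix (a ∷ as) (b ∷ bs) p eq = cong₂ _∷_ (proj₁ (∷-injective eq)) (++-prefix as bs (suc-injective p) (proj₂ (∷-injective eq)))
    injective : ∀ x y → g x ≡ g y → x ≡ y
    injective x y = unique-map⁻ (subst Unique (sym eq) u′) (∈-resp-↭ (↭-sym (completion u)) (∈-allFin x)) (∈-resp-↭ (↭-sym (completion u)) (∈-allFin y))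
      where
      unique-map⁻ : ∀ {zs} → Unique (map g zs) → ∀ {x y} → x ∈ zs → y ∈ zs → g x ≡ g y → x ≡ y
      unique-map⁻ _        (here refl) (here refl) _   = refl
      unique-map⁻ (z∉ ∷ _) (here refl) (there y∈)  eq  = contradiction eq (All.lookup z∉ (∈-map⁺ g y∈))
      unique-map⁻ (z∉ ∷ _) (there x∈)  (here refl) eq  = contradiction (sym eq) (All.lookup z∉ (∈-map⁺ g x∈))
      unique-map⁻ (_ ∷ u)  (there x∈)  (there y∈)  eq  = unique-map⁻ u x∈ y∈ eq

  -- The matching is cut down to as many edges as there are shared colours, and both ends of each
  -- edge receive one of these. All other vertices receive colours private to their level, so a
  -- repeated colour occurs only along an edge of the matching.
  realizeBlock : (m : Matching H) → ∀ {es} → Block i r s (length (Matching.pairs m)) es → ∃[ fs ] es ↭ fs × PartColouring (double i r s H) fs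
  realizeBlock matching {es} block =
    _ , ↭-trans entries (Perm.++⁺ (colours g g↭) (colours h h↭)) , g , h , g-inj , h-inj , edge′ , refl
    where
    open Block block
    open Matching matching
    m = length shared
    ps = take m pairs
    length-ps : length ps ≡ m
    length-ps = trans (length-take m pairs)
      (m≤n⇒m⊓n≡m shared≤)
    shared-unique = proj₁ (Unique-++⁻ shared unique)
    rest-unique = proj₁ (proj₂ (Unique-++⁻ shared unique))
    shared-disjoint = proj₂ (proj₂ (Unique-++⁻ shared unique))
    lower-unique : Unique (shared ++ lower)
    lower-unique = Unique.++⁺ shared-unique (proj₁ (Unique-++⁻ lower rest-unique)) λ (c∈ , c∈′) → shared-disjoint c∈ (∈-++⁺ˡ c∈′)
    upper-unique : Unique (shared ++ upper)
    upper-unique = Unique.++⁺ shared-unique (proj₁ (proj₂ (Unique-++⁻ lower rest-unique))) λ (c∈ , c∈′) → shared-disjoint c∈ (∈-++⁺ʳ lower c∈′)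
    rows = prescribeBijectively (map proj₁ ps) shared lower
      (subst Unique (take-map m pairs) (Unique.take⁺ m uniqueRows)) lower-unique (trans (length-map proj₁ ps) length-ps) lower≡
    cols = prescribeBijectively (map proj₂ ps) shared upper
      (subst Unique (take-map m pairs) (Unique.take⁺ m uniqueCols)) upper-unique (trans (length-map proj₂ ps) length-ps) upper≡
    g = proj₁ rows
    h = proj₁ cols
    g-inj : ∀ {x y} → g x ≡ g y → x ≡ y
    g-inj = proj₁ (proj₂ rows)
    h-inj : ∀ {x y} → h x ≡ h y → x ≡ y
    h-inj = proj₁ (proj₂ cols)
    g↭ = proj₂ (proj₂ (proj₂ rows))
    h↭ = proj₂ (proj₂ (proj₂ cols))
    colours : ∀ {n l cs} (f : Fin n → ℕ) → map f (allFin n) ↭ cs → at l cs ↭ map (λ x → l , f x) (allFin n)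
    colours {n} {l} f p = ↭-trans (Perm.map⁺ (l ,_) (↭-sym p)) (↭-reflexive (sym (map-∘ (allFin n))))
    both-shared : ∀ {c} → c ∈ shared ++ lower → c ∈ shared ++ upper → c ∈ shared
    both-shared c∈ c∈′ with ∈-++⁻ shared c∈ | ∈-++⁻ shared c∈′
    ... | inj₁ c∈s | _        = c∈s
    ... | inj₂ _   | inj₁ c∈s = c∈s
    ... | inj₂ c∈l | inj₂ c∈u = contradiction c∈u (proj₂ (proj₂ (Unique-++⁻ lower rest-unique)) c∈l)
    paired : ∀ qs {ds} → map g (map proj₁ qs) ≡ ds → map h (map proj₂ qs) ≡ ds → ∀ {x y} → g x ∈ ds → g x ≡ h y → (x , y) ∈ qs
    paired ((x , y) ∷ qs) eq eq′ (here p) same with refl , _ ← ∷-injective eq | p′ , _ ← ∷-injective eq′ =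
      here (cong₂ _,_ (g-inj p) (h-inj (trans (sym same) (trans p (sym p′)))))
    paired ((x , y) ∷ qs) eq eq′ (there p) same with refl , eqs ← ∷-injective eq | _ , eqs′ ← ∷-injective eq′ =
      there (paired qs eqs eqs′ p same)
    edge′ : ∀ {x y} → g x ≡ h y → Edge H x y
    edge′ {x} {y} same = edge (take-⊆ (paired ps (proj₁ (proj₂ (proj₂ rows))) (proj₁ (proj₂ (proj₂ cols)))
      (both-shared (∈-resp-↭ g↭ (∈-map⁺ g (∈-allFin x)))
        (subst (_∈ shared ++ upper) (sym same) (∈-resp-↭ h↭ (∈-map⁺ h (∈-allFin y))))) same))
      where
      take-⊆ : ∀ {p} → p ∈ ps → p ∈ pairs
      take-⊆ p∈ = subst (_ ∈_) (take++drop≡id m pairs) (∈-++⁺ˡ p∈)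

  block⇒partColouring : ∀ {es} → Block i r s j es → ∃[ fs ] es ↭ fs × PartColouring (double i r s H) fs
  block⇒partColouring block = let m , size = maxCommon-matching H in
    realizeBlock m (subst (λ j → Block i r s j _) (sym size) block)

at-word : ∀ {l cs m} → length cs ≡ m → Unique cs → Word (replicate m (single l)) (at l cs)
at-word refl = replicate-word

module _ {i r s j : ℕ} where

  private
    Lower Upper : ℕ → Listing
    Lower m = replicate m (single i)
    Upper m = replicate m (single (suc i))

  module _ {es} (block : Block i r s j es) where
    open Block block

    private
      shared-unique : Unique shared
      shared-unique = proj₁ (Unique-++⁻ shared unique)
      lower-unique : Unique lower
      lower-unique = proj₁ (Unique-++⁻ lower (proj₁ (proj₂ (Unique-++⁻ shared unique))))
      upper-unique : Unique upper
      upper-unique = proj₁ (proj₂ (Unique-++⁻ lower (proj₁ (proj₂ (Unique-++⁻ shared unique)))))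
      shared-lower : Disjoint shared lower
      shared-lower c∈ c∈′ = proj₂ (proj₂ (Unique-++⁻ shared unique)) c∈ (∈-++⁺ˡ c∈′)
      shared-upper : Disjoint shared upper
      shared-upper c∈ c∈′ = proj₂ (proj₂ (Unique-++⁻ shared unique)) c∈ (∈-++⁺ʳ lower c∈′)
      lower-upper : Disjoint lower upper
      lower-upper = proj₂ (proj₂ (Unique-++⁻ lower (proj₁ (proj₂ (Unique-++⁻ shared unique)))))

    -- The first `s ∸ j` upper vertices precede the lower ones and are incomparable with them, while
    -- the last `j` lie above all of them. Shared colours therefore go to the last group, and the
    -- first group uses only colours private to the upper level.
    block⇒word-upper : j ≤ s → ∃[ fs ] es ↭ fs × Word (Upper (s ∸ j) ++ Lower r ++ Upper j) fs
    block⇒word-upper j≤s = _ , es↭ ,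
      word-++ (at-word length-first (proj₁ split-unique))
        (word-++ (at-word (trans (length-++ shared) lower≡)
                    (Unique.++⁺ shared-unique lower-unique λ (c∈ , c∈′) → shared-lower c∈ c∈′))
                 (at-word length-second
                    (Unique.++⁺ (proj₁ (proj₂ split-unique)) shared-unique λ (c∈ , c∈′) → shared-upper c∈′ (second⊆upper c∈)))
                 at-compatible-below)
        λ x∈ y∈ → case ∈-++⁻ (at i (shared ++ lower)) y∈ of λ
          { (inj₁ y∈′) → at-compatible-disjoint first-lower x∈ y∈′
          ; (inj₂ y∈′) → at-compatible-disjoint first-second x∈ y∈′ }
      where
      -- There are `s ∸ length shared` private upper colours, which suffices because at most `j`
      -- colours are shared. The leftover ones fill the last group up to `j`.
      first  = take (s ∸ j) upper
      second = drop (s ∸ j) upper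
      upper≡++ : first ++ second ≡ upper
      upper≡++ = take++drop≡id (s ∸ j) upper
      first⊆upper : ∀ {c} → c ∈ first → c ∈ upper
      first⊆upper c∈ = subst (_ ∈_) upper≡++ (∈-++⁺ˡ c∈)
      second⊆upper : ∀ {c} → c ∈ second → c ∈ upper
      second⊆upper c∈ = subst (_ ∈_) upper≡++ (∈-++⁺ʳ first c∈)
      split-unique = Unique-++⁻ first (subst Unique (sym upper≡++) upper-unique)
      first-lower : Disjoint first (shared ++ lower)
      first-lower c∈ c∈′ = case ∈-++⁻ shared c∈′ of λ
        { (inj₁ c∈s) → shared-upper c∈s (first⊆upper c∈) ; (inj₂ c∈l) → lower-upper c∈l (first⊆upper c∈) }
      first-second : Disjoint first (second ++ shared)
      first-second c∈ c∈′ = case ∈-++⁻ second c∈′ of λ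
        { (inj₁ c∈₂) → proj₂ (proj₂ split-unique) c∈ c∈₂ ; (inj₂ c∈s) → shared-upper c∈s (first⊆upper c∈) }
      length-first : length first ≡ s ∸ j
      length-first = trans (length-take (s ∸ j) upper) (m≤n⇒m⊓n≡m (begin
        s ∸ j                       ≤⟨ ∸-monoʳ-≤ s shared≤ ⟩
        s ∸ length shared           ≡⟨ cong (_∸ length shared) upper≡ ⟨
        length shared + length upper ∸ length shared   ≡⟨ m+n∸m≡n (length shared) (length upper) ⟩
        length upper                ∎))
        where open ≤-Reasoning
      length-second : length (second ++ shared) ≡ j
      length-second = +-cancelˡ-≡ (s ∸ j) _ _ (begin
        s ∸ j + length (second ++ shared)               ≡⟨ cong (_+ length (second ++ shared)) length-first ⟨
        length first + length (second ++ shared)        ≡⟨ length-++ first ⟨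
        length (first ++ second ++ shared)              ≡⟨ cong length (++-assoc first second shared) ⟨
        length ((first ++ second) ++ shared)            ≡⟨ cong (λ us → length (us ++ shared)) upper≡++ ⟩
        length (upper ++ shared)                        ≡⟨ length-++ upper ⟩
        length upper + length shared                    ≡⟨ +-comm (length upper) (length shared) ⟩
        length shared + length upper                    ≡⟨ upper≡ ⟩
        s                                               ≡⟨ m∸n+n≡m j≤s ⟨
        s ∸ j + j                                       ∎)
        where open ≡-Reasoning
      upper↭ : shared ++ upper ↭ first ++ second ++ shared
      upper↭ = ↭-trans (Perm.++-comm shared upper)
        (↭-reflexive (trans (cong (_++ shared) (sym upper≡++)) (++-assoc first second shared)))
      es↭ : es ↭ at (suc i) first ++ at i (shared ++ lower) ++ at (suc i) (second ++ shared)
      es↭ = ↭-trans entries (↭-trans (Perm.++⁺ˡ (at i (shared ++ lower))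
        (↭-trans (Perm.map⁺ (suc i ,_) upper↭) (↭-reflexive (map-++ (suc i ,_) first (second ++ shared)))))
        (shifts (at i (shared ++ lower)) (at (suc i) first)))

    -- Here the first `j` lower vertices lie below all upper ones and take the shared colours,
    -- whereas the last `r ∸ j` follow the upper vertices and are incomparable with them.
    block⇒word-lower : j ≤ r → ∃[ fs ] es ↭ fs × Word (Lower j ++ Upper s ++ Lower (r ∸ j)) fs
    block⇒word-lower j≤r = _ , es↭ ,
      word-++ (at-word length-first
                 (Unique.++⁺ shared-unique (proj₁ split-unique) λ (c∈ , c∈′) → shared-lower c∈ (first⊆lower c∈′)))
        (word-++ (at-word (trans (length-++ shared) upper≡)
                    (Unique.++⁺ shared-unique upper-unique λ (c∈ , c∈′) → shared-upper c∈ c∈′))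
                 (at-word length-second (proj₁ (proj₂ split-unique)))
                 (at-compatible-disjoint upper-second))
        λ x∈ y∈ → case ∈-++⁻ (at (suc i) (shared ++ upper)) y∈ of λ
          { (inj₁ y∈′) → at-compatible-below x∈ y∈′
          ; (inj₂ y∈′) → at-compatible-disjoint first-second x∈ y∈′ }
      where
      -- The number of private lower colours needed to fill the first group up to `j`.
      k = j ∸ length shared
      first  = take k lower
      second = drop k lower
      lower≡++ : first ++ second ≡ lower
      lower≡++ = take++drop≡id k lower
      first⊆lower : ∀ {c} → c ∈ first → c ∈ lower
      first⊆lower c∈ = subst (_ ∈_) lower≡++ (∈-++⁺ˡ c∈)
      second⊆lower : ∀ {c} → c ∈ second → c ∈ lower
      second⊆lower c∈ = subst (_ ∈_) lower≡++ (∈-++⁺ʳ first c∈)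
      split-unique = Unique-++⁻ first (subst Unique (sym lower≡++) lower-unique)
      upper-second : Disjoint (shared ++ upper) second
      upper-second c∈ c∈′ = case ∈-++⁻ shared c∈ of λ
        { (inj₁ c∈s) → shared-lower c∈s (second⊆lower c∈′) ; (inj₂ c∈u) → lower-upper (second⊆lower c∈′) c∈u }
      first-second : Disjoint (shared ++ first) second
      first-second c∈ c∈′ = case ∈-++⁻ shared c∈ of λ
        { (inj₁ c∈s) → shared-lower c∈s (second⊆lower c∈′) ; (inj₂ c∈₁) → proj₂ (proj₂ split-unique) c∈₁ c∈′ }
      length-first : length (shared ++ first) ≡ j
      length-first = trans (length-++ shared) (trans (cong (length shared +_)
        (trans (length-take k lower) (m≤n⇒m⊓n≡m (m≤n+o⇒m∸n≤o j (length shared) (subst (j ≤_) (sym lower≡) j≤r)))))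
        (m+[n∸m]≡n shared≤))
      length-second : length second ≡ r ∸ j
      length-second = +-cancelˡ-≡ j _ _ (begin
        j + length second                                ≡⟨ cong (_+ length second) length-first ⟨
        length (shared ++ first) + length second         ≡⟨ length-++ (shared ++ first) ⟨
        length ((shared ++ first) ++ second)             ≡⟨ cong length (++-assoc shared first second) ⟩
        length (shared ++ first ++ second)               ≡⟨ cong (λ ls → length (shared ++ ls)) lower≡++ ⟩
        length (shared ++ lower)                         ≡⟨ length-++ shared ⟩
        length shared + length lower                     ≡⟨ lower≡ ⟩
        r                                                ≡⟨ m+[n∸m]≡n j≤r ⟨
        j + (r ∸ j)                                      ∎)
        where open ≡-Reasoning
      lower≡′ : shared ++ lower ≡ (shared ++ first) ++ second
      lower≡′ = trans (cong (shared ++_) (sym lower≡++)) (sym (++-assoc shared first second))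
      es↭ : es ↭ at i (shared ++ first) ++ at (suc i) (shared ++ upper) ++ at i second
      es↭ = ↭-trans entries (↭-trans (↭-reflexive (trans
        (cong (_++ at (suc i) (shared ++ upper)) (trans (cong (at i) lower≡′) (map-++ (i ,_) (shared ++ first) second)))
        (++-assoc (at i (shared ++ first)) (at i second) (at (suc i) (shared ++ upper)))))
        (Perm.++⁺ˡ (at i (shared ++ first)) (Perm.++-comm (at i second) (at (suc i) (shared ++ upper)))))

  -- Colours of the first group are excluded from the lower level, so every common colour is among
  -- those of the last `j` upper vertices. This bounds the number of shared colours.
  word-upper⇒block : j ≤ s → ∀ {fs} → Word (Upper (s ∸ j) ++ Lower r ++ Upper j) fs → Block i r s j fs
  word-upper⇒block j≤s word with word-split (Upper (s ∸ j)) word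
  ... | _ , _ , refl , word₁ , word′ , compatible₁ with word-split (Lower r) word′
  ... | _ , _ , refl , word₂ , word₃ , compatible₂
    with replicate-word⁻ (s ∸ j) word₁ | replicate-word⁻ r word₂ | replicate-word⁻ j word₃
  ... | first , refl , first-unique , length-first | lower , refl , lower-unique , length-lower
      | second , refl , second-unique , length-second =
    toBlock lower-unique upper-unique length-lower
      (trans (length-++ first) (trans (cong₂ _+_ length-first length-second) (m∸n+n≡m j≤s)))
      (subst (length (common lower (first ++ second)) ≤_) length-second
        (unique-⊆⇒length-≤ (Unique.filter⁺ (_∈? (first ++ second)) lower-unique) common⊆second))
      (↭-trans (shifts (at (suc i) first) (at i lower))
        (↭-reflexive (cong (at i lower ++_) (sym (map-++ (suc i ,_) first second)))))
    where
    first-lower : Disjoint first lower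
    first-lower = at-disjoint-above λ x∈ y∈ → compatible₁ x∈ (∈-++⁺ˡ y∈)
    upper-unique : Unique (first ++ second)
    upper-unique = Unique.++⁺ first-unique second-unique λ (c∈ , c∈′) →
      at-disjoint-same (λ x∈ y∈ → compatible₁ x∈ (∈-++⁺ʳ (at i lower) y∈)) c∈ c∈′
    common⊆second : ∀ {c} → c ∈ filter (_∈? (first ++ second)) lower → c ∈ second
    common⊆second c∈ with ∈-filter⁻ (_∈? (first ++ second)) {xs = lower} c∈
    ... | c∈l , c∈u with ∈-++⁻ first c∈u
    ...   | inj₁ c∈₁ = contradiction c∈l (first-lower c∈₁)
    ...   | inj₂ c∈₂ = c∈₂

  -- Colours of the last group are excluded from the upper level, so every common colour is among
  -- those of the first `j` lower vertices.
  word-lower⇒block : j ≤ r → ∀ {fs} → Word (Lower j ++ Upper s ++ Lower (r ∸ j)) fs → Block i r s j fs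
  word-lower⇒block j≤r word with word-split (Lower j) word
  ... | _ , _ , refl , word₁ , word′ , compatible₁ with word-split (Upper s) word′
  ... | _ , _ , refl , word₂ , word₃ , compatible₂
    with replicate-word⁻ j word₁ | replicate-word⁻ s word₂ | replicate-word⁻ (r ∸ j) word₃
  ... | first , refl , first-unique , length-first | upper , refl , upper-unique , length-upper
      | second , refl , second-unique , length-second =
    toBlock lower-unique upper-unique
      (trans (length-++ first) (trans (cong₂ _+_ length-first length-second) (m+[n∸m]≡n j≤r))) length-upper
      (subst (length (common (first ++ second) upper) ≤_) length-first
        (unique-⊆⇒length-≤ (Unique.filter⁺ (_∈? upper) lower-unique) common⊆first))
      (↭-trans (Perm.++⁺ˡ (at i first) (Perm.++-comm (at (suc i) upper) (at i second)))
        (↭-reflexive (trans (sym (++-assoc (at i first) (at i second) (at (suc i) upper)))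
          (cong (_++ at (suc i) upper) (sym (map-++ (i ,_) first second))))))
    where
    upper-second : Disjoint upper second
    upper-second = at-disjoint-above compatible₂
    lower-unique : Unique (first ++ second)
    lower-unique = Unique.++⁺ first-unique second-unique λ (c∈ , c∈′) →
      at-disjoint-same (λ x∈ y∈ → compatible₁ x∈ (∈-++⁺ʳ (at (suc i) upper) y∈)) c∈ c∈′
    common⊆first : ∀ {c} → c ∈ filter (_∈? upper) (first ++ second) → c ∈ first
    common⊆first c∈ with ∈-filter⁻ (_∈? upper) {xs = first ++ second} c∈
    ... | c∈l , c∈u with ∈-++⁻ first c∈l
    ...   | inj₁ c∈₁ = c∈₁
    ...   | inj₂ c∈₂ = contradiction c∈₂ (upper-second c∈u)

module _ {i r s : ℕ} (H : BicolouredGraph r s) where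

  block⇒word : ∀ {es} → Block i r s (maxCommon H) es → ∃[ fs ] es ↭ fs × Word (replacePart (double i r s H)) fs
  block⇒word block with s ≤? r
  ... | yes _ = block⇒word-upper block (≤-trans (maxCommon-≤ H) (m⊓n≤n r s))
  ... | no  _ = block⇒word-lower block (≤-trans (maxCommon-≤ H) (m⊓n≤m r s))

  word⇒block : ∀ {fs} → Word (replacePart (double i r s H)) fs → Block i r s (maxCommon H) fs
  word⇒block word with s ≤? r
  ... | yes _ = word-upper⇒block (≤-trans (maxCommon-≤ H) (m⊓n≤n r s)) word
  ... | no  _ = word-lower⇒block (≤-trans (maxCommon-≤ H) (m⊓n≤m r s)) word

replacePart⁺ : ∀ p {es} → PartColouring p es → ∃[ fs ] es ↭ fs × Word (replacePart p) fs
replacePart⁺ (single i)       (c , refl) = _ , ↭-refl , cons (c , refl) [] λ _ ()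
replacePart⁺ (double i r s H) col        = block⇒word H (partColouring⇒block H col)

replacePart⁻ : ∀ p {fs} → Word (replacePart p) fs → ∃[ es ] fs ↭ es × PartColouring p es
replacePart⁻ (single i)       (cons (c , refl) [] _) = _ , ↭-refl , c , refl
replacePart⁻ (double i r s H) word                   = block⇒partColouring H (word⇒block H word)

compatible-resp-↭ : ∀ {es es′ fs fs′} → es ↭ es′ → fs ↭ fs′ → (∀ {x y} → x ∈ es → y ∈ fs → Compatible x y) →
                    ∀ {x y} → x ∈ es′ → y ∈ fs′ → Compatible x y
compatible-resp-↭ es↭ fs↭ compatible x∈ y∈ = compatible (∈-resp-↭ (↭-sym es↭) x∈) (∈-resp-↭ (↭-sym fs↭) y∈)

replaceParts⁺ : ∀ {L es} → Word L es → ∃[ fs ] es ↭ fs × Word (replaceParts L) fs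
replaceParts⁺ [] = [] , ↭-refl , []
replaceParts⁺ (cons {p} col word compatible) =
  let _ , es↭ , word₁ = replacePart⁺ p col
      _ , fs↭ , word₂ = replaceParts⁺ word
  in _ , Perm.++⁺ es↭ fs↭ , word-++ word₁ word₂ (compatible-resp-↭ es↭ fs↭ compatible)

replaceParts⁻ : ∀ L {fs} → Word (replaceParts L) fs → ∃[ es ] fs ↭ es × Word L es
replaceParts⁻ []      [] = [] , ↭-refl , []
replaceParts⁻ (p ∷ L) word with word-split (replacePart p) word
... | es , fs , refl , word₁ , word₂ , compatible =
  let _ , es↭ , col   = replacePart⁻ p word₁
      _ , fs↭ , word′ = replaceParts⁻ L word₂
  in _ , Perm.++⁺ es↭ fs↭ , cons col word′ (compatible-resp-↭ es↭ fs↭ compatible)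

module _ {L : Listing} {α : List ℕ} where

  listingColouring-replace : ListingColouring L α → ListingColouring (replaceParts L) α
  listingColouring-replace f =
    let _ , word , mult  = listingColouring⇒word f
        _ , es↭ , word′ = replaceParts⁺ word
    in word⇒listingColouring word′ (HasMultiplicities-resp-↭ {α} (Perm.map⁺ proj₂ es↭) mult)

  listingColouring-unreplace : ListingColouring (replaceParts L) α → ListingColouring L α
  listingColouring-unreplace f =
    let _ , word , mult  = listingColouring⇒word f
        _ , es↭ , word′ = replaceParts⁻ L word
    in word⇒listingColouring word′ (HasMultiplicities-resp-↭ {α} (Perm.map⁺ proj₂ es↭) mult)

-- Transfer from the Dyck path to the poset

DominatedWeights-resp-⇔ : ∀ {W W′ : List ℕ → Set} {μ} → (∀ {α} → W α → W′ α) → (∀ {α} → W′ α → W α) →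
                          DominatedWeights W μ → DominatedWeights W′ μ
DominatedWeights-resp-⇔ to from dw = record
  { boxClosed = record { perm = λ p → to ∘ perm p ∘ from ; box = λ y<x → to ∘ box y<x ∘ from }
  ; padding   = λ m → to ∘ padding m ∘ from
  ; dominated = dominated ∘ from
  ; total     = total ∘ from
  ; attained  = to attained }
  where
  open DominatedWeights dw
  open BoxClosed boxClosed

module _ {n} (P : FinPoset n) {μ} (greedyPartition : IsGreedyPartition P μ) where
  open IsGreedyPartition greedyPartition
  open FinPoset P using (_⊏_)

  private
    L′ = replaceParts listing

    module _ {α : List ℕ} where

      -- Only the existence of a colouring of each weight is transferred, not the number of such
      -- colourings. This is enough, since the support, and with it the Newton polytope, depends on
      -- existence alone.
      poset⇒path : GraphColouring (incomparabilityGraph P) α → GraphColouring (indifferenceGraph path) α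
      poset⇒path =
        colouring-push inc≅path (vertices-unique L′) (vertices-complete L′) (Unique.allFin⁺ size) ∈-allFin
        ∘ listingColouring-replace
        ∘ colouring-push (Isomorphic-incomparable P≅listing) (Unique.allFin⁺ n) ∈-allFin
            (vertices-unique listing) (vertices-complete listing)

      path⇒poset : GraphColouring (indifferenceGraph path) α → GraphColouring (incomparabilityGraph P) α
      path⇒poset =
        colouring-pull (Isomorphic-incomparable P≅listing) (Unique.allFin⁺ n) ∈-allFin
            (vertices-unique listing) (vertices-complete listing)
        ∘ listingColouring-unreplace
        ∘ colouring-pull inc≅path (vertices-unique L′) (vertices-complete L′) (Unique.allFin⁺ size) ∈-allFin

  poset-dominated : DominatedWeights (GraphColouring (incomparabilityGraph P)) μ
  poset-dominated = subst (DominatedWeights _) (sym μ≡λ)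
    (DominatedWeights-resp-⇔ path⇒poset poset⇒path (unitInterval-dominated (indifferenceGraph-unitInterval path)))

theorem1p3 : (k : ℕ) → k ≥ 1 →
    (∀ n (G : Graph n) → CoBipartite G →
    SNP (X G k) × Newton (X G k) ≐ Permutahedron k (λ-coBipartite G))
    × (∀ n (d : DyckPath n) →
    SNP (X (indifferenceGraph d) k)
    × Newton (X (indifferenceGraph d) k) ≐ Permutahedron k (λ-greedy d))
    × (∀ n (P : FinPoset n) → ThreePlusOneFree P → ∀ (μ : List ℕ) → IsGreedyPartition P μ →
    SNP (X (incomparabilityGraph P) k)
    × Newton (X (incomparabilityGraph P) k) ≐ Permutahedron k μ)
theorem1p3 k _ =
  (λ n G cobipartite → dominatedWeights⇒SNP×Newton G (cobipartite-dominated G cobipartite) k) ,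
  (λ n d → dominatedWeights⇒SNP×Newton (indifferenceGraph d) (unitInterval-dominated (indifferenceGraph-unitInterval d)) k) ,
  (λ n P _ μ greedyPartition → dominatedWeights⇒SNP×Newton (incomparabilityGraph P) (poset-dominated P greedyPartition) k)
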